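{- Let $\mathcal{I}$ be an ideal and let $n\ge 3$. Every $n$-$\mathcal{I}$-generic set computes an $n$-$COMP$-generic set.
   Context: Sets are subsets of $\omega$. A (Turing) ideal is a (countable) collection of sets closed under $\le_T$ and $\oplus$. Each ideal $\mathcal{I}$ is presented by a fixed exact pair $A_0,A_1$ (so $S\in\mathcal{I}$ iff $S\le_T A_0$ and $S\le_T A_1$), and $\Sigma^0_n(\mathcal{I})$ means $\Sigma^0_n(A_0\oplus A_1)$. $COMP$ is the ideal of computable sets (presented by a computable exact pair, so $\Sigma^0_n(COMP)=\Sigma^0_n$). A Mathias condition is a pair $(D,S)$ with $D$ finite, $S$ infinite, $\max D<\min S$; $(\widetilde D,\widetilde S)$ extends $(D,S)$ if $D\subseteq\widetilde D\subseteq D\cup S$ and $\widetilde S\subseteq S$. A set $X$ satisfies $(D,S)$ if $D\subseteq X\subseteq D\cup S$; $X$ meets a collection $\mathcal{C}$ of conditions if it satisfies a member of $\mathcal{C}$, and avoids $\mathcal{C}$ if it satisfies a condition with no extension in $\mathcal{C}$. An $\mathcal{I}$-condition is a Mathias condition $(D,S)$ with $S\in\mathcal{I}$. A set $G$ is $n$-$\mathcal{I}$-generic if it meets or avoids every $\Sigma^0_n(\mathcal{I})$-definable collection of $\mathcal{I}$-conditions. -}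

module Defs where

open import Data.Nat using (ℕ; zero; suc; _+_; _<_; _≤_; ⌊_/2⌋)
open import Data.Bool using (Bool; true; false; if_then_else_)
open import Data.Product using (Σ; ∃; _×_; _,_; proj₁; proj₂)
open import Data.Sum using (_⊎_)
open import Relation.Nullary using (¬_)
open import Relation.Binary.PropositionalEquality using (_≡_)

SetN : Set
SetN = ℕ → Bool

_∈ₛ_ : ℕ → SetN → Set
x ∈ₛ A = A x ≡ true

_⊆ₛ_ : SetN → SetN → Set
A ⊆ₛ B = ∀ x → x ∈ₛ A → x ∈ₛ B

∅ₛ : SetN
∅ₛ _ = false

_∪ₛ_ : SetN → SetN → SetN
(A ∪ₛ B) x = if A x then true else B x

_⊕_ : SetN → SetN → SetN
(A ⊕ B) zero = A zero
(A ⊕ B) (suc zero) = B zero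
(A ⊕ B) (suc (suc x)) = ((λ k → A (suc k)) ⊕ (λ k → B (suc k))) x

tri : ℕ → ℕ
tri zero = zero
tri (suc s) = tri s + suc s

⟨_,_⟩ : ℕ → ℕ → ℕ
⟨ a , b ⟩ = tri (a + b) + b

-- inverse of the pairing, enumerating (0,0),(1,0),(0,1),(2,0),(1,1),(0,2),...
unpair : ℕ → ℕ × ℕ
unpair zero = zero , zero
unpair (suc n) with unpair n
... | zero , b = suc b , zero
... | suc a , b = a , suc b

-- Oracle partial recursive functions (unary, via pairing).

data Code : Set where
  zer  : Code
  sucC : Code
  fstC : Code
  sndC : Code
  orc  : Code
  comp : Code → Code → Code
  prC  : Code → Code → Code
  rec  : Code → Code → Code
  mu   : Code → Code

χ : SetN → ℕ → ℕ
χ X x = if X x then 1 else 0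

data Ev (X : SetN) : Code → ℕ → ℕ → Set where
  ev-zer  : ∀ x → Ev X zer x 0
  ev-suc  : ∀ x → Ev X sucC x (suc x)
  ev-fst  : ∀ x → Ev X fstC x (proj₁ (unpair x))
  ev-snd  : ∀ x → Ev X sndC x (proj₂ (unpair x))
  ev-orc  : ∀ x → Ev X orc x (χ X x)
  ev-comp : ∀ {f g x y z} → Ev X g x y → Ev X f y z → Ev X (comp f g) x z
  ev-pr   : ∀ {f g x y z} → Ev X f x y → Ev X g x z → Ev X (prC f g) x ⟨ y , z ⟩
  ev-rec0 : ∀ {f g x y} → Ev X f x y → Ev X (rec f g) ⟨ x , 0 ⟩ y
  ev-recS : ∀ {f g x n v y} → Ev X (rec f g) ⟨ x , n ⟩ v →
            Ev X g ⟨ x , ⟨ n , v ⟩ ⟩ y → Ev X (rec f g) ⟨ x , suc n ⟩ y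
  ev-mu   : ∀ {f x n} → Ev X f ⟨ x , n ⟩ 0 →
            (∀ m → m < n → ∃ λ v → Ev X f ⟨ x , m ⟩ (suc v)) →
            Ev X (mu f) x n

-- A fixed effective Gödel numbering of programs (surjective).
decodeF : ℕ → ℕ → Code
decodeF zero _ = zer
decodeF (suc fuel) n with unpair n
... | zero , _ = zer
... | suc zero , _ = sucC
... | suc (suc zero) , _ = fstC
... | suc (suc (suc zero)) , _ = sndC
... | suc (suc (suc (suc zero))) , _ = orc
... | suc (suc (suc (suc (suc zero)))) , p =
        comp (decodeF fuel (proj₁ (unpair p))) (decodeF fuel (proj₂ (unpair p)))
... | suc (suc (suc (suc (suc (suc zero))))) , p =
        prC (decodeF fuel (proj₁ (unpair p))) (decodeF fuel (proj₂ (unpair p)))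
... | suc (suc (suc (suc (suc (suc (suc zero)))))) , p =
        rec (decodeF fuel (proj₁ (unpair p))) (decodeF fuel (proj₂ (unpair p)))
... | suc (suc (suc (suc (suc (suc (suc (suc zero))))))) , p = mu (decodeF fuel p)
... | _ , _ = zer

decode : ℕ → Code
decode n = decodeF (suc n) n

Computes : SetN → Code → SetN → Set
Computes X c S = ∀ x → Ev X c x (χ S x)

_≤T_ : SetN → SetN → Set
S ≤T X = Σ Code λ c → Computes X c S

ΣQ ΠQ : ℕ → (ℕ → Set) → ℕ → Set
ΣQ zero P x = P x
ΣQ (suc n) P x = ∃ λ y → ΠQ n P ⟨ x , y ⟩
ΠQ zero P x = P x
ΠQ (suc n) P x = ∀ y → ΣQ n P ⟨ x , y ⟩

TotalC : SetN → Code → Set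
TotalC X c = ∀ x → ∃ λ y → Ev X c x y

-- W ⊆ ℕ is Σ⁰ₙ(X): W = { x : ∃y₁∀y₂… R(x,y₁,…,yₙ) } for an X-computable R
-- (given by a total X-computable function c, with R holding iff output is 0).
IsΣ : ℕ → SetN → (ℕ → Set) → Set
IsΣ n X W = Σ Code λ c → TotalC X c ×
  (∀ x → (W x → ΣQ n (λ z → Ev X c z 0) x) × (ΣQ n (λ z → Ev X c z 0) x → W x))

Ideal : Set₁
Ideal = SetN → Set

IsIdeal : Ideal → Set
IsIdeal I =
  (∀ S T → I T → S ≤T T → I S) ×
  (∀ S T → I S → I T → I (S ⊕ T)) ×
  (Σ (ℕ → SetN) λ f → ∀ S → (I S → ∃ λ i → ∀ x → f i x ≡ S x)
                          × ((∃ λ i → ∀ x → f i x ≡ S x) → I S))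

ExactPair : Ideal → SetN → SetN → Set
ExactPair I A₀ A₁ = ∀ S → (I S → S ≤T A₀ × S ≤T A₁) × (S ≤T A₀ × S ≤T A₁ → I S)

COMP : Ideal
COMP S = S ≤T ∅ₛ

Cond : Set
Cond = SetN × SetN

FiniteS : SetN → Set
FiniteS D = ∃ λ b → ∀ x → b ≤ x → D x ≡ false

InfiniteS : SetN → Set
InfiniteS S = ∀ m → ∃ λ x → m ≤ x × x ∈ₛ S

IsMathias : Cond → Set
IsMathias (D , S) = FiniteS D × InfiniteS S × (∀ x y → x ∈ₛ D → y ∈ₛ S → x < y)

ICond : Ideal → Cond → Set
ICond I (D , S) = IsMathias (D , S) × I S

_≼_ : Cond → Cond → Set
(D' , S') ≼ (D , S) = D ⊆ₛ D' × D' ⊆ₛ (D ∪ₛ S) × S' ⊆ₛ S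

Satisfies : SetN → Cond → Set
Satisfies X (D , S) = D ⊆ₛ X × X ⊆ₛ (D ∪ₛ S)

Collection : Set₁
Collection = Cond → Set

Meets : SetN → Collection → Set
Meets X C = Σ Cond λ c → C c × Satisfies X c

Avoids : Ideal → SetN → Collection → Set
Avoids I X C = Σ Cond λ c → ICond I c × Satisfies X c × (∀ c' → c' ≼ c → ¬ C c')

isOdd : ℕ → Bool
isOdd zero = false
isOdd (suc zero) = true
isOdd (suc (suc n)) = isOdd n

bit : ℕ → ℕ → Bool
bit d zero = isOdd d
bit d (suc x) = bit ⌊ d /2⌋ x

CanonIdx : ℕ → SetN → Set
CanonIdx d D = ∀ x → D x ≡ bit d x

IsIndex : Ideal → SetN → SetN → ℕ → Cond → Set
IsIndex I A₀ A₁ k (D , S) = ICond I (D , S) × (∃ λ d → ∃ λ e₀ → ∃ λ e₁ →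
  k ≡ ⟨ d , ⟨ e₀ , e₁ ⟩ ⟩ × CanonIdx d D ×
  Computes A₀ (decode e₀) S × Computes A₁ (decode e₁) S)

SigmaColl : ℕ → Ideal → SetN → SetN → Collection → Set₁
SigmaColl n I A₀ A₁ C = Σ (ℕ → Set) λ W → IsΣ n (A₀ ⊕ A₁) W ×
  (∀ k → (W k → Σ Cond λ c → C c × IsIndex I A₀ A₁ k c)
       × ((Σ Cond λ c → C c × IsIndex I A₀ A₁ k c) → W k))

-- n-I-generic (I presented by the exact pair A₀ , A₁)
Generic : ℕ → Ideal → SetN → SetN → SetN → Set₁
Generic n I A₀ A₁ G = (C : Collection) → (∀ c → C c → ICond I c) →
  SigmaColl n I A₀ A₁ C → Meets G C ⊎ Avoids I G C

{-# OPTIONS --safe #-}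

-- Genericity for the collection of all conditions satisfying a Σ⁰ₙ(I) sentence
-- decides that sentence, so the classical case distinctions below are available.
--
-- Let Z ∈ I with Z ≤T G.  Call x < y < w marked if some program below x halts
-- with oracle Z between the stages y and w.  Either G satisfies a condition
-- whose reservoir has no marked triples: then this reservoir and G both compute
-- the jump Z′, and the argument is repeated with Z′.  Or some condition forces
-- every later reservoir to contain marked triples.
--
-- If the first case occurs n + 2 times, starting from ∅, then G computes ∅⁽ⁿ⁺²⁾,
-- which suffices to build an n-COMP-generic set by finite extensions.
--
-- Otherwise marks can both be produced and be avoided in every reservoir, so the
-- number of elements of G read before a mark transmits arbitrary indices of
-- computable conditions.  H collects the finite parts of the transmitted
-- conditions; their infinite parts constrain H only as long as the gaps of G are
-- large enough to confirm totality, infinity and inclusion.  A wrong index is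
-- eventually refuted, while for a correct one the reservoir can be thinned so
-- that it is confirmed forever.  Hence every extension of the condition imposed
-- on H is induced by an extension of the condition on G, and H inherits the
-- genericity of G.
module Submission where

open import Defs
open import Data.Bool using (Bool; true; false; if_then_else_; not; _∧_; _∨_)
open import Data.Empty using (⊥-elim)
open import Data.Nat using (ℕ; zero; suc; pred; _+_; _∸_; _⊔_; _≤_; _<_; z≤n; s≤s; _≡ᵇ_; _<ᵇ_; ⌊_/2⌋)
open import Data.Nat.Properties
open import Data.Nat.Induction using (<-rec)
open import Data.Product using (Σ; ∃; _×_; _,_; proj₁; proj₂)
open import Data.Sum using (_⊎_; inj₁; inj₂)
open import Data.Unit using (⊤; tt)
open import Function using (_∘_; case_of_)
open import Relation.Binary.Definitions using (tri<; tri≈; tri>)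
open import Relation.Binary.PropositionalEquality using (_≡_; refl; sym; trans; cong; cong₂; subst; module ≡-Reasoning)
open import Relation.Nullary using (¬_; yes; no)

-- Pairing

-- The obstacle is that the reservoirs constraining `G` lie in the ideal and need not have infinite
-- computable subsets, so they say nothing directly about computable conditions. Computable
-- reservoirs have to be communicated to `H` by finite information, and this takes a signal that
-- every reservoir can postpone and none can suppress. Halting times provide it. For fixed `x`, the
-- programs below `x` that halt at all do so by some stage, so nothing is marked once `y` is large
-- compared with `x`. Yet a reservoir free of marks bounds halting times and so computes the jump;
-- the case distinction is whether the signal can be suppressed. The receiver cannot recognise
-- correct indices, correctness being Π⁰₂. An index is therefore only believed, pair by pair of
-- elements of `G`, while bounded tests succeed. That a reservoir confirms the latest index at all
-- its pairs is a universal statement about the reservoir, so requiring it leaves a collection Σ⁰ₙ.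
-- The `n + 2` jumps arise as follows: one evaluates programs that may be partial, `n` handle the
-- quantifiers of a Σ⁰ₙ predicate, and one asks whether some extension satisfies it.

opaque
  π₁ π₂ : ℕ → ℕ
  π₁ n = proj₁ (unpair n)
  π₂ n = proj₂ (unpair n)

  unpair≡π : ∀ n → unpair n ≡ (π₁ n , π₂ n)
  unpair≡π n = refl

unpair-step : ℕ × ℕ → ℕ × ℕ
unpair-step (zero , b) = suc b , zero
unpair-step (suc a , b) = a , suc b

unpair-suc : ∀ n → unpair (suc n) ≡ unpair-step (unpair n)
unpair-suc n with unpair n
... | zero , b = refl
... | suc a , b = refl

-- Induction along the enumeration: on the antidiagonal `s` the second component counts the steps
-- taken, and `(s , 0)` comes right after `(0 , s - 1)`, the last pair of the preceding
-- antidiagonal.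
unpair-diagonal : ∀ s b a → a + b ≡ s → unpair (tri s + b) ≡ (a , b)
unpair-diagonal zero zero zero _ = refl
unpair-diagonal (suc s) zero a eq
  rewrite +-identityʳ (tri s + suc s) | +-suc (tri s) s | unpair-suc (tri s + s)
        | unpair-diagonal s s 0 refl = cong (_, 0) (trans (sym eq) (+-identityʳ a))
unpair-diagonal s (suc b) a eq
  rewrite +-suc (tri s) b | unpair-suc (tri s + b)
        | unpair-diagonal s b (suc a) (trans (sym (+-suc a b)) eq) = refl

unpair-⟨⟩ : ∀ a b → unpair ⟨ a , b ⟩ ≡ (a , b)
unpair-⟨⟩ a b = unpair-diagonal (a + b) b a refl

opaque
  unfolding π₁

  π₁-⟨⟩ : ∀ a b → π₁ ⟨ a , b ⟩ ≡ a
  π₁-⟨⟩ a b = cong proj₁ (unpair-⟨⟩ a b)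

  π₂-⟨⟩ : ∀ a b → π₂ ⟨ a , b ⟩ ≡ b
  π₂-⟨⟩ a b = cong proj₂ (unpair-⟨⟩ a b)

  ⟨π₁,π₂⟩ : ∀ n → ⟨ π₁ n , π₂ n ⟩ ≡ n
  ⟨π₁,π₂⟩ zero = refl
  ⟨π₁,π₂⟩ (suc n) with unpair n | ⟨π₁,π₂⟩ n
  ... | zero , b | eq rewrite +-identityʳ b | +-identityʳ (tri b + suc b) | +-suc (tri b) b = cong suc eq
  ... | suc a , b | eq rewrite +-suc a b | +-suc (tri (a + b) + suc (a + b)) b = cong suc eq

  ev-π₁ : ∀ {X} x → Ev X fstC x (π₁ x)
  ev-π₁ = ev-fst

  ev-π₂ : ∀ {X} x → Ev X sndC x (π₂ x)
  ev-π₂ = ev-snd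

⟨⟩-injective : ∀ {a b c d} → ⟨ a , b ⟩ ≡ ⟨ c , d ⟩ → a ≡ c × b ≡ d
⟨⟩-injective {a} {b} {c} {d} eq =
  trans (sym (π₁-⟨⟩ a b)) (trans (cong π₁ eq) (π₁-⟨⟩ c d)) ,
  trans (sym (π₂-⟨⟩ a b)) (trans (cong π₂ eq) (π₂-⟨⟩ c d))

n≤tri : ∀ n → n ≤ tri n
n≤tri zero = z≤n
n≤tri (suc n) = m≤n+m (suc n) (tri n)

m+n≤⟨m,n⟩ : ∀ m n → m + n ≤ ⟨ m , n ⟩
m+n≤⟨m,n⟩ m n = ≤-trans (n≤tri (m + n)) (m≤m+n _ n)

m≤⟨m,n⟩ : ∀ m n → m ≤ ⟨ m , n ⟩
m≤⟨m,n⟩ m n = ≤-trans (m≤m+n m n) (m+n≤⟨m,n⟩ m n)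

n≤⟨m,n⟩ : ∀ m n → n ≤ ⟨ m , n ⟩
n≤⟨m,n⟩ m n = ≤-trans (m≤n+m n m) (m+n≤⟨m,n⟩ m n)

π₁≤ : ∀ n → π₁ n ≤ n
π₁≤ n = subst (π₁ n ≤_) (⟨π₁,π₂⟩ n) (m≤⟨m,n⟩ (π₁ n) (π₂ n))

π₂≤ : ∀ n → π₂ n ≤ n
π₂≤ n = subst (π₂ n ≤_) (⟨π₁,π₂⟩ n) (n≤⟨m,n⟩ (π₁ n) (π₂ n))

-- Evaluation

module _ {X : SetN} where

  -- The indices `⟨ x , 0 ⟩` and `⟨ x , suc n ⟩` are numbers and not constructor patterns, so
  -- unification cannot separate the two rules. Inversion turns them into equations, to which
  -- injectivity of pairing applies.
  rec-inv : ∀ {f g z y} → Ev X (rec f g) z y →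
    (∃ λ x → z ≡ ⟨ x , 0 ⟩ × Ev X f x y) ⊎
    (∃ λ x → ∃ λ n → ∃ λ v → z ≡ ⟨ x , suc n ⟩ × Ev X (rec f g) ⟨ x , n ⟩ v × Ev X g ⟨ x , ⟨ n , v ⟩ ⟩ y)
  rec-inv (ev-rec0 {x = x} p) = inj₁ (x , refl , p)
  rec-inv (ev-recS {x = x} {n} {v} p q) = inj₂ (x , n , v , refl , p , q)

  Ev-det : ∀ {c x y y'} → Ev X c x y → Ev X c x y' → y ≡ y'
  Ev-det-pos : ∀ {f z} → (∃ λ v → Ev X f z (suc v)) → ¬ Ev X f z 0
  Ev-det (ev-zer x) (ev-zer .x) = refl
  Ev-det (ev-suc x) (ev-suc .x) = refl
  Ev-det (ev-fst x) (ev-fst .x) = refl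
  Ev-det (ev-snd x) (ev-snd .x) = refl
  Ev-det (ev-orc x) (ev-orc .x) = refl
  Ev-det (ev-comp p q) (ev-comp p' q') with Ev-det p p'
  ... | refl = Ev-det q q'
  Ev-det (ev-pr p q) (ev-pr p' q') = cong₂ ⟨_,_⟩ (Ev-det p p') (Ev-det q q')
  Ev-det (ev-rec0 {x = x} p) e with rec-inv e
  ... | inj₁ (x' , eq , p') with proj₁ (⟨⟩-injective {x} {0} {x'} {0} eq)
  ... | refl = Ev-det p p'
  Ev-det (ev-rec0 {x = x} p) e | inj₂ (x' , n , _ , eq , _) with proj₂ (⟨⟩-injective {x} {0} {x'} {suc n} eq)
  ... | ()
  Ev-det (ev-recS {x = x} {n} p q) e with rec-inv e
  ... | inj₁ (x' , eq , _) with proj₂ (⟨⟩-injective {x} {suc n} {x'} {0} eq)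
  ... | ()
  Ev-det (ev-recS {x = x} {n} p q) e | inj₂ (x' , n' , _ , eq , p' , q')
    with ⟨⟩-injective {x} {suc n} {x'} {suc n'} eq
  ... | refl , refl with Ev-det p p'
  ... | refl = Ev-det q q'
  Ev-det (ev-mu {n = n} p h) (ev-mu {n = n'} p' h') with <-cmp n n'
  ... | tri≈ _ eq _ = eq
  ... | tri< lt _ _ with h' n lt
  ... | v , e with Ev-det p e
  ... | ()
  Ev-det (ev-mu {n = n} p h) (ev-mu {n = n'} p' h') | tri> _ _ gt = ⊥-elim (Ev-det-pos (h n' gt) p')
  Ev-det-pos (v , e) e' with Ev-det e e'
  ... | ()

replace-orc : Code → Code → Code
replace-orc d orc = d
replace-orc d (comp f g) = comp (replace-orc d f) (replace-orc d g)
replace-orc d (prC f g) = prC (replace-orc d f) (replace-orc d g)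
replace-orc d (rec f g) = rec (replace-orc d f) (replace-orc d g)
replace-orc d (mu f) = mu (replace-orc d f)
replace-orc d zer = zer
replace-orc d sucC = sucC
replace-orc d fstC = fstC
replace-orc d sndC = sndC

module _ {X Y : SetN} {d : Code} (D : Computes Y d X) where
  Ev-replace : ∀ {c x y} → Ev X c x y → Ev Y (replace-orc d c) x y
  Ev-replace-pos : ∀ {f z} → (∃ λ v → Ev X f z (suc v)) → ∃ λ v → Ev Y (replace-orc d f) z (suc v)
  Ev-replace (ev-zer x) = ev-zer x
  Ev-replace (ev-suc x) = ev-suc x
  Ev-replace (ev-fst x) = ev-fst x
  Ev-replace (ev-snd x) = ev-snd x
  Ev-replace (ev-orc x) = D x
  Ev-replace (ev-comp p q) = ev-comp (Ev-replace p) (Ev-replace q)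
  Ev-replace (ev-pr p q) = ev-pr (Ev-replace p) (Ev-replace q)
  Ev-replace (ev-rec0 {x = x} p) = ev-rec0 {x = x} (Ev-replace p)
  Ev-replace (ev-recS {x = x} {n} {v} p q) = ev-recS {x = x} {n} {v} (Ev-replace p) (Ev-replace q)
  Ev-replace (ev-mu {x = x} {n} p h) = ev-mu {x = x} {n} (Ev-replace p) (λ m lt → Ev-replace-pos (h m lt))
  Ev-replace-pos (v , e) = v , Ev-replace e

-- Booleans and bounded quantifiers

true≢false : ∀ {b : Bool} → b ≡ true → ¬ b ≡ false
true≢false refl ()

¬true⇒false : ∀ {b} → ¬ b ≡ true → b ≡ false
¬true⇒false {false} _ = refl
¬true⇒false {true} n = ⊥-elim (n refl)

bool-ext : ∀ {a b} → (a ≡ true → b ≡ true) → (b ≡ true → a ≡ true) → a ≡ b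
bool-ext {true} f g = sym (f refl)
bool-ext {false} {false} f g = refl
bool-ext {false} {true} f g = g refl

∧-intro : ∀ {a b} → a ≡ true → b ≡ true → a ∧ b ≡ true
∧-intro refl refl = refl

∧-left : ∀ {a b} → a ∧ b ≡ true → a ≡ true
∧-left {true} _ = refl

∧-right : ∀ {a b} → a ∧ b ≡ true → b ≡ true
∧-right {true} p = p

∨-introˡ : ∀ {a b} → a ≡ true → a ∨ b ≡ true
∨-introˡ refl = refl

∨-introʳ : ∀ {a b} → b ≡ true → a ∨ b ≡ true
∨-introʳ {true} _ = refl
∨-introʳ {false} p = p

∨-elim : ∀ {a b} → a ∨ b ≡ true → a ≡ true ⊎ b ≡ true
∨-elim {true} _ = inj₁ refl
∨-elim {false} p = inj₂ p

not-intro : ∀ {a} → ¬ a ≡ true → not a ≡ true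
not-intro {true} n = ⊥-elim (n refl)
not-intro {false} _ = refl

not-elim : ∀ {a} → not a ≡ true → ¬ a ≡ true
not-elim {true} () _
not-elim {false} _ ()

opaque
  _⇒ᵇ_ : Bool → Bool → Bool
  a ⇒ᵇ b = not a ∨ b

  ⇒ᵇ-intro : ∀ {a b} → (a ≡ true → b ≡ true) → a ⇒ᵇ b ≡ true
  ⇒ᵇ-intro {true} f = f refl
  ⇒ᵇ-intro {false} f = refl

  ⇒ᵇ-elim : ∀ {a b} → a ⇒ᵇ b ≡ true → a ≡ true → b ≡ true
  ⇒ᵇ-elim {true} p _ = p

≡ᵇ-sound : ∀ {m n} → (m ≡ᵇ n) ≡ true → m ≡ n
≡ᵇ-sound {zero} {zero} _ = refl
≡ᵇ-sound {suc m} {suc n} p = cong suc (≡ᵇ-sound p)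

≡ᵇ-refl : ∀ n → (n ≡ᵇ n) ≡ true
≡ᵇ-refl zero = refl
≡ᵇ-refl (suc n) = ≡ᵇ-refl n

≡ᵇ-complete : ∀ {m n} → m ≡ n → (m ≡ᵇ n) ≡ true
≡ᵇ-complete {m} refl = ≡ᵇ-refl m

<ᵇ-sound : ∀ {m n} → (m <ᵇ n) ≡ true → m < n
<ᵇ-sound {zero} {suc n} _ = s≤s z≤n
<ᵇ-sound {suc m} {suc n} p = s≤s (<ᵇ-sound p)

<ᵇ-complete : ∀ {m n} → m < n → (m <ᵇ n) ≡ true
<ᵇ-complete {zero} {suc n} _ = refl
<ᵇ-complete {suc m} {suc n} (s≤s p) = <ᵇ-complete p

ball bex : (ℕ → Bool) → ℕ → Bool
ball p zero = true
ball p (suc n) = p n ∧ ball p n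
bex p zero = false
bex p (suc n) = p n ∨ bex p n

ball-sound : ∀ {p} n → ball p n ≡ true → ∀ {i} → i < n → p i ≡ true
ball-sound {p} (suc n) b {i} (s≤s i≤n) with m≤n⇒m<n∨m≡n i≤n
... | inj₁ i<n = ball-sound n (∧-right {p n} b) i<n
... | inj₂ refl = ∧-left b

ball-complete : ∀ {p} n → (∀ i → i < n → p i ≡ true) → ball p n ≡ true
ball-complete zero _ = refl
ball-complete (suc n) h = ∧-intro (h n ≤-refl) (ball-complete n (λ i lt → h i (m<n⇒m<1+n lt)))

bex-sound : ∀ {p} n → bex p n ≡ true → ∃ λ i → i < n × p i ≡ true
bex-sound {p} (suc n) b with ∨-elim {p n} b
... | inj₁ e = n , ≤-refl , e
... | inj₂ e with bex-sound n e
... | i , lt , pi = i , m<n⇒m<1+n lt , pi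

bex-complete : ∀ {p} n i → i < n → p i ≡ true → bex p n ≡ true
bex-complete {p} (suc n) i (s≤s i≤n) pi with m≤n⇒m<n∨m≡n i≤n
... | inj₁ i<n = ∨-introʳ {p n} (bex-complete n i i<n pi)
... | inj₂ refl = ∨-introˡ pi

least : (p : ℕ → Bool) (n : ℕ) → p n ≡ true → ∃ λ n → p n ≡ true × (∀ m → m < n → p m ≡ false)
least p zero e = zero , e , λ _ ()
least p (suc n) e with p zero in eq
... | true = zero , eq , λ _ ()
... | false with least (p ∘ suc) n e
... | m , pm , below = suc m , pm , λ { zero _ → eq ; (suc i) (s≤s lt) → below i lt }

-- Bounded collection: upward closure lets the maximum of finitely many witnesses serve every
-- `i < n`. It yields one stage by which finitely many computations have all converged.
common-bound : (P : ℕ → ℕ → Set) → (∀ i {m m'} → m ≤ m' → P i m → P i m') →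
  ∀ n → (∀ i → i < n → ∃ (P i)) → ∃ λ m → ∀ i → i < n → P i m
common-bound P mono zero h = 0 , λ _ ()
common-bound P mono (suc n) h with common-bound P mono n (λ i lt → h i (m<n⇒m<1+n lt)) | h n ≤-refl
... | m , f | m' , q = m ⊔ m' , g
  where
  g : ∀ i → i < suc n → P i (m ⊔ m')
  g i (s≤s i≤n) with m≤n⇒m<n∨m≡n i≤n
  ... | inj₁ lt = mono i (m≤m⊔n m m') (f i lt)
  ... | inj₂ refl = mono i (m≤n⊔m m m') q

-- Computable functions relative to an oracle

record Rec (X : SetN) (f : ℕ → ℕ) : Set where
  constructor mkRec
  field
    code : Code
    evaluates : ∀ x → Ev X code x (f x)

open Rec

b2n : Bool → ℕ
b2n b = if b then 1 else 0

-- As a record (rather than an abbreviation) so that the predicate can be inferred.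
record RecB (X : SetN) (p : ℕ → Bool) : Set where
  constructor mkRecB
  field
    characteristic : Rec X (λ x → b2n (p x))

open RecB

≤T⇒RecB : ∀ {S X} → S ≤T X → RecB X S
≤T⇒RecB (c , h) = mkRecB (mkRec c h)

RecB⇒≤T : ∀ {S X} → RecB X S → S ≤T X
RecB⇒≤T (mkRecB (mkRec c h)) = c , h

opaque
  Rec-rel : ∀ {X Y f} → X ≤T Y → Rec X f → Rec Y f
  Rec-rel (d , D) (mkRec c h) = mkRec (replace-orc d c) (λ x → Ev-replace D (h x))

opaque
  RecB-rel : ∀ {X Y p} → X ≤T Y → RecB X p → RecB Y p
  RecB-rel le (mkRecB r) = mkRecB (Rec-rel le r)

opaque
  Rec-ext : ∀ {X f g} → (∀ x → f x ≡ g x) → Rec X f → Rec X g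
  Rec-ext eq (mkRec c h) = mkRec c (λ x → subst (Ev _ c x) (eq x) (h x))

opaque
  RecB-ext : ∀ {X p q} → (∀ x → p x ≡ q x) → RecB X p → RecB X q
  RecB-ext eq (mkRecB r) = mkRecB (Rec-ext (λ x → cong b2n (eq x)) r)

natrec : ℕ → (ℕ → ℕ → ℕ) → ℕ → ℕ
natrec b s zero = b
natrec b s (suc n) = s n (natrec b s n)

module _ {X : SetN} where
  opaque

    constR : ∀ n → Rec X (λ _ → n)
    constR zero = mkRec zer ev-zer
    constR (suc n) = mkRec (comp sucC (code (constR n))) (λ x → ev-comp (evaluates (constR n) x) (ev-suc n))

    idR : Rec X (λ x → x)
    idR = mkRec (prC fstC sndC)
      (λ x → subst (Ev X _ x) (⟨π₁,π₂⟩ x) (ev-pr {y = π₁ x} {z = π₂ x} (ev-π₁ x) (ev-π₂ x)))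

    _∘R_ : ∀ {f g} → Rec X f → Rec X g → Rec X (λ x → f (g x))
    _∘R_ {f} {g} F G = mkRec (comp (code F) (code G)) (λ x → ev-comp (evaluates G x) (evaluates F (g x)))

    _∘B_ : ∀ {p g} → RecB X p → Rec X g → RecB X (λ x → p (g x))
    mkRecB P ∘B G = mkRecB (P ∘R G)

    sucR : ∀ {f} → Rec X f → Rec X (λ x → suc (f x))
    sucR {f} F = mkRec (comp sucC (code F)) (λ x → ev-comp (evaluates F x) (ev-suc (f x)))

    π₁R : ∀ {f} → Rec X f → Rec X (λ x → π₁ (f x))
    π₁R {f} F = mkRec (comp fstC (code F)) (λ x → ev-comp (evaluates F x) (ev-π₁ (f x)))

    π₂R : ∀ {f} → Rec X f → Rec X (λ x → π₂ (f x))
    π₂R {f} F = mkRec (comp sndC (code F)) (λ x → ev-comp (evaluates F x) (ev-π₂ (f x)))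

    pairR : ∀ {f g} → Rec X f → Rec X g → Rec X (λ x → ⟨ f x , g x ⟩)
    pairR {f} {g} F G = mkRec (prC (code F) (code G))
      (λ x → ev-pr {y = f x} {z = g x} (evaluates F x) (evaluates G x))

    orcR : ∀ {f} → Rec X f → RecB X (λ x → X (f x))
    orcR {f} F = mkRecB (mkRec (comp orc (code F)) (λ x → ev-comp (evaluates F x) (ev-orc (f x))))

    wk : ∀ {f} → Rec X f → Rec X (λ u → f (π₁ u))
    wk F = F ∘R π₁R idR

    wkB : ∀ {p} → RecB X p → RecB X (λ u → p (π₁ u))
    wkB P = P ∘B π₁R idR

    var : Rec X (λ u → π₂ u)
    var = π₂R idR

    natrecR : ∀ {b : ℕ → ℕ} {s : ℕ → ℕ → ℕ → ℕ} {c : ℕ → ℕ} → Rec X b →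
      Rec X (λ u → s (π₁ u) (π₁ (π₂ u)) (π₂ (π₂ u))) → Rec X c →
      Rec X (λ z → natrec (b z) (s z) (c z))
    natrecR {b} {s} {c} B S C =
      mkRec (comp (rec (code B) (code S)) (code (pairR idR C)))
        (λ z → ev-comp (evaluates (pairR idR C) z) (loop z (c z)))
      where
      loop : ∀ z n → Ev X (rec (code B) (code S)) ⟨ z , n ⟩ (natrec (b z) (s z) n)
      loop z zero = ev-rec0 {x = z} (evaluates B z)
      loop z (suc n) = ev-recS {x = z} {n} {v} (loop z n)
        (subst (Ev X (code S) u) eq (evaluates S u))
        where
        v u : ℕ
        v = natrec (b z) (s z) n
        u = ⟨ z , ⟨ n , v ⟩ ⟩
        eq : s (π₁ u) (π₁ (π₂ u)) (π₂ (π₂ u)) ≡ s z n v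
        eq rewrite π₁-⟨⟩ z ⟨ n , v ⟩ | π₂-⟨⟩ z ⟨ n , v ⟩ | π₁-⟨⟩ n v | π₂-⟨⟩ n v = refl

    predR : ∀ {f} → Rec X f → Rec X (λ z → pred (f z))
    predR {f} F = Rec-ext (λ z → eq (f z)) (natrecR {s = λ _ n _ → n} (constR 0) (π₁R (π₂R idR)) F)
      where
      eq : ∀ n → natrec 0 (λ n _ → n) n ≡ pred n
      eq zero = refl
      eq (suc n) = refl

    plusR : ∀ {f g} → Rec X f → Rec X g → Rec X (λ z → f z + g z)
    plusR {f} {g} F G = Rec-ext (λ z → eq (f z) (g z)) (natrecR {s = λ _ _ v → suc v} F (sucR (π₂R (π₂R idR))) G)
      where
      eq : ∀ m n → natrec m (λ _ v → suc v) n ≡ m + n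
      eq m zero = sym (+-identityʳ m)
      eq m (suc n) = trans (cong suc (eq m n)) (sym (+-suc m n))

    monusR : ∀ {f g} → Rec X f → Rec X g → Rec X (λ z → f z ∸ g z)
    monusR {f} {g} F G = Rec-ext (λ z → eq (f z) (g z)) (natrecR {s = λ _ _ v → pred v} F (predR (π₂R (π₂R idR))) G)
      where
      eq : ∀ m n → natrec m (λ _ v → pred v) n ≡ m ∸ n
      eq m zero = refl
      eq m (suc n) = trans (cong pred (eq m n)) (pred[m∸n]≡m∸[1+n] m n)

    ifR : ∀ {p f g} → RecB X p → Rec X f → Rec X g → Rec X (λ z → if p z then f z else g z)
    ifR {p} {f} {g} (mkRecB P) F G =
      Rec-ext (λ z → eq (p z) (f z) (g z)) (natrecR {s = λ z _ _ → f z} G (wk F) P)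
      where
      eq : ∀ b m n → natrec n (λ _ _ → m) (b2n b) ≡ (if b then m else n)
      eq true m n = refl
      eq false m n = refl

    b2nR : ∀ {p} → RecB X p → Rec X (λ z → b2n (p z))
    b2nR = characteristic

    constB : ∀ b → RecB X (λ _ → b)
    constB b = mkRecB (constR (b2n b))

    notR : ∀ {p} → RecB X p → RecB X (λ z → not (p z))
    notR {p} P = mkRecB (Rec-ext (λ z → eq (p z)) (ifR P (constR 0) (constR 1)))
      where
      eq : ∀ b → (if b then 0 else 1) ≡ b2n (not b)
      eq true = refl
      eq false = refl

    andR : ∀ {p q} → RecB X p → RecB X q → RecB X (λ z → p z ∧ q z)
    andR {p} {q} P Q = mkRecB (Rec-ext (λ z → eq (p z) (q z)) (ifR P (b2nR Q) (constR 0)))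
      where
      eq : ∀ a b → (if a then b2n b else 0) ≡ b2n (a ∧ b)
      eq true b = refl
      eq false b = refl

    orR : ∀ {p q} → RecB X p → RecB X q → RecB X (λ z → p z ∨ q z)
    orR {p} {q} P Q = mkRecB (Rec-ext (λ z → eq (p z) (q z)) (ifR P (constR 1) (b2nR Q)))
      where
      eq : ∀ a b → (if a then 1 else b2n b) ≡ b2n (a ∨ b)
      eq true b = refl
      eq false b = refl

  opaque
    unfolding _⇒ᵇ_

    ⇒R : ∀ {p q} → RecB X p → RecB X q → RecB X (λ z → p z ⇒ᵇ q z)
    ⇒R P Q = orR (notR P) Q

nonzero : ℕ → Bool
nonzero zero = false
nonzero (suc _) = true

module _ {X : SetN} where
  opaque

    nonzeroR : ∀ {f} → Rec X f → RecB X (λ z → nonzero (f z))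
    nonzeroR {f} F = mkRecB (Rec-ext (λ z → eq (f z)) (natrecR {s = λ _ _ _ → 1} (constR 0) (constR 1) F))
      where
      eq : ∀ n → natrec 0 (λ _ _ → 1) n ≡ b2n (nonzero n)
      eq zero = refl
      eq (suc n) = refl

    <ᵇR : ∀ {f g} → Rec X f → Rec X g → RecB X (λ z → f z <ᵇ g z)
    <ᵇR {f} {g} F G = RecB-ext (λ z → eq (f z) (g z)) (nonzeroR (monusR G F))
      where
      eq : ∀ m n → nonzero (n ∸ m) ≡ (m <ᵇ n)
      eq zero zero = refl
      eq zero (suc n) = refl
      eq (suc m) zero = refl
      eq (suc m) (suc n) = eq m n

    ≡ᵇR : ∀ {f g} → Rec X f → Rec X g → RecB X (λ z → f z ≡ᵇ g z)
    ≡ᵇR {f} {g} F G = RecB-ext (λ z → eq (f z) (g z)) (notR (orR (nonzeroR (monusR F G)) (nonzeroR (monusR G F))))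
      where
      eq : ∀ m n → not (nonzero (m ∸ n) ∨ nonzero (n ∸ m)) ≡ (m ≡ᵇ n)
      eq zero zero = refl
      eq zero (suc n) = refl
      eq (suc m) zero = refl
      eq (suc m) (suc n) = eq m n

    ballR : ∀ {p : ℕ → ℕ → Bool} {c} → RecB X (λ u → p (π₁ u) (π₂ u)) → Rec X c → RecB X (λ z → ball (p z) (c z))
    ballR {p} {c} P C = mkRecB (Rec-ext (λ z → eq z (c z))
      (natrecR {s = λ z n v → if p z n then v else 0} (constR 1) (ifR P' (π₂R (π₂R idR)) (constR 0)) C))
      where
      P' : RecB X (λ u → p (π₁ u) (π₁ (π₂ u)))
      P' = RecB-ext (λ u → cong₂ p (π₁-⟨⟩ (π₁ u) (π₁ (π₂ u))) (π₂-⟨⟩ (π₁ u) (π₁ (π₂ u))))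
        (P ∘B pairR (π₁R idR) (π₁R (π₂R idR)))
      eq : ∀ z n → natrec 1 (λ n v → if p z n then v else 0) n ≡ b2n (ball (p z) n)
      eq z zero = refl
      eq z (suc n) with p z n
      ... | true = eq z n
      ... | false = refl

    bexR : ∀ {p : ℕ → ℕ → Bool} {c} → RecB X (λ u → p (π₁ u) (π₂ u)) → Rec X c → RecB X (λ z → bex (p z) (c z))
    bexR {p} {c} P C = RecB-ext (λ z → eq z (c z)) (notR (ballR {p = λ z i → not (p z i)} (notR P) C))
      where
      eq : ∀ z n → not (ball (λ i → not (p z i)) n) ≡ bex (p z) n
      eq z zero = refl
      eq z (suc n) with p z n
      ... | true = refl
      ... | false = eq z n

    muR : ∀ {p : ℕ → ℕ → Bool} {n : ℕ → ℕ} → RecB X (λ u → p (π₁ u) (π₂ u)) →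
      (ex : ∀ z → p z (n z) ≡ true) → Rec X (λ z → proj₁ (least (p z) (n z) (ex z)))
    muR {p} {n} P ex = mkRec (mu (code N)) λ z → let (m , pm , below) = least (p z) (n z) (ex z) in
      ev-mu {x = z} {m} (value z m (cong (b2n ∘ not) pm)) (λ i lt → 0 , value z i (cong (b2n ∘ not) (below i lt)))
      where
      -- `mu` stops at the value 0, so the search runs over the negation of `p`.
      N : Rec X (λ u → b2n (not (p (π₁ u) (π₂ u))))
      N = b2nR (notR P)
      value : ∀ z i {v} → b2n (not (p z i)) ≡ v → Ev X (code N) ⟨ z , i ⟩ v
      value z i eq = subst (Ev X (code N) ⟨ z , i ⟩)
        (trans (cong₂ (λ a b → b2n (not (p a b))) (π₁-⟨⟩ z i) (π₂-⟨⟩ z i)) eq) (evaluates N ⟨ z , i ⟩)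

-- Lists coded by 0 and suc ⟨ head , tail ⟩

cons : ℕ → ℕ → ℕ
cons h t = suc ⟨ h , t ⟩

hd tl : ℕ → ℕ
hd w = π₁ (pred w)
tl w = π₂ (pred w)

list-ind : (P : ℕ → Set) → P 0 → (∀ h t → P t → P (cons h t)) → ∀ w → P w
list-ind P nil step = <-rec P go
  where
  go : ∀ w → (∀ {v} → v < w → P v) → P w
  go zero _ = nil
  go (suc w) ih = subst (λ v → P (suc v)) (⟨π₁,π₂⟩ w) (step (π₁ w) (π₂ w) (ih (s≤s (π₂≤ w))))

private
  list-step : ℕ → (ℕ → ℕ → ℕ → ℕ) → ℕ → ℕ → ℕ
  list-step b c v r = if nonzero v then c (hd v) (tl v) r else b

  fold : ℕ → (ℕ → ℕ → ℕ → ℕ) → ℕ → ℕ → ℕ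
  fold b c zero v = b
  fold b c (suc n) v = list-step b c v (fold b c n (tl v))

  drop : ℕ → ℕ → ℕ
  drop w = natrec w (λ _ v → tl v)

  fold-fuel : ∀ b c m n v → v ≤ m → v ≤ n → fold b c m v ≡ fold b c n v
  fold-fuel b c zero zero v _ _ = refl
  fold-fuel b c zero (suc n) zero _ _ = refl
  fold-fuel b c (suc m) zero zero _ _ = refl
  fold-fuel b c (suc m) (suc n) zero _ _ = refl
  fold-fuel b c (suc m) (suc n) (suc v) (s≤s p) (s≤s q) =
    cong (c (π₁ v) (π₂ v)) (fold-fuel b c m n (π₂ v) (≤-trans (π₂≤ v) p) (≤-trans (π₂≤ v) q))

opaque
  -- The paramorphism over a coded list, evaluated from its last tail backwards.
  para : ℕ → (ℕ → ℕ → ℕ → ℕ) → ℕ → ℕ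
  para b c w = natrec b (λ i r → list-step b c (drop w (w ∸ suc i)) r) w

  -- A list coded by `w` has at most `w` entries, so `w` rounds suffice; surplus rounds come at the
  -- beginning, on the exhausted list, and return `b`.
  para-fold : ∀ b c w i → i ≤ w →
    natrec b (λ i r → list-step b c (drop w (w ∸ suc i)) r) i ≡ fold b c i (drop w (w ∸ i))
  para-fold b c w zero _ = refl
  para-fold b c w (suc i) i<w = cong (list-step b c (drop w (w ∸ suc i)))
    (trans (para-fold b c w i (<⇒≤ i<w)) (cong (λ j → fold b c i (drop w j)) (+-∸-assoc 1 i<w)))

  para≡fold : ∀ b c w → para b c w ≡ fold b c w w
  para≡fold b c w = trans (para-fold b c w w ≤-refl) (cong (λ j → fold b c w (drop w j)) (n∸n≡0 w))

  para-nil : ∀ b c → para b c 0 ≡ b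
  para-nil b c = refl

  para-cons : ∀ b c h t → para b c (cons h t) ≡ c h t (para b c t)
  para-cons b c h t = begin
    para b c (cons h t)  ≡⟨ para≡fold b c (cons h t) ⟩
    c (π₁ ⟨ h , t ⟩) (π₂ ⟨ h , t ⟩) (fold b c ⟨ h , t ⟩ (π₂ ⟨ h , t ⟩))
      ≡⟨ cong₂ (λ a d → c a d (fold b c ⟨ h , t ⟩ d)) (π₁-⟨⟩ h t) (π₂-⟨⟩ h t) ⟩
    c h t (fold b c ⟨ h , t ⟩ t)  ≡⟨ cong (c h t) (fold-fuel b c ⟨ h , t ⟩ t t (n≤⟨m,n⟩ h t) ≤-refl) ⟩
    c h t (fold b c t t)  ≡⟨ cong (c h t) (para≡fold b c t) ⟨
    c h t (para b c t) ∎
    where open ≡-Reasoning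

  paraR : ∀ {X} {b : ℕ → ℕ} {c : ℕ → ℕ → ℕ → ℕ → ℕ} {w : ℕ → ℕ} → Rec X b →
    Rec X (λ u → c (π₁ u) (π₁ (π₂ u)) (π₁ (π₂ (π₂ u))) (π₂ (π₂ (π₂ u)))) → Rec X w →
    Rec X (λ z → para (b z) (c z) (w z))
  paraR {X} {b} {c} {w} B C W =
    natrecR {s = λ z i r → list-step (b z) (c z) (dropped z i) r} B
      (ifR (nonzeroR D) (Rec-ext eq (C ∘R pairR (π₁R idR) (pairR (π₁R (predR D)) (pairR (π₂R (predR D)) (π₂R (π₂R idR))))))
        (wk B)) W
    where
    dropped : ℕ → ℕ → ℕ
    dropped z i = drop (w z) (w z ∸ suc i)
    D : Rec X (λ u → dropped (π₁ u) (π₁ (π₂ u)))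
    D = natrecR {s = λ _ _ v → tl v} (wk W) (π₂R (predR (π₂R (π₂R idR)))) (monusR (wk W) (sucR (π₁R (π₂R idR))))
    eq : ∀ u → let v = dropped (π₁ u) (π₁ (π₂ u)) ; r = π₂ (π₂ u)
                   q = ⟨ π₁ u , ⟨ hd v , ⟨ tl v , r ⟩ ⟩ ⟩ in
         c (π₁ q) (π₁ (π₂ q)) (π₁ (π₂ (π₂ q))) (π₂ (π₂ (π₂ q))) ≡ c (π₁ u) (hd v) (tl v) r
    eq u = let v = dropped (π₁ u) (π₁ (π₂ u)) ; r = π₂ (π₂ u) in lemma (π₁ u) (hd v) (tl v) r
      where
      lemma : ∀ z h t r → let q = ⟨ z , ⟨ h , ⟨ t , r ⟩ ⟩ ⟩ in
        c (π₁ q) (π₁ (π₂ q)) (π₁ (π₂ (π₂ q))) (π₂ (π₂ (π₂ q))) ≡ c z h t r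
      lemma z h t r rewrite π₁-⟨⟩ z ⟨ h , ⟨ t , r ⟩ ⟩ | π₂-⟨⟩ z ⟨ h , ⟨ t , r ⟩ ⟩
        | π₁-⟨⟩ h ⟨ t , r ⟩ | π₂-⟨⟩ h ⟨ t , r ⟩ | π₁-⟨⟩ t r | π₂-⟨⟩ t r = refl

-- The Gödel numbering

decodeStep : (ℕ → Code) → ℕ × ℕ → Code
decodeStep D (0 , p) = zer
decodeStep D (1 , p) = sucC
decodeStep D (2 , p) = fstC
decodeStep D (3 , p) = sndC
decodeStep D (4 , p) = orc
decodeStep D (5 , p) = comp (D (π₁ p)) (D (π₂ p))
decodeStep D (6 , p) = prC (D (π₁ p)) (D (π₂ p))
decodeStep D (7 , p) = rec (D (π₁ p)) (D (π₂ p))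
decodeStep D (8 , p) = mu (D p)
decodeStep D (suc (suc (suc (suc (suc (suc (suc (suc (suc t)))))))) , p) = zer

opaque
  unfolding π₁

  decodeF-suc : ∀ f n → decodeF (suc f) n ≡ decodeStep (decodeF f) (π₁ n , π₂ n)
  decodeF-suc f n with unpair n
  ... | 0 , _ = refl
  ... | 1 , _ = refl
  ... | 2 , _ = refl
  ... | 3 , _ = refl
  ... | 4 , _ = refl
  ... | 5 , _ = refl
  ... | 6 , _ = refl
  ... | 7 , _ = refl
  ... | 8 , _ = refl
  ... | suc (suc (suc (suc (suc (suc (suc (suc (suc t)))))))) , _ = refl

-- Subprograms have codes at most `p`, and compound tags are positive, so these codes are below
-- `t + p`, which is at most `⟨ t , p ⟩`. Hence any fuel above the code yields the same program.
decodeStep-cong : ∀ {D D'} u → (∀ m → m < proj₁ u + proj₂ u → D m ≡ D' m) → decodeStep D u ≡ decodeStep D' u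
decodeStep-cong (0 , p) h = refl
decodeStep-cong (1 , p) h = refl
decodeStep-cong (2 , p) h = refl
decodeStep-cong (3 , p) h = refl
decodeStep-cong (4 , p) h = refl
decodeStep-cong (5 , p) h = cong₂ comp (h _ (s≤s (≤-trans (π₁≤ p) (m≤n+m p 4)))) (h _ (s≤s (≤-trans (π₂≤ p) (m≤n+m p 4))))
decodeStep-cong (6 , p) h = cong₂ prC (h _ (s≤s (≤-trans (π₁≤ p) (m≤n+m p 5)))) (h _ (s≤s (≤-trans (π₂≤ p) (m≤n+m p 5))))
decodeStep-cong (7 , p) h = cong₂ rec (h _ (s≤s (≤-trans (π₁≤ p) (m≤n+m p 6)))) (h _ (s≤s (≤-trans (π₂≤ p) (m≤n+m p 6))))
decodeStep-cong (8 , p) h = cong mu (h _ (s≤s (m≤n+m p 7)))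
decodeStep-cong (suc (suc (suc (suc (suc (suc (suc (suc (suc t)))))))) , p) h = refl

decodeF-fuel : ∀ f f' n → n < f → n < f' → decodeF f n ≡ decodeF f' n
decodeF-fuel (suc f) (suc f') n (s≤s p) (s≤s p') = begin
  decodeF (suc f) n  ≡⟨ decodeF-suc f n ⟩
  decodeStep (decodeF f) (π₁ n , π₂ n)  ≡⟨ decodeStep-cong (π₁ n , π₂ n) (λ m lt → decodeF-fuel f f' m
      (≤-trans lt (≤-trans bound p)) (≤-trans lt (≤-trans bound p'))) ⟩
  decodeStep (decodeF f') (π₁ n , π₂ n)  ≡⟨ decodeF-suc f' n ⟨
  decodeF (suc f') n ∎
  where
  open ≡-Reasoning
  bound : π₁ n + π₂ n ≤ n
  bound = subst (π₁ n + π₂ n ≤_) (⟨π₁,π₂⟩ n) (m+n≤⟨m,n⟩ (π₁ n) (π₂ n))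

decode-unpair : ∀ n → decode n ≡ decodeStep decode (π₁ n , π₂ n)
decode-unpair n = trans (decodeF-suc n n) (decodeStep-cong (π₁ n , π₂ n) λ m lt →
  decodeF-fuel n (suc m) m (≤-trans lt bound) ≤-refl)
  where
  bound : π₁ n + π₂ n ≤ n
  bound = subst (π₁ n + π₂ n ≤_) (⟨π₁,π₂⟩ n) (m+n≤⟨m,n⟩ (π₁ n) (π₂ n))

decode-⟨⟩ : ∀ t p → decode ⟨ t , p ⟩ ≡ decodeStep decode (t , p)
decode-⟨⟩ t p = trans (decode-unpair ⟨ t , p ⟩) (cong₂ (λ a b → decodeStep decode (a , b)) (π₁-⟨⟩ t p) (π₂-⟨⟩ t p))

decode-surjective : ∀ c → ∃ λ e → decode e ≡ c
decode-surjective zer = ⟨ 0 , 0 ⟩ , decode-⟨⟩ 0 0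
decode-surjective sucC = ⟨ 1 , 0 ⟩ , decode-⟨⟩ 1 0
decode-surjective fstC = ⟨ 2 , 0 ⟩ , decode-⟨⟩ 2 0
decode-surjective sndC = ⟨ 3 , 0 ⟩ , decode-⟨⟩ 3 0
decode-surjective orc = ⟨ 4 , 0 ⟩ , decode-⟨⟩ 4 0
decode-surjective (comp f g) with decode-surjective f | decode-surjective g
... | a , refl | b , refl = ⟨ 5 , ⟨ a , b ⟩ ⟩ , trans (decode-⟨⟩ 5 ⟨ a , b ⟩)
  (cong₂ comp (cong decode (π₁-⟨⟩ a b)) (cong decode (π₂-⟨⟩ a b)))
decode-surjective (prC f g) with decode-surjective f | decode-surjective g
... | a , refl | b , refl = ⟨ 6 , ⟨ a , b ⟩ ⟩ , trans (decode-⟨⟩ 6 ⟨ a , b ⟩)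
  (cong₂ prC (cong decode (π₁-⟨⟩ a b)) (cong decode (π₂-⟨⟩ a b)))
decode-surjective (rec f g) with decode-surjective f | decode-surjective g
... | a , refl | b , refl = ⟨ 7 , ⟨ a , b ⟩ ⟩ , trans (decode-⟨⟩ 7 ⟨ a , b ⟩)
  (cong₂ rec (cong decode (π₁-⟨⟩ a b)) (cong decode (π₂-⟨⟩ a b)))
decode-surjective (mu f) with decode-surjective f
... | a , refl = ⟨ 8 , a ⟩ , decode-⟨⟩ 8 a

-- Kleene's T-predicate.  A computation is a coded list of facts
-- ⟨ e , ⟨ x , y ⟩ ⟩ ("program e maps x to y"), each following from its tail.

opaque
  anyL : (ℕ → Bool) → ℕ → Bool
  anyL p w = nonzero (para 0 (λ h t r → if p h then 1 else r) w)

  anyL-nil : ∀ p → anyL p 0 ≡ false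
  anyL-nil p = cong nonzero (para-nil 0 (λ h t r → if p h then 1 else r))

  anyL-cons : ∀ p h t → anyL p (cons h t) ≡ p h ∨ anyL p t
  anyL-cons p h t rewrite para-cons 0 (λ h t r → if p h then 1 else r) h t with p h
  ... | true = refl
  ... | false = refl

  anyLR : ∀ {X} {p : ℕ → ℕ → Bool} {w} → RecB X (λ u → p (π₁ u) (π₂ u)) → Rec X w → RecB X (λ z → anyL (p z) (w z))
  anyLR {X} {p} {w} P W = nonzeroR (paraR {c = λ z h t r → if p z h then 1 else r} (constR 0)
    (ifR (RecB-ext (λ u → cong₂ p (π₁-⟨⟩ (π₁ u) (π₁ (π₂ u))) (π₂-⟨⟩ (π₁ u) (π₁ (π₂ u))))
        (P ∘B pairR (π₁R idR) (π₁R (π₂R idR)))) (constR 1) (π₂R (π₂R (π₂R idR)))) W)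

anyL-absurd : ∀ {A : Set} p → anyL p 0 ≡ true → A
anyL-absurd p e = ⊥-elim (true≢false e (anyL-nil p))

mem : ℕ → ℕ → Bool
mem q = anyL (λ h → h ≡ᵇ q)

anyL-sound : ∀ p w → anyL p w ≡ true → ∃ λ q → mem q w ≡ true × p q ≡ true
anyL-sound p = list-ind (λ w → anyL p w ≡ true → ∃ λ q → mem q w ≡ true × p q ≡ true) (anyL-absurd p)
  λ h t ih e → case ∨-elim {p h} (trans (sym (anyL-cons p h t)) e) of λ
  { (inj₁ ph) → h , trans (anyL-cons (λ v → v ≡ᵇ h) h t) (∨-introˡ (≡ᵇ-refl h)) , ph
  ; (inj₂ e') → let (q , m , pq) = ih e' in q , trans (anyL-cons (λ v → v ≡ᵇ q) h t) (∨-introʳ {h ≡ᵇ q} m) , pq }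

anyL-complete : ∀ p w q → mem q w ≡ true → p q ≡ true → anyL p w ≡ true
anyL-complete p w q m pq = list-ind (λ w → mem q w ≡ true → anyL p w ≡ true) (anyL-absurd _)
  (λ h t ih e → trans (anyL-cons p h t) (case ∨-elim {h ≡ᵇ q} (trans (sym (anyL-cons (λ v → v ≡ᵇ q) h t)) e) of λ
    { (inj₁ h≡q) → ∨-introˡ (subst (λ v → p v ≡ true) (sym (≡ᵇ-sound h≡q)) pq)
    ; (inj₂ e') → ∨-introʳ {p h} (ih e') })) w m

fact-matches : ℕ → ℕ → (ℕ → Bool) → ℕ → Bool
fact-matches e x φ h = (π₁ h ≡ᵇ e) ∧ ((π₁ (π₂ h) ≡ᵇ x) ∧ φ (π₂ (π₂ h)))

opaque
  -- Serves the premises whose value does not occur in the conclusion: intermediate results of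
  -- compositions and recursions, and the positive values before a minimum, are looked up among the
  -- recorded facts.
  yields : ℕ → ℕ → (ℕ → Bool) → ℕ → Bool
  yields e x φ = anyL (fact-matches e x φ)

  yields-sound : ∀ e x φ w → yields e x φ w ≡ true → ∃ λ v → mem ⟨ e , ⟨ x , v ⟩ ⟩ w ≡ true × φ v ≡ true
  yields-sound e x φ w h with anyL-sound (fact-matches e x φ) w h
  ... | q , m , eq with ≡ᵇ-sound {π₁ q} (∧-left eq) | ∧-right {π₁ q ≡ᵇ e} eq
  ... | refl | eq' with ≡ᵇ-sound {π₁ (π₂ q)} (∧-left eq') | ∧-right {π₁ (π₂ q) ≡ᵇ x} eq'
  ... | refl | eq'' = π₂ (π₂ q) ,
    subst (λ v → mem v w ≡ true) (sym (trans (cong ⟨ π₁ q ,_⟩ (⟨π₁,π₂⟩ (π₂ q))) (⟨π₁,π₂⟩ q))) m , eq''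

  yields-complete : ∀ e x φ w v → mem ⟨ e , ⟨ x , v ⟩ ⟩ w ≡ true → φ v ≡ true → yields e x φ w ≡ true
  yields-complete e x φ w v m φv = anyL-complete (fact-matches e x φ) w ⟨ e , ⟨ x , v ⟩ ⟩ m
    (∧-intro (≡ᵇ-complete (π₁-⟨⟩ e ⟨ x , v ⟩))
      (∧-intro (≡ᵇ-complete (trans (cong π₁ (π₂-⟨⟩ e ⟨ x , v ⟩)) (π₁-⟨⟩ x v)))
        (trans (cong φ (trans (cong π₂ (π₂-⟨⟩ e ⟨ x , v ⟩)) (π₂-⟨⟩ x v))) φv)))

  yieldsR : ∀ {X} {e x : ℕ → ℕ} {φ : ℕ → ℕ → Bool} {w} → Rec X e → Rec X x → RecB X (λ u → φ (π₁ u) (π₂ u)) → Rec X w →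
    RecB X (λ z → yields (e z) (x z) (φ z) (w z))
  yieldsR {X} {e} {x} {φ} E N Φ W = anyLR {p = λ z → fact-matches (e z) (x z) (φ z)}
    (andR (≡ᵇR (π₁R var) (wk E)) (andR (≡ᵇR (π₁R (π₂R var)) (wk N))
      (RecB-ext (λ u → cong₂ φ (π₁-⟨⟩ (π₁ u) _) (π₂-⟨⟩ (π₁ u) _)) (Φ ∘B pairR (π₁R idR) (π₂R (π₂R var)))))) W

compRule pairRule muRule : (p x y w : ℕ) → Bool
compRule p x y w = yields (π₂ p) x (λ m → mem ⟨ π₁ p , ⟨ m , y ⟩ ⟩ w) w
pairRule p x y w = mem ⟨ π₁ p , ⟨ x , π₁ y ⟩ ⟩ w ∧ mem ⟨ π₂ p , ⟨ x , π₂ y ⟩ ⟩ w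
muRule p x y w = mem ⟨ p , ⟨ ⟨ x , y ⟩ , 0 ⟩ ⟩ w ∧ ball (λ m → yields p ⟨ x , m ⟩ nonzero w) y

recRule : (e p x n y w : ℕ) → Bool
recRule e p x zero y w = mem ⟨ π₁ p , ⟨ x , y ⟩ ⟩ w
recRule e p x (suc n) y w = yields e ⟨ x , n ⟩ (λ v → mem ⟨ π₂ p , ⟨ ⟨ x , ⟨ n , v ⟩ ⟩ , y ⟩ ⟩ w) w

rule : SetN → (t p e x y w : ℕ) → Bool
rule X t p e x y w =
  if t ≡ᵇ 1 then y ≡ᵇ suc x else
  if t ≡ᵇ 2 then y ≡ᵇ π₁ x else
  if t ≡ᵇ 3 then y ≡ᵇ π₂ x else
  if t ≡ᵇ 4 then y ≡ᵇ χ X x else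
  if t ≡ᵇ 5 then compRule p x y w else
  if t ≡ᵇ 6 then pairRule p x y w else
  if t ≡ᵇ 7 then recRule e p (π₁ x) (π₂ x) y w else
  if t ≡ᵇ 8 then muRule p x y w else
  -- The tag 0 and every tag above 8 decode to `zer`.
  (y ≡ᵇ 0)

justified : SetN → ℕ → ℕ → Bool
justified X q w = rule X (π₁ (π₁ q)) (π₂ (π₁ q)) (π₁ q) (π₁ (π₂ q)) (π₂ (π₂ q)) w

opaque
  valid : SetN → ℕ → Bool
  valid X w = nonzero (para 1 (λ h t r → if justified X h t then r else 0) w)

  valid-nil : ∀ X → valid X 0 ≡ true
  valid-nil X = cong nonzero (para-nil 1 (λ h t r → if justified X h t then r else 0))

  valid-cons : ∀ X h t → valid X (cons h t) ≡ justified X h t ∧ valid X t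
  valid-cons X h t rewrite para-cons 1 (λ h t r → if justified X h t then r else 0) h t with justified X h t
  ... | true = refl
  ... | false = refl

opaque
  T : SetN → (e x y w : ℕ) → Bool
  T X e x y w = valid X w ∧ mem ⟨ e , ⟨ x , y ⟩ ⟩ w

  T-intro : ∀ {X} e x y w → valid X w ≡ true → mem ⟨ e , ⟨ x , y ⟩ ⟩ w ≡ true → T X e x y w ≡ true
  T-intro e x y w = ∧-intro

  T-valid : ∀ {X} e x y w → T X e x y w ≡ true → valid X w ≡ true
  T-valid e x y w = ∧-left

  T-mem : ∀ {X} e x y w → T X e x y w ≡ true → mem ⟨ e , ⟨ x , y ⟩ ⟩ w ≡ true
  T-mem {X} e x y w = ∧-right {valid X w}

justified-⟨⟩ : ∀ X e x y w → justified X ⟨ e , ⟨ x , y ⟩ ⟩ w ≡ rule X (π₁ e) (π₂ e) e x y w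
justified-⟨⟩ X e x y w rewrite π₁-⟨⟩ e ⟨ x , y ⟩ | π₂-⟨⟩ e ⟨ x , y ⟩ | π₁-⟨⟩ x y | π₂-⟨⟩ x y = refl

module _ {X : SetN} where

  rule-sound : ∀ w → (∀ e x y → mem ⟨ e , ⟨ x , y ⟩ ⟩ w ≡ true → Ev X (decode e) x y) →
    ∀ t p e x y → decode e ≡ decodeStep decode (t , p) → rule X t p e x y w ≡ true →
    Ev X (decodeStep decode (t , p)) x y
  rule-sound w h 0 p e x y eq r rewrite ≡ᵇ-sound {y} r = ev-zer x
  rule-sound w h 1 p e x y eq r rewrite ≡ᵇ-sound {y} r = ev-suc x
  rule-sound w h 2 p e x y eq r rewrite ≡ᵇ-sound {y} r = ev-π₁ x
  rule-sound w h 3 p e x y eq r rewrite ≡ᵇ-sound {y} r = ev-π₂ x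
  rule-sound w h 4 p e x y eq r rewrite ≡ᵇ-sound {y} r = ev-orc x
  rule-sound w h 5 p e x y eq r with yields-sound (π₂ p) x _ w r
  ... | v , m , m' = ev-comp (h _ x v m) (h _ v y m')
  rule-sound w h 6 p e x y eq r = subst (Ev X _ x) (⟨π₁,π₂⟩ y)
    (ev-pr {y = π₁ y} {z = π₂ y} (h (π₁ p) x (π₁ y) (∧-left r))
      (h (π₂ p) x (π₂ y) (∧-right {mem ⟨ π₁ p , ⟨ x , π₁ y ⟩ ⟩ w} r)))
  rule-sound w h 7 p e x y eq r = subst (λ z → Ev X _ z y) (⟨π₁,π₂⟩ x) (go (π₂ x) r)
    where
    go : ∀ n → recRule e p (π₁ x) n y w ≡ true → Ev X (rec (decode (π₁ p)) (decode (π₂ p))) ⟨ π₁ x , n ⟩ y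
    go zero r = ev-rec0 {x = π₁ x} (h (π₁ p) (π₁ x) y r)
    go (suc n) r with yields-sound e ⟨ π₁ x , n ⟩ _ w r
    ... | v , m , m' = ev-recS {x = π₁ x} {n} {v} (subst (λ c → Ev X c ⟨ π₁ x , n ⟩ v) eq (h e ⟨ π₁ x , n ⟩ v m))
      (h (π₂ p) ⟨ π₁ x , ⟨ n , v ⟩ ⟩ y m')
  rule-sound w h 8 p e x y eq r = ev-mu {x = x} {y} (h p ⟨ x , y ⟩ 0 (∧-left r))
    λ m lt → go m (yields-sound p ⟨ x , m ⟩ nonzero w
      (ball-sound {λ m → yields p ⟨ x , m ⟩ nonzero w} y (∧-right {mem ⟨ p , ⟨ ⟨ x , y ⟩ , 0 ⟩ ⟩ w} r) lt))
    where
    go : ∀ m → (∃ λ v → mem ⟨ p , ⟨ ⟨ x , m ⟩ , v ⟩ ⟩ w ≡ true × nonzero v ≡ true) → ∃ λ v → Ev X (decode p) ⟨ x , m ⟩ (suc v)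
    go m (suc v , q , _) = v , h p ⟨ x , m ⟩ (suc v) q
  rule-sound w h (suc (suc (suc (suc (suc (suc (suc (suc (suc t))))))))) p e x y eq r
    rewrite ≡ᵇ-sound {y} r = ev-zer x

  valid-sound : ∀ w → valid X w ≡ true → ∀ e x y → mem ⟨ e , ⟨ x , y ⟩ ⟩ w ≡ true → Ev X (decode e) x y
  valid-sound = list-ind (λ w → valid X w ≡ true → ∀ e x y → mem ⟨ e , ⟨ x , y ⟩ ⟩ w ≡ true → Ev X (decode e) x y)
    (λ _ _ _ _ → anyL-absurd _) step
    where
    step : ∀ h t → (valid X t ≡ true → ∀ e x y → mem ⟨ e , ⟨ x , y ⟩ ⟩ t ≡ true → Ev X (decode e) x y) →
      valid X (cons h t) ≡ true → ∀ e x y → mem ⟨ e , ⟨ x , y ⟩ ⟩ (cons h t) ≡ true → Ev X (decode e) x y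
    step h t ih v e x y m with trans (sym (valid-cons X h t)) v
    ... | v' with ∨-elim {h ≡ᵇ ⟨ e , ⟨ x , y ⟩ ⟩} (trans (sym (anyL-cons (λ v → v ≡ᵇ ⟨ e , ⟨ x , y ⟩ ⟩) h t)) m)
    ... | inj₂ m' = ih (∧-right {justified X h t} v') e x y m'
    ... | inj₁ h≡ with ≡ᵇ-sound {h} {⟨ e , ⟨ x , y ⟩ ⟩} h≡
    ... | refl = subst (λ c → Ev X c x y) (sym (decode-unpair e))
      (rule-sound t (ih (∧-right {justified X h t} v')) (π₁ e) (π₂ e) e x y (decode-unpair e)
        (trans (sym (justified-⟨⟩ X e x y t)) (∧-left v')))

  T-sound : ∀ e x y w → T X e x y w ≡ true → Ev X (decode e) x y
  T-sound e x y w h = valid-sound w (T-valid e x y w h) e x y (T-mem e x y w h)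

  _⊆L_ : ℕ → ℕ → Set
  u ⊆L w = ∀ q → mem q u ≡ true → mem q w ≡ true

  yields-mono : ∀ e x {φ ψ : ℕ → Bool} u w → u ⊆L w → (∀ v → φ v ≡ true → ψ v ≡ true) →
    yields e x φ u ≡ true → yields e x ψ w ≡ true
  yields-mono e x {φ} {ψ} u w s f h with yields-sound e x φ u h
  ... | v , m , φv = yields-complete e x ψ w v (s _ m) (f v φv)

  rule-mono : ∀ u w → u ⊆L w → ∀ t p e x y → rule X t p e x y u ≡ true → rule X t p e x y w ≡ true
  rule-mono u w s 0 p e x y r = r
  rule-mono u w s 1 p e x y r = r
  rule-mono u w s 2 p e x y r = r
  rule-mono u w s 3 p e x y r = r
  rule-mono u w s 4 p e x y r = r
  rule-mono u w s 5 p e x y r = yields-mono (π₂ p) x u w s (λ v → s ⟨ π₁ p , ⟨ v , y ⟩ ⟩) r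
  rule-mono u w s 6 p e x y r = ∧-intro (s ⟨ π₁ p , ⟨ x , π₁ y ⟩ ⟩ (∧-left r))
    (s ⟨ π₂ p , ⟨ x , π₂ y ⟩ ⟩ (∧-right {mem ⟨ π₁ p , ⟨ x , π₁ y ⟩ ⟩ u} r))
  rule-mono u w s 7 p e x y r = go (π₂ x) r
    where
    go : ∀ n → recRule e p (π₁ x) n y u ≡ true → recRule e p (π₁ x) n y w ≡ true
    go zero r = s ⟨ π₁ p , ⟨ π₁ x , y ⟩ ⟩ r
    go (suc n) r = yields-mono e ⟨ π₁ x , n ⟩ u w s (λ v → s ⟨ π₂ p , ⟨ ⟨ π₁ x , ⟨ n , v ⟩ ⟩ , y ⟩ ⟩) r
  rule-mono u w s 8 p e x y r = ∧-intro (s ⟨ p , ⟨ ⟨ x , y ⟩ , 0 ⟩ ⟩ (∧-left r))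
    (ball-complete y λ m lt → yields-mono p ⟨ x , m ⟩ u w s (λ _ h → h)
      (ball-sound {λ m → yields p ⟨ x , m ⟩ nonzero u} y (∧-right {mem ⟨ p , ⟨ ⟨ x , y ⟩ , 0 ⟩ ⟩ u} r) lt))
  rule-mono u w s (suc (suc (suc (suc (suc (suc (suc (suc (suc t))))))))) p e x y r = r

  -- The facts of `u` are put on top of `v`. They stay justified because rules ask only for the
  -- presence of facts, never for their absence (`rule-mono`).
  merge : ∀ u v → valid X u ≡ true → valid X v ≡ true → ∃ λ w → valid X w ≡ true × u ⊆L w × v ⊆L w
  merge u v hu hv = list-ind (λ u → valid X u ≡ true → ∃ λ w → valid X w ≡ true × u ⊆L w × v ⊆L w)
    (λ _ → v , hv , (λ _ → anyL-absurd _) , λ _ m → m) step u hu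
    where
    step : ∀ h t → (valid X t ≡ true → ∃ λ w → valid X w ≡ true × t ⊆L w × v ⊆L w) →
      valid X (cons h t) ≡ true → ∃ λ w → valid X w ≡ true × cons h t ⊆L w × v ⊆L w
    step h t ih val with trans (sym (valid-cons X h t)) val
    ... | val' with ih (∧-right {justified X h t} val')
    ... | w , hw , t⊆w , v⊆w = cons h w ,
      trans (valid-cons X h w) (∧-intro
        (rule-mono t w t⊆w (π₁ (π₁ h)) (π₂ (π₁ h)) (π₁ h) (π₁ (π₂ h)) (π₂ (π₂ h)) (∧-left val')) hw) ,
      (λ q m → trans (anyL-cons (λ v → v ≡ᵇ q) h w) (case ∨-elim {h ≡ᵇ q} (trans (sym (anyL-cons (λ v → v ≡ᵇ q) h t)) m) of λ
        { (inj₁ e) → ∨-introˡ e ; (inj₂ m') → ∨-introʳ {h ≡ᵇ q} (t⊆w q m') })) ,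
      (λ q m → trans (anyL-cons (λ v → v ≡ᵇ q) h w) (∨-introʳ {h ≡ᵇ q} (v⊆w q m)))

  Derivable : ℕ → ℕ → ℕ → Set
  Derivable e x y = ∃ λ w → T X e x y w ≡ true

  derive : ∀ {t p} e x y w → π₁ e ≡ t → π₂ e ≡ p → valid X w ≡ true → rule X t p e x y w ≡ true → Derivable e x y
  derive e x y w refl refl v r = cons q w , T-intro e x y (cons q w)
    (trans (valid-cons X q w) (∧-intro (trans (justified-⟨⟩ X e x y w) r) v))
    (trans (anyL-cons (λ v → v ≡ᵇ q) q w) (∨-introˡ (≡ᵇ-refl q)))
    where q = ⟨ e , ⟨ x , y ⟩ ⟩

  derive₂ : ∀ {t p a b c a' b' c'} e x y → π₁ e ≡ t → π₂ e ≡ p → Derivable a b c → Derivable a' b' c' →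
    (∀ w → mem ⟨ a , ⟨ b , c ⟩ ⟩ w ≡ true → mem ⟨ a' , ⟨ b' , c' ⟩ ⟩ w ≡ true → rule X t p e x y w ≡ true) →
    Derivable e x y
  derive₂ {a = a} {b} {c} {a'} {b'} {c'} e x y eq eq' (u , hu) (v , hv) r
    with merge u v (T-valid a b c u hu) (T-valid a' b' c' v hv)
  ... | w , hw , u⊆w , v⊆w = derive e x y w eq eq' hw
    (r w (u⊆w ⟨ a , ⟨ b , c ⟩ ⟩ (T-mem a b c u hu)) (v⊆w ⟨ a' , ⟨ b' , c' ⟩ ⟩ (T-mem a' b' c' v hv)))

  collect : ∀ f x n → (∀ m → m < n → ∃ λ v → Derivable f ⟨ x , m ⟩ (suc v)) →
    ∃ λ w → valid X w ≡ true × (∀ m → m < n → yields f ⟨ x , m ⟩ nonzero w ≡ true)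
  collect f x zero h = 0 , valid-nil X , λ _ ()
  collect f x (suc n) h with collect f x n (λ m lt → h m (m<n⇒m<1+n lt)) | h n ≤-refl
  ... | u , hu , g | v , w , hw with merge u w hu (T-valid f ⟨ x , n ⟩ (suc v) w hw)
  ... | w' , hw' , u⊆ , w⊆ = w' , hw' , λ m → go m
    where
    go : ∀ m → m < suc n → yields f ⟨ x , m ⟩ nonzero w' ≡ true
    go m (s≤s m≤n) with m≤n⇒m<n∨m≡n m≤n
    ... | inj₁ lt = yields-mono f ⟨ x , m ⟩ u w' u⊆ (λ _ e → e) (g m lt)
    ... | inj₂ refl = yields-complete f ⟨ x , m ⟩ nonzero w' (suc v)
      (w⊆ ⟨ f , ⟨ ⟨ x , m ⟩ , suc v ⟩ ⟩ (T-mem f ⟨ x , m ⟩ (suc v) w hw)) refl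

  T-complete : ∀ e {x y} → Ev X (decode e) x y → Derivable e x y
  -- Induction on the evaluation and not on the code, since `ev-recS` calls the same program `e`
  -- again at a smaller argument. Tag and payload are separate arguments so that matching on the tag
  -- exposes the program.
  derivable : ∀ t p e → π₁ e ≡ t → π₂ e ≡ p → ∀ {c x y} → Ev X c x y → decodeStep decode (t , p) ≡ c → Derivable e x y
  derivable-at : ∀ e → ∀ {c x y} → Ev X c x y → decode e ≡ c → Derivable e x y
  derivable-pos : ∀ e → ∀ {c x} → (∃ λ v → Ev X c x (suc v)) → decode e ≡ c → ∃ λ v → Derivable e x (suc v)
  T-complete e h = derivable-at e h refl
  derivable-at e h eq = derivable (π₁ e) (π₂ e) e refl refl h (trans (sym (decode-unpair e)) eq)
  derivable-pos e (v , h) eq = v , derivable-at e h eq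
  derivable 0 p e eq eq' (ev-zer x) refl = derive e x 0 0 eq eq' (valid-nil X) refl
  derivable 1 p e eq eq' (ev-suc x) refl = derive e x (suc x) 0 eq eq' (valid-nil X) (≡ᵇ-refl x)
  derivable 2 p e eq eq' (ev-fst x) refl = derive e x _ 0 eq eq' (valid-nil X) (≡ᵇ-complete (cong proj₁ (unpair≡π x)))
  derivable 3 p e eq eq' (ev-snd x) refl = derive e x _ 0 eq eq' (valid-nil X) (≡ᵇ-complete (cong proj₂ (unpair≡π x)))
  derivable 4 p e eq eq' (ev-orc x) refl = derive e x (χ X x) 0 eq eq' (valid-nil X) (≡ᵇ-refl (χ X x))
  derivable 5 p e eq eq' (ev-comp {x = x} {y} {z} h k) refl =
    derive₂ {a = π₂ p} {x} {y} {π₁ p} {y} {z} e x z eq eq' (derivable-at (π₂ p) h refl) (derivable-at (π₁ p) k refl)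
      λ w m m' → yields-complete (π₂ p) x (λ v → mem ⟨ π₁ p , ⟨ v , z ⟩ ⟩ w) w y m m'
  derivable 6 p e eq eq' (ev-pr {x = x} {y} {z} h k) refl =
    derive₂ {a = π₁ p} {x} {y} {π₂ p} {x} {z} e x ⟨ y , z ⟩ eq eq' (derivable-at (π₁ p) h refl) (derivable-at (π₂ p) k refl)
      λ w m m' → ∧-intro (subst (λ v → mem ⟨ π₁ p , ⟨ x , v ⟩ ⟩ w ≡ true) (sym (π₁-⟨⟩ y z)) m)
        (subst (λ v → mem ⟨ π₂ p , ⟨ x , v ⟩ ⟩ w ≡ true) (sym (π₂-⟨⟩ y z)) m')
  derivable 7 p e eq eq' (ev-rec0 {x = x} {y} h) refl =
    derive₂ {a = π₁ p} {x} {y} {π₁ p} {x} {y} e ⟨ x , 0 ⟩ y eq eq' d d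
      λ w m _ → trans (cong₂ (λ a b → recRule e p a b y w) (π₁-⟨⟩ x 0) (π₂-⟨⟩ x 0)) m
    where d = derivable-at (π₁ p) h refl
  derivable 7 p e eq eq' (ev-recS {x = x} {n} {v} {y} h k) refl =
    derive₂ {a = e} {⟨ x , n ⟩} {v} {π₂ p} {⟨ x , ⟨ n , v ⟩ ⟩} {y} e ⟨ x , suc n ⟩ y eq eq'
      (derivable 7 p e eq eq' h refl) (derivable-at (π₂ p) k refl)
      λ w m m' → trans (cong₂ (λ a b → recRule e p a b y w) (π₁-⟨⟩ x (suc n)) (π₂-⟨⟩ x (suc n)))
        (yields-complete e ⟨ x , n ⟩ (λ v → mem ⟨ π₂ p , ⟨ ⟨ x , ⟨ n , v ⟩ ⟩ , y ⟩ ⟩ w) w v m m')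
  derivable 8 p e eq eq' (ev-mu {x = x} {n} h k) refl
    with derivable-at p h refl | collect p x n (λ m lt → derivable-pos p (k m lt) refl)
  ... | u , hu | v , hv , f with merge u v (T-valid p ⟨ x , n ⟩ 0 u hu) hv
  ... | w , hw , u⊆ , v⊆ = derive e x n w eq eq' hw (∧-intro (u⊆ ⟨ p , ⟨ ⟨ x , n ⟩ , 0 ⟩ ⟩ (T-mem p ⟨ x , n ⟩ 0 u hu))
    (ball-complete n λ m lt → yields-mono p ⟨ x , m ⟩ v w v⊆ (λ _ e → e) (f m lt)))
  derivable (suc (suc (suc (suc (suc (suc (suc (suc (suc t))))))))) p e eq eq' (ev-zer x) refl =
    derive e x 0 0 eq eq' (valid-nil X) refl

-- Computability of the T-predicate relative to its oracle

module _ {X : SetN} where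
  opaque

    memR : ∀ {q w} → Rec X q → Rec X w → RecB X (λ z → mem (q z) (w z))
    memR {q} Q W = anyLR {p = λ z h → h ≡ᵇ q z} (≡ᵇR var (wk Q)) W

    ifB : ∀ {p q r} → RecB X p → RecB X q → RecB X r → RecB X (λ z → if p z then q z else r z)
    ifB {p} {q} {r} P Q R = mkRecB (Rec-ext (λ z → eq (p z) (q z) (r z)) (ifR P (b2nR Q) (b2nR R)))
      where
      eq : ∀ a b c → (if a then b2n b else b2n c) ≡ b2n (if a then b else c)
      eq true b c = refl
      eq false b c = refl

    recRuleR : ∀ {e p x n y w} → Rec X e → Rec X p → Rec X x → Rec X n → Rec X y → Rec X w →
      RecB X (λ z → recRule (e z) (p z) (x z) (n z) (y z) (w z))
    recRuleR {e} {p} {x} {n} {y} {w} E P N K Y W =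
      RecB-ext (λ z → eq (e z) (p z) (x z) (n z) (y z) (w z)) (ifB (nonzeroR K)
        (yieldsR {φ = λ z v → mem ⟨ π₂ (p z) , ⟨ ⟨ x z , ⟨ pred (n z) , v ⟩ ⟩ , y z ⟩ ⟩ (w z)}
          E (pairR N (predR K)) (memR (pairR (wk (π₂R P)) (pairR (pairR (wk N) (pairR (wk (predR K)) var)) (wk Y))) (wk W)) W)
        (memR (pairR (π₁R P) (pairR N Y)) W))
      where
      eq : ∀ e p x n y w → (if nonzero n
          then yields e ⟨ x , pred n ⟩ (λ v → mem ⟨ π₂ p , ⟨ ⟨ x , ⟨ pred n , v ⟩ ⟩ , y ⟩ ⟩ w) w
          else mem ⟨ π₁ p , ⟨ x , y ⟩ ⟩ w) ≡ recRule e p x n y w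
      eq e p x zero y w = refl
      eq e p x (suc n) y w = refl

    ruleR : ∀ {t p e x y w} → Rec X t → Rec X p → Rec X e → Rec X x → Rec X y → Rec X w →
      RecB X (λ z → rule X (t z) (p z) (e z) (x z) (y z) (w z))
    ruleR {t} {p} {e} {x} {y} {w} K P E N Y W =
      ifB (≡ᵇR K (constR 1)) (≡ᵇR Y (sucR N)) (
      ifB (≡ᵇR K (constR 2)) (≡ᵇR Y (π₁R N)) (
      ifB (≡ᵇR K (constR 3)) (≡ᵇR Y (π₂R N)) (
      ifB (≡ᵇR K (constR 4)) (≡ᵇR Y (b2nR (orcR N))) (
      ifB (≡ᵇR K (constR 5))
        (yieldsR {φ = λ z m → mem ⟨ π₁ (p z) , ⟨ m , y z ⟩ ⟩ (w z)} (π₂R P) N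
          (memR (pairR (wk (π₁R P)) (pairR var (wk Y))) (wk W)) W) (
      ifB (≡ᵇR K (constR 6))
        (andR (memR (pairR (π₁R P) (pairR N (π₁R Y))) W) (memR (pairR (π₂R P) (pairR N (π₂R Y))) W)) (
      ifB (≡ᵇR K (constR 7)) (recRuleR E P (π₁R N) (π₂R N) Y W) (
      ifB (≡ᵇR K (constR 8))
        (andR (memR (pairR P (pairR (pairR N Y) (constR 0))) W)
          (ballR {p = λ z m → yields (p z) ⟨ x z , m ⟩ nonzero (w z)}
            (yieldsR {φ = λ _ v → nonzero v} (wk P) (pairR (wk N) var) (nonzeroR var) (wk W)) Y))
      (≡ᵇR Y (constR 0)))))))))

    justifiedR : ∀ {q w} → Rec X q → Rec X w → RecB X (λ z → justified X (q z) (w z))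
    justifiedR Q W = ruleR (π₁R (π₁R Q)) (π₂R (π₁R Q)) (π₁R Q) (π₁R (π₂R Q)) (π₂R (π₂R Q)) W

    opaque
      unfolding valid

      validR : ∀ {w} → Rec X w → RecB X (λ z → valid X (w z))
      validR W = nonzeroR (paraR {c = λ _ h t r → if justified X h t then r else 0} (constR 1)
        (ifR (justifiedR (π₁R (π₂R idR)) (π₁R (π₂R (π₂R idR)))) (π₂R (π₂R (π₂R idR))) (constR 0)) W)

  opaque
    unfolding T

    TR : ∀ {e x y w} → Rec X e → Rec X x → Rec X y → Rec X w → RecB X (λ z → T X (e z) (x z) (y z) (w z))
    TR E N Y W = andR (validR W) (memR (pairR E (pairR N Y)) W)

opaque
  T-relR : ∀ {X Y} → X ≤T Y → ∀ {e x y w} → Rec Y e → Rec Y x → Rec Y y → Rec Y w →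
    RecB Y (λ z → T X (e z) (x z) (y z) (w z))
  T-relR {X} {Y} le {e} {x} {y} {w} E N V W = RecB-ext (λ z → eq (e z) (x z) (y z) (w z))
    (RecB-rel le (TR (π₁R idR) (π₁R (π₂R idR)) (π₁R (π₂R (π₂R idR))) (π₂R (π₂R (π₂R idR)))) ∘B pairR E (pairR N (pairR V W)))
    where
    eq : ∀ e x y w → let u = ⟨ e , ⟨ x , ⟨ y , w ⟩ ⟩ ⟩ in
      T X (π₁ u) (π₁ (π₂ u)) (π₁ (π₂ (π₂ u))) (π₂ (π₂ (π₂ u))) ≡ T X e x y w
    eq e x y w rewrite π₁-⟨⟩ e ⟨ x , ⟨ y , w ⟩ ⟩ | π₂-⟨⟩ e ⟨ x , ⟨ y , w ⟩ ⟩
      | π₁-⟨⟩ x ⟨ y , w ⟩ | π₂-⟨⟩ x ⟨ y , w ⟩ | π₁-⟨⟩ y w | π₂-⟨⟩ y w = refl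

-- The arithmetical hierarchy

record _⇔_ (P Q : Set) : Set where
  constructor mk⇔
  field
    to : P → Q
    from : Q → P

open _⇔_

ΣQ-map : ∀ n {P Q : ℕ → Set} → (∀ z → P z → Q z) → ∀ {x} → ΣQ n P x → ΣQ n Q x
ΠQ-map : ∀ n {P Q : ℕ → Set} → (∀ z → P z → Q z) → ∀ {x} → ΠQ n P x → ΠQ n Q x
ΣQ-map zero f {x} p = f x p
ΣQ-map (suc n) f (y , p) = y , ΠQ-map n f p
ΠQ-map zero f {x} p = f x p
ΠQ-map (suc n) f p y = ΣQ-map n f (p y)

record Sig (n : ℕ) (X : SetN) (W : ℕ → Set) : Set where
  constructor mkSig
  field
    matrix : ℕ → Bool
    matrixR : RecB X matrix
    defines : ∀ x → W x ⇔ ΣQ n (λ z → matrix z ≡ true) x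

opaque
  Sig⇒IsΣ : ∀ {n X W} → Sig n X W → IsΣ n X W
  Sig⇒IsΣ {n} {X} {W} (mkSig R RR iff) = code N , (λ x → _ , evaluates N x) ,
    λ x → (λ w → ΣQ-map n (λ z e → subst (Ev X (code N) z) (cong (b2n ∘ not) e) (evaluates N z)) (to (iff x) w)) ,
          (λ s → from (iff x) (ΣQ-map n (λ z e → matrix-true (R z) (Ev-det (evaluates N z) e)) s))
    where
    N : Rec X (λ z → b2n (not (R z)))
    N = b2nR (notR RR)
    matrix-true : ∀ b → b2n (not b) ≡ 0 → b ≡ true
    matrix-true true _ = refl

opaque
  IsΣ⇒Sig : ∀ {n X W} → IsΣ n X W → Sig n X W
  IsΣ⇒Sig {n} {X} {W} (c , total , iff) = mkSig (λ z → not (nonzero (proj₁ (total z))))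
    (notR (nonzeroR (mkRec c (λ z → proj₂ (total z)))))
    (λ x → mk⇔ (λ w → ΣQ-map n (λ z e → cong (not ∘ nonzero) (Ev-det (proj₂ (total z)) e)) (proj₁ (iff x) w))
      (λ s → proj₂ (iff x) (ΣQ-map n (λ z e → subst (Ev X c z) (value-zero _ e) (proj₂ (total z))) s)))
    where
    value-zero : ∀ v → not (nonzero v) ≡ true → v ≡ 0
    value-zero zero _ = refl

opaque
  Sig-rel : ∀ {n X Y W} → X ≤T Y → Sig n X W → Sig n Y W
  Sig-rel le (mkSig R RR iff) = mkSig R (RecB-rel le RR) iff

opaque
  Sig-⇔ : ∀ {n X V W} → (∀ x → V x ⇔ W x) → Sig n X V → Sig n X W
  Sig-⇔ eq (mkSig R RR iff) = mkSig R RR (λ x → mk⇔ (to (iff x) ∘ from (eq x)) (to (eq x) ∘ from (iff x)))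

-- Applies a to the first of n + 1 variables, and g to each of the others.
reindex : (ℕ → ℕ) → ℕ → (ℕ → ℕ) → ℕ → ℕ
reindex g zero a z = a z
reindex g (suc n) a = reindex g n (λ z → ⟨ a (π₁ z) , g (π₂ z) ⟩)

reindexR : ∀ {X g} n {a} → Rec X g → Rec X a → Rec X (reindex g n a)
reindexR zero G A = A
reindexR {g = g} (suc n) G A = reindexR n G (pairR (wk A) (G ∘R var))

reindex-⟨⟩ : ∀ (g a : ℕ → ℕ) x y → ⟨ a (π₁ ⟨ x , y ⟩) , g (π₂ ⟨ x , y ⟩) ⟩ ≡ ⟨ a x , g y ⟩
reindex-⟨⟩ g a x y = cong₂ (λ u v → ⟨ a u , g v ⟩) (π₁-⟨⟩ x y) (π₂-⟨⟩ x y)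

ΣQ-reindex : ∀ n (P : ℕ → Set) a x → ΣQ n (λ z → P (reindex (λ y → y) n a z)) x ⇔ ΣQ n P (a x)
ΠQ-reindex : ∀ n (P : ℕ → Set) a x → ΠQ n (λ z → P (reindex (λ y → y) n a z)) x ⇔ ΠQ n P (a x)
ΣQ-reindex zero P a x = mk⇔ (λ p → p) (λ p → p)
ΣQ-reindex (suc n) P a x = mk⇔
  (λ (y , p) → y , subst (ΠQ n P) (reindex-⟨⟩ (λ y → y) a x y) (to (ΠQ-reindex n P _ ⟨ x , y ⟩) p))
  (λ (y , p) → y , from (ΠQ-reindex n P _ ⟨ x , y ⟩) (subst (ΠQ n P) (sym (reindex-⟨⟩ (λ y → y) a x y)) p))
ΠQ-reindex zero P a x = mk⇔ (λ p → p) (λ p → p)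
ΠQ-reindex (suc n) P a x = mk⇔
  (λ p y → subst (ΣQ n P) (reindex-⟨⟩ (λ y → y) a x y) (to (ΣQ-reindex n P _ ⟨ x , y ⟩) (p y)))
  (λ p y → from (ΣQ-reindex n P _ ⟨ x , y ⟩) (subst (ΣQ n P) (sym (reindex-⟨⟩ (λ y → y) a x y)) (p y)))

opaque
  Sig-reindex : ∀ {n X W a} → Rec X a → Sig n X W → Sig n X (λ x → W (a x))
  Sig-reindex {n} {X} {W} {a} A (mkSig R RR iff) = mkSig (λ z → R (reindex (λ y → y) n a z)) (RR ∘B reindexR n idR A)
    (λ x → let e = ΣQ-reindex n (λ z → R z ≡ true) a x in mk⇔ (from e ∘ to (iff (a x))) (from (iff (a x)) ∘ to e))

-- Both prefixes are read in parallel: each quantified variable codes a pair, of which `P` sees the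
-- first and `Q` the second component. From a universal variable either conjunct is recovered at the
-- pair `⟨ y , y ⟩`.
ΣQ-× : ∀ n (P Q : ℕ → Set) a b x →
  ΣQ n (λ z → P (reindex π₁ n a z) × Q (reindex π₂ n b z)) x ⇔ (ΣQ n P (a x) × ΣQ n Q (b x))
ΠQ-× : ∀ n (P Q : ℕ → Set) a b x →
  ΠQ n (λ z → P (reindex π₁ n a z) × Q (reindex π₂ n b z)) x ⇔ (ΠQ n P (a x) × ΠQ n Q (b x))
ΣQ-× zero P Q a b x = mk⇔ (λ p → p) (λ p → p)
ΣQ-× (suc n) P Q a b x = mk⇔
  (λ (y , p) → let (p₁ , p₂) = to (ΠQ-× n P Q _ _ ⟨ x , y ⟩) p in
    (π₁ y , subst (ΠQ n P) (reindex-⟨⟩ π₁ a x y) p₁) , (π₂ y , subst (ΠQ n Q) (reindex-⟨⟩ π₂ b x y) p₂))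
  (λ ((y , p) , (z , q)) → ⟨ y , z ⟩ , from (ΠQ-× n P Q _ _ ⟨ x , ⟨ y , z ⟩ ⟩)
    ( subst (ΠQ n P) (sym (trans (reindex-⟨⟩ π₁ a x ⟨ y , z ⟩) (cong ⟨ a x ,_⟩ (π₁-⟨⟩ y z)))) p
    , subst (ΠQ n Q) (sym (trans (reindex-⟨⟩ π₂ b x ⟨ y , z ⟩) (cong ⟨ b x ,_⟩ (π₂-⟨⟩ y z)))) q))
ΠQ-× zero P Q a b x = mk⇔ (λ p → p) (λ p → p)
ΠQ-× (suc n) P Q a b x = mk⇔
  (λ p → (λ y → let p₁ = proj₁ (to (ΣQ-× n P Q _ _ ⟨ x , ⟨ y , y ⟩ ⟩) (p ⟨ y , y ⟩)) in
      subst (ΣQ n P) (trans (reindex-⟨⟩ π₁ a x ⟨ y , y ⟩) (cong ⟨ a x ,_⟩ (π₁-⟨⟩ y y))) p₁)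
    , (λ y → let p₂ = proj₂ (to (ΣQ-× n P Q _ _ ⟨ x , ⟨ y , y ⟩ ⟩) (p ⟨ y , y ⟩)) in
      subst (ΣQ n Q) (trans (reindex-⟨⟩ π₂ b x ⟨ y , y ⟩) (cong ⟨ b x ,_⟩ (π₂-⟨⟩ y y))) p₂))
  (λ (p , q) y → from (ΣQ-× n P Q _ _ ⟨ x , y ⟩)
    ( subst (ΣQ n P) (sym (reindex-⟨⟩ π₁ a x y)) (p (π₁ y))
    , subst (ΣQ n Q) (sym (reindex-⟨⟩ π₂ b x y)) (q (π₂ y))))

opaque
  Sig-× : ∀ {n X V W} → Sig n X V → Sig n X W → Sig n X (λ x → V x × W x)
  Sig-× {n} (mkSig R RR iff) (mkSig R' RR' iff') = mkSig
    (λ z → R (reindex π₁ n (λ x → x) z) ∧ R' (reindex π₂ n (λ x → x) z))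
    (andR (RR ∘B reindexR n (π₁R idR) idR) (RR' ∘B reindexR n (π₂R idR) idR))
    (λ x → let e = ΣQ-× n (λ z → R z ≡ true) (λ z → R' z ≡ true) (λ x → x) (λ x → x) x in mk⇔
      (λ (v , w) → ΣQ-map n (λ z (p , q) → ∧-intro p q) (from e (to (iff x) v , to (iff' x) w)))
      (λ s → let (v , w) = to e (ΣQ-map n (λ z p → ∧-left p , ∧-right {R (reindex π₁ n (λ x → x) z)} p) s) in
        from (iff x) v , from (iff' x) w))

-- The new quantifier is innermost and vacuous, so the alternation is respected whether it is
-- existential or universal.
ΣQ-dummy : ∀ n (P : ℕ → Set) x → ΣQ n P x ⇔ ΣQ (suc n) (λ z → P (π₁ z)) x
ΠQ-dummy : ∀ n (P : ℕ → Set) x → ΠQ n P x ⇔ ΠQ (suc n) (λ z → P (π₁ z)) x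
ΣQ-dummy zero P x = mk⇔ (λ p → 0 , subst P (sym (π₁-⟨⟩ x 0)) p) (λ (y , p) → subst P (π₁-⟨⟩ x y) p)
ΣQ-dummy (suc n) P x = mk⇔ (λ (y , p) → y , to (ΠQ-dummy n P ⟨ x , y ⟩) p) (λ (y , p) → y , from (ΠQ-dummy n P ⟨ x , y ⟩) p)
ΠQ-dummy zero P x = mk⇔ (λ p y → subst P (sym (π₁-⟨⟩ x y)) p) (λ p → subst P (π₁-⟨⟩ x 0) (p 0))
ΠQ-dummy (suc n) P x = mk⇔ (λ p y → to (ΣQ-dummy n P ⟨ x , y ⟩) (p y)) (λ p y → from (ΣQ-dummy n P ⟨ x , y ⟩) (p y))

opaque
  Sig-suc : ∀ {n X W} → Sig n X W → Sig (suc n) X W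
  Sig-suc {n} (mkSig R RR iff) = mkSig (λ z → R (π₁ z)) (wkB RR)
    (λ x → let e = ΣQ-dummy n (λ z → R z ≡ true) x in mk⇔ (to e ∘ to (iff x)) (from (iff x) ∘ from e))

opaque
  Sig-≤ : ∀ {m n X W} → m ≤ n → Sig m X W → Sig n X W
  Sig-≤ {m} {n} {X} {W} le s = subst (λ k → Sig k X W) (m∸n+n≡m le) (go (n ∸ m))
    where
    go : ∀ k → Sig (k + m) X W
    go zero = s
    go (suc k) = Sig-suc (go k)

opaque
  Sig-dec : ∀ {X n p} → RecB X p → Sig n X (λ x → p x ≡ true)
  Sig-dec {p = p} P = Sig-≤ z≤n (mkSig p P (λ x → mk⇔ (λ e → e) (λ e → e)))

record Pi2 (X : SetN) (W : ℕ → Set) : Set where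
  constructor mkPi2
  field
    matrix : ℕ → ℕ → ℕ → Bool
    matrixR : RecB X (λ u → matrix (π₁ (π₁ u)) (π₂ (π₁ u)) (π₂ u))
    defines : ∀ x → W x ⇔ (∀ a → ∃ λ b → matrix x a b ≡ true)

opaque
  Pi2-× : ∀ {X V W} → Pi2 X V → Pi2 X W → Pi2 X (λ x → V x × W x)
  Pi2-× (mkPi2 R RR iff) (mkPi2 R' RR' iff') = mkPi2 (λ x a b → R x a (π₁ b) ∧ R' x a (π₂ b))
    (andR (RecB-ext (λ u → cong₂ (λ v b → R (π₁ v) (π₂ v) b) (π₁-⟨⟩ (π₁ u) (π₁ (π₂ u))) (π₂-⟨⟩ (π₁ u) (π₁ (π₂ u))))
            (RR ∘B pairR (π₁R idR) (π₁R var)))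
          (RecB-ext (λ u → cong₂ (λ v b → R' (π₁ v) (π₂ v) b) (π₁-⟨⟩ (π₁ u) (π₂ (π₂ u))) (π₂-⟨⟩ (π₁ u) (π₂ (π₂ u))))
            (RR' ∘B pairR (π₁R idR) (π₂R var))))
    (λ x → mk⇔ (λ (v , w) a → let (b , p) = to (iff x) v a ; (c , q) = to (iff' x) w a in
        ⟨ b , c ⟩ , ∧-intro (trans (cong (R x a) (π₁-⟨⟩ b c)) p) (trans (cong (R' x a) (π₂-⟨⟩ b c)) q))
      (λ h → from (iff x) (λ a → let (b , p) = h a in π₁ b , ∧-left p) ,
             from (iff' x) (λ a → let (b , p) = h a in π₂ b , ∧-right {R x a (π₁ b)} p)))

opaque
  Pi1⇒Pi2 : ∀ {X} (r : ℕ → ℕ → Bool) → RecB X (λ u → r (π₁ u) (π₂ u)) → Pi2 X (λ x → ∀ a → r x a ≡ true)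
  Pi1⇒Pi2 r R = mkPi2 (λ x a _ → r x a) (wkB R) (λ x → mk⇔ (λ h a → 0 , h a) (λ h a → proj₂ (h a)))

opaque
  -- The bound `3 ≤ n` comes from here: a vacuous existential quantifier in front turns Π⁰₂ into
  -- Σ⁰₃, and being the index of a condition is Π⁰₂.
  Pi2⇒Sig : ∀ {n X W} → 3 ≤ n → Pi2 X W → Sig n X W
  Pi2⇒Sig {n} {X} {W} le (mkPi2 R RR iff) = Sig-≤ le (mkSig
    (λ z → R (π₁ (π₁ (π₁ z))) (π₂ (π₁ z)) (π₂ z))
    (RecB-ext (λ z → eq (π₁ (π₁ (π₁ z))) (π₂ (π₁ z)) (π₂ z))
      (RR ∘B pairR (pairR (π₁R (π₁R (π₁R idR))) (π₂R (π₁R idR))) var))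
    (λ x → mk⇔ (λ w → 0 , λ a → let (b , p) = to (iff x) w a in b , trans (eq' x 0 a b) p)
      (λ (c , h) → from (iff x) (λ a → let (b , p) = h a in b , trans (sym (eq' x c a b)) p))))
    where
    eq : ∀ x a b → R (π₁ (π₁ ⟨ ⟨ x , a ⟩ , b ⟩)) (π₂ (π₁ ⟨ ⟨ x , a ⟩ , b ⟩)) (π₂ ⟨ ⟨ x , a ⟩ , b ⟩) ≡ R x a b
    eq x a b rewrite π₁-⟨⟩ ⟨ x , a ⟩ b | π₂-⟨⟩ ⟨ x , a ⟩ b | π₁-⟨⟩ x a | π₂-⟨⟩ x a = refl
    eq' : ∀ x c a b → let z = ⟨ ⟨ ⟨ x , c ⟩ , a ⟩ , b ⟩ in R (π₁ (π₁ (π₁ z))) (π₂ (π₁ z)) (π₂ z) ≡ R x a b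
    eq' x c a b rewrite π₁-⟨⟩ ⟨ ⟨ x , c ⟩ , a ⟩ b | π₂-⟨⟩ ⟨ ⟨ x , c ⟩ , a ⟩ b | π₁-⟨⟩ ⟨ x , c ⟩ a | π₂-⟨⟩ ⟨ x , c ⟩ a
      | π₁-⟨⟩ x c = refl

opaque
  Σ₂-sentence : ∀ {n X} (r : ℕ → ℕ → Bool) → 3 ≤ n → RecB X (λ u → r (π₁ u) (π₂ u)) →
    Sig n X (λ _ → ∃ λ a → ∀ b → r a b ≡ true)
  Σ₂-sentence r le R = Sig-≤ (≤-trans (n≤1+n 2) le) (mkSig (λ z → r (π₂ (π₁ z)) (π₂ z))
    (RecB-ext (λ z → cong₂ r (π₁-⟨⟩ (π₂ (π₁ z)) (π₂ z)) (π₂-⟨⟩ (π₂ (π₁ z)) (π₂ z))) (R ∘B pairR (π₂R (π₁R idR)) var))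
    (λ x → mk⇔ (λ (a , h) → a , λ b → trans (eq x a b) (h b)) (λ (a , h) → a , λ b → trans (sym (eq x a b)) (h b))))
    where
    eq : ∀ x a b → r (π₂ (π₁ ⟨ ⟨ x , a ⟩ , b ⟩)) (π₂ ⟨ ⟨ x , a ⟩ , b ⟩) ≡ r a b
    eq x a b rewrite π₁-⟨⟩ ⟨ x , a ⟩ b | π₂-⟨⟩ ⟨ x , a ⟩ b | π₂-⟨⟩ x a = refl

-- Turing reducibility and joins

opaque
  ≤T-trans : ∀ {X Y Z} → X ≤T Y → Y ≤T Z → X ≤T Z
  ≤T-trans p q = RecB⇒≤T (RecB-rel q (≤T⇒RecB p))

opaque
  ∅-≤T : ∀ {X} → ∅ₛ ≤T X
  ∅-≤T = RecB⇒≤T (constB false)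

⊕-even : ∀ x A B → (A ⊕ B) (x + x) ≡ A x
⊕-even zero A B = refl
⊕-even (suc x) A B rewrite +-suc x x = ⊕-even x (λ k → A (suc k)) (λ k → B (suc k))

⊕-odd : ∀ x A B → (A ⊕ B) (suc (x + x)) ≡ B x
⊕-odd zero A B = refl
⊕-odd (suc x) A B rewrite +-suc x x = ⊕-odd x (λ k → A (suc k)) (λ k → B (suc k))

opaque
  ≤T-⊕ˡ : ∀ {A B} → A ≤T (A ⊕ B)
  ≤T-⊕ˡ {A} {B} = RecB⇒≤T (RecB-ext (λ x → ⊕-even x A B) (orcR (plusR idR idR)))

opaque
  ≤T-⊕ʳ : ∀ {A B} → B ≤T (A ⊕ B)
  ≤T-⊕ʳ {A} {B} = RecB⇒≤T (RecB-ext (λ x → ⊕-odd x A B) (orcR (sucR (plusR idR idR))))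

∅⊕∅ : ∀ x → (∅ₛ ⊕ ∅ₛ) x ≡ false
∅⊕∅ zero = refl
∅⊕∅ (suc zero) = refl
∅⊕∅ (suc (suc x)) = ∅⊕∅ x

opaque
  ∅⊕∅-≤T : ∀ {X} → (∅ₛ ⊕ ∅ₛ) ≤T X
  ∅⊕∅-≤T = RecB⇒≤T (RecB-ext (λ x → sym (∅⊕∅ x)) (constB false))

-- Canonical indices of finite sets

isOdd-suc : ∀ n → isOdd (suc n) ≡ not (isOdd n)
isOdd-suc zero = refl
isOdd-suc (suc zero) = refl
isOdd-suc (suc (suc n)) = isOdd-suc n

half-suc : ∀ n → ⌊ suc n /2⌋ ≡ (if isOdd n then suc ⌊ n /2⌋ else ⌊ n /2⌋)
half-suc zero = refl
half-suc (suc zero) = refl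
half-suc (suc (suc n)) with isOdd n | half-suc n
... | true | eq = cong suc eq
... | false | eq = cong suc eq

isOdd-double : ∀ n → isOdd (n + n) ≡ false
isOdd-double zero = refl
isOdd-double (suc n) rewrite +-suc n n = isOdd-double n

double-half : ∀ n → n ≡ ⌊ n /2⌋ + ⌊ n /2⌋ + b2n (isOdd n)
double-half zero = refl
double-half (suc zero) = refl
double-half (suc (suc n)) = cong suc (trans (cong suc (double-half n))
  (cong (_+ b2n (isOdd n)) (sym (+-suc ⌊ n /2⌋ ⌊ n /2⌋))))

bit-zero : ∀ x → bit 0 x ≡ false
bit-zero zero = refl
bit-zero (suc x) = bit-zero x

bit⇒< : ∀ d x → bit d x ≡ true → x < d
bit⇒< (suc d) zero _ = s≤s z≤n
bit⇒< zero (suc x) e = ⊥-elim (true≢false e (bit-zero x))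
bit⇒< (suc zero) (suc x) e = ⊥-elim (true≢false e (bit-zero x))
bit⇒< (suc (suc d)) (suc x) e = s≤s (≤-trans (bit⇒< ⌊ suc (suc d) /2⌋ x e) (s≤s (⌊n/2⌋≤n d)))

bit-injective : ∀ d d' → (∀ x → bit d x ≡ bit d' x) → d ≡ d'
bit-injective d d' = go (d + d') d d' ≤-refl
  where
  go : ∀ s d d' → d + d' ≤ s → (∀ x → bit d x ≡ bit d' x) → d ≡ d'
  go s zero zero _ h = refl
  go (suc s) (suc d) d' (s≤s le) h = trans (double-half (suc d)) (trans (cong₂ (λ a b → a + a + b2n b)
    (go s ⌊ suc d /2⌋ ⌊ d' /2⌋ (≤-trans (+-mono-≤ (≤-pred (⌊n/2⌋<n d)) (⌊n/2⌋≤n d')) le) (λ x → h (suc x))) (h 0))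
    (sym (double-half d')))
  go (suc s) zero (suc d') (s≤s le) h = trans (cong₂ (λ a b → a + a + b2n b)
    (go s 0 ⌊ suc d' /2⌋ (≤-trans (≤-pred (⌊n/2⌋<n d')) le) (λ x → h (suc x))) (h 0))
    (sym (double-half (suc d')))

canonIdx : ∀ b D → (∀ x → b ≤ x → D x ≡ false) → ∃ λ d → CanonIdx d D
canonIdx zero D h = 0 , λ x → trans (h x z≤n) (sym (bit-zero x))
canonIdx (suc b) D h with canonIdx b (D ∘ suc) (λ x le → h (suc x) (s≤s le)) | D 0 in eq
... | d , c | false = d + d , λ
  { zero → trans eq (sym (isOdd-double d)) ; (suc x) → trans (c x) (cong (λ v → bit v x) (n≡⌊n+n/2⌋ d)) }
... | d , c | true = suc (d + d) , λ
  { zero → trans eq (sym (trans (isOdd-suc (d + d)) (cong not (isOdd-double d))))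
  ; (suc x) → trans (c x) (cong (λ v → bit v x) (n≡⌈n+n/2⌉ d)) }

module _ {X : SetN} where
  opaque

    isOddR : ∀ {f} → Rec X f → RecB X (λ z → isOdd (f z))
    isOddR {f} F = mkRecB (Rec-ext (λ z → eq (f z))
      (natrecR {s = λ _ _ v → b2n (not (nonzero v))} (constR 0) (b2nR (notR (nonzeroR (π₂R (π₂R idR))))) F))
      where
      nonzero-b2n : ∀ b → nonzero (b2n b) ≡ b
      nonzero-b2n true = refl
      nonzero-b2n false = refl
      eq : ∀ n → natrec 0 (λ _ v → b2n (not (nonzero v))) n ≡ b2n (isOdd n)
      eq zero = refl
      eq (suc n) = cong b2n (trans (cong not (trans (cong nonzero (eq n)) (nonzero-b2n (isOdd n)))) (sym (isOdd-suc n)))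

    halfR : ∀ {f} → Rec X f → Rec X (λ z → ⌊ f z /2⌋)
    halfR {f} F = Rec-ext (λ z → eq (f z)) (natrecR {s = λ _ n v → if isOdd n then suc v else v} (constR 0)
      (ifR (isOddR (π₁R (π₂R idR))) (sucR (π₂R (π₂R idR))) (π₂R (π₂R idR))) F)
      where
      eq : ∀ n → natrec 0 (λ n v → if isOdd n then suc v else v) n ≡ ⌊ n /2⌋
      eq zero = refl
      eq (suc n) = trans (cong (λ v → if isOdd n then suc v else v) (eq n)) (sym (half-suc n))

    bitR : ∀ {d x} → Rec X d → Rec X x → RecB X (λ z → bit (d z) (x z))
    bitR {d} {x} D N = RecB-ext (λ z → eq (x z) (d z))
      (isOddR (natrecR {s = λ _ _ v → ⌊ v /2⌋} D (halfR (π₂R (π₂R idR))) N))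
      where
      shift : ∀ x d → natrec ⌊ d /2⌋ (λ _ v → ⌊ v /2⌋) x ≡ ⌊ natrec d (λ _ v → ⌊ v /2⌋) x /2⌋
      shift zero d = refl
      shift (suc x) d = cong ⌊_/2⌋ (shift x d)
      eq : ∀ x d → isOdd (natrec d (λ _ v → ⌊ v /2⌋) x) ≡ bit d x
      eq zero d = refl
      eq (suc x) d = trans (cong isOdd (sym (shift x d))) (eq x ⌊ d /2⌋)

-- Indices of conditions

module Index (A₀ A₁ : SetN) where

  -- In `totalM` the witness `u` carries a value below 2 and computations of it by both programs, so
  -- that totality and agreement form a single Π⁰₂ clause. In `infiniteM` it carries an element and
  -- the computation that puts it into the set.
  totalM infiniteM : ℕ → ℕ → ℕ → Bool
  totalM k h u = (π₁ u <ᵇ 2) ∧ (T A₀ (π₁ (π₂ k)) h (π₁ u) (π₁ (π₂ u)) ∧ T A₁ (π₂ (π₂ k)) h (π₁ u) (π₂ (π₂ u)))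
  infiniteM k m u = not (π₁ u <ᵇ m) ∧ T A₀ (π₁ (π₂ k)) (π₁ u) 1 (π₂ u)

  aboveM : ℕ → ℕ → Bool
  aboveM k a = (bit (π₁ k) (π₁ a) ∧ T A₀ (π₁ (π₂ k)) (π₁ (π₂ a)) 1 (π₂ (π₂ a))) ⇒ᵇ (π₁ a <ᵇ π₁ (π₂ a))

  Valid : ℕ → Set
  Valid k = (∀ h → ∃ λ u → totalM k h u ≡ true) × (∀ m → ∃ λ u → infiniteM k m u ≡ true) × (∀ a → aboveM k a ≡ true)

  Valid-Pi2 : Pi2 (A₀ ⊕ A₁) Valid
  Valid-Pi2 = Pi2-× (mkPi2 totalM totalR (λ _ → mk⇔ (λ h → h) (λ h → h)))
    (Pi2-× (mkPi2 infiniteM infiniteR (λ _ → mk⇔ (λ h → h) (λ h → h))) (Pi1⇒Pi2 aboveM aboveR))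
    where
    T₀ : ∀ {e x y w} → Rec (A₀ ⊕ A₁) e → Rec (A₀ ⊕ A₁) x → Rec (A₀ ⊕ A₁) y → Rec (A₀ ⊕ A₁) w →
      RecB (A₀ ⊕ A₁) (λ z → T A₀ (e z) (x z) (y z) (w z))
    T₀ = T-relR ≤T-⊕ˡ
    totalR = andR (<ᵇR (π₁R var) (constR 2)) (andR
      (T₀ (π₁R (π₂R (wk (π₁R idR)))) (wk (π₂R idR)) (π₁R var) (π₁R (π₂R var)))
      (T-relR ≤T-⊕ʳ (π₂R (π₂R (wk (π₁R idR)))) (wk (π₂R idR)) (π₁R var) (π₂R (π₂R var))))
    infiniteR = andR (notR (<ᵇR (π₁R var) (wk (π₂R idR))))
      (T₀ (π₁R (π₂R (wk (π₁R idR)))) (π₁R var) (constR 1) (π₂R var))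
    aboveR = ⇒R (andR (bitR (wk (π₁R idR)) (π₁R var)) (T₀ (wk (π₁R (π₂R idR))) (π₁R (π₂R var)) (constR 1) (π₂R (π₂R var))))
      (<ᵇR (π₁R var) (π₁R (π₂R var)))

  module _ {I : Ideal} (exact : ExactPair I A₀ A₁) where

    Valid⇒IsIndex : ∀ k → Valid k → Σ SetN λ S → IsIndex I A₀ A₁ k (bit (π₁ k) , S)
    Valid⇒IsIndex k (total , infinite , above) = S ,
      (((π₁ k , λ x le → ¬true⇒false λ e → <⇒≱ (bit⇒< (π₁ k) x e) le) , inf , sep) ,
        proj₂ (exact S) ((_ , comp₀) , (_ , comp₁))) ,
      π₁ k , π₁ (π₂ k) , π₂ (π₂ k) ,
      sym (trans (cong ⟨ π₁ k ,_⟩ (⟨π₁,π₂⟩ (π₂ k))) (⟨π₁,π₂⟩ k)) , (λ _ → refl) , comp₀ , comp₁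
      where
      -- Membership is read off the totality witnesses, which contain the common value of the two
      -- programs.
      S : SetN
      S h = π₁ (proj₁ (total h)) ≡ᵇ 1
      χ-S : ∀ h → χ S h ≡ π₁ (proj₁ (total h))
      χ-S h = go (π₁ (proj₁ (total h))) (<ᵇ-sound (∧-left (proj₂ (total h))))
        where
        go : ∀ v → v < 2 → b2n (v ≡ᵇ 1) ≡ v
        go zero _ = refl
        go (suc zero) _ = refl
        go (suc (suc v)) (s≤s (s≤s ()))
      T-parts : ∀ h → let u = proj₁ (total h) in
        T A₀ (π₁ (π₂ k)) h (π₁ u) (π₁ (π₂ u)) ∧ T A₁ (π₂ (π₂ k)) h (π₁ u) (π₂ (π₂ u)) ≡ true
      T-parts h = ∧-right {π₁ (proj₁ (total h)) <ᵇ 2} (proj₂ (total h))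
      comp₀ : Computes A₀ (decode (π₁ (π₂ k))) S
      comp₀ h = subst (Ev A₀ _ h) (sym (χ-S h)) (T-sound _ h _ _ (∧-left (T-parts h)))
      comp₁ : Computes A₁ (decode (π₂ (π₂ k))) S
      comp₁ h = subst (Ev A₁ _ h) (sym (χ-S h)) (T-sound _ h _ _
        (∧-right {T A₀ (π₁ (π₂ k)) h (π₁ (proj₁ (total h))) (π₁ (π₂ (proj₁ (total h))))} (T-parts h)))
      S-T : ∀ x → S x ≡ true → ∃ λ w → T A₀ (π₁ (π₂ k)) x 1 w ≡ true
      S-T x e = T-complete (π₁ (π₂ k)) (subst (Ev A₀ _ x) (cong b2n e) (comp₀ x))
      T-S : ∀ x w → T A₀ (π₁ (π₂ k)) x 1 w ≡ true → S x ≡ true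
      T-S x w e = ≡ᵇ-complete (trans (sym (χ-S x)) (Ev-det (comp₀ x) (T-sound _ x 1 w e)))
      inf : InfiniteS S
      inf m = let (u , e) = infinite m in π₁ u , ≮⇒≥ (λ lt → not-elim (∧-left e) (<ᵇ-complete lt)) ,
        T-S (π₁ u) (π₂ u) (∧-right {not (π₁ u <ᵇ m)} e)
      sep : ∀ x y → x ∈ₛ bit (π₁ k) → y ∈ₛ S → x < y
      sep x y bx sy with S-T y sy
      ... | w , t = <ᵇ-sound (eq (above ⟨ x , ⟨ y , w ⟩ ⟩))
        where
        eq : aboveM k ⟨ x , ⟨ y , w ⟩ ⟩ ≡ true → (x <ᵇ y) ≡ true
        eq e rewrite π₁-⟨⟩ x ⟨ y , w ⟩ | π₂-⟨⟩ x ⟨ y , w ⟩ | π₁-⟨⟩ y w | π₂-⟨⟩ y w =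
          ⇒ᵇ-elim e (∧-intro bx t)

    IsIndex⇒Valid : ∀ k {D S} → IsIndex I A₀ A₁ k (D , S) → Valid k
    IsIndex⇒Valid k {D} {S} ((math , _) , d , e₀ , e₁ , refl , canon , comp₀ , comp₁) = total , infinite , above
      where
      i₀ : π₁ (π₂ k) ≡ e₀
      i₀ = trans (cong π₁ (π₂-⟨⟩ d ⟨ e₀ , e₁ ⟩)) (π₁-⟨⟩ e₀ e₁)
      i₁ : π₂ (π₂ k) ≡ e₁
      i₁ = trans (cong π₂ (π₂-⟨⟩ d ⟨ e₀ , e₁ ⟩)) (π₂-⟨⟩ e₀ e₁)
      total : ∀ h → ∃ λ u → totalM k h u ≡ true
      total h with T-complete e₀ (comp₀ h) | T-complete e₁ (comp₁ h)
      ... | w₀ , t₀ | w₁ , t₁ = ⟨ χ S h , ⟨ w₀ , w₁ ⟩ ⟩ , eq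
        where
        χ<2 : ∀ b → (b2n b <ᵇ 2) ≡ true
        χ<2 true = refl
        χ<2 false = refl
        eq : totalM k h ⟨ χ S h , ⟨ w₀ , w₁ ⟩ ⟩ ≡ true
        eq rewrite i₀ | i₁ | π₁-⟨⟩ (χ S h) ⟨ w₀ , w₁ ⟩ | π₂-⟨⟩ (χ S h) ⟨ w₀ , w₁ ⟩ | π₁-⟨⟩ w₀ w₁ | π₂-⟨⟩ w₀ w₁ =
          ∧-intro (χ<2 (S h)) (∧-intro t₀ t₁)
      infinite : ∀ m → ∃ λ u → infiniteM k m u ≡ true
      infinite m with proj₁ (proj₂ math) m
      ... | x , m≤x , sx with T-complete e₀ (subst (Ev A₀ _ x) (cong b2n sx) (comp₀ x))
      ... | w , t = ⟨ x , w ⟩ , eq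
        where
        eq : infiniteM k m ⟨ x , w ⟩ ≡ true
        eq rewrite i₀ | π₁-⟨⟩ x w | π₂-⟨⟩ x w = ∧-intro (not-intro (λ e → <⇒≱ (<ᵇ-sound e) m≤x)) t
      above : ∀ a → aboveM k a ≡ true
      above a rewrite i₀ | π₁-⟨⟩ d ⟨ e₀ , e₁ ⟩ = ⇒ᵇ-intro λ e → <ᵇ-complete (proj₂ (proj₂ math) _ _
        (trans (canon _) (∧-left e)) (in-S (π₁ (π₂ a)) (π₂ (π₂ a)) (∧-right {bit d (π₁ a)} e)))
        where
        in-S : ∀ y w → T A₀ e₀ y 1 w ≡ true → S y ≡ true
        in-S y w t with S y | Ev-det (comp₀ y) (T-sound e₀ y 1 w t)
        ... | true | _ = refl

-- Restricting and extending conditions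

_above_ : SetN → ℕ → SetN
(S above x) y = S y ∧ (x <ᵇ y)

insert : SetN → ℕ → SetN
insert D x y = D y ∨ (y ≡ᵇ x)

above-⊆ : ∀ S x → (S above x) ⊆ₛ S
above-⊆ S x y = ∧-left

above-< : ∀ S x y → y ∈ₛ (S above x) → x < y
above-< S x y e = <ᵇ-sound (∧-right {S y} e)

above-infinite : ∀ S x → InfiniteS S → InfiniteS (S above x)
above-infinite S x inf m with inf (m ⊔ suc x)
... | y , le , sy = y , ≤-trans (m≤m⊔n m (suc x)) le , ∧-intro sy (<ᵇ-complete (≤-trans (m≤n⊔m m (suc x)) le))

above-≤T : ∀ S x → (S above x) ≤T S
above-≤T S x = RecB⇒≤T (andR (orcR idR) (<ᵇR (constR x) idR))

∪-introˡ : ∀ {D S : SetN} {x} → x ∈ₛ D → x ∈ₛ (D ∪ₛ S)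
∪-introˡ {D} {S} {x} e rewrite e = refl

∪-introʳ : ∀ {D S : SetN} {x} → x ∈ₛ S → x ∈ₛ (D ∪ₛ S)
∪-introʳ {D} {S} {x} e with D x
... | true = refl
... | false = e

∪-elim : ∀ {D S : SetN} {x} → x ∈ₛ (D ∪ₛ S) → x ∈ₛ D ⊎ x ∈ₛ S
∪-elim {D} {S} {x} e with D x
... | true = inj₁ refl
... | false = inj₂ e

≼-refl : ∀ c → c ≼ c
≼-refl (D , S) = (λ _ e → e) , (λ _ → ∪-introˡ {D} {S}) , λ _ e → e

≼-trans : ∀ {a b c} → a ≼ b → b ≼ c → a ≼ c
≼-trans {D , S} {D' , S'} {D'' , S''} (p , q , r) (p' , q' , r') = (λ x e → p x (p' x e)) ,
  (λ x e → case ∪-elim {D'} {S'} (q x e) of λ { (inj₁ d) → q' x d ; (inj₂ s) → ∪-introʳ {D''} {S''} (r' x s) }) ,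
  λ x e → r' x (r x e)

record Extend (I : Ideal) (d : ℕ) (S : SetN) (x : ℕ) : Set where
  field
    d' : ℕ
    bits : ∀ y → bit d' y ≡ insert (bit d) x y
    cond : ICond I (bit d' , (S above x))
    ext : (bit d' , (S above x)) ≼ (bit d , S)

module Ideals {I : Ideal} {A₀ A₁ : SetN} (exact : ExactPair I A₀ A₁) where

  I-intro : ∀ {S} → S ≤T A₀ → S ≤T A₁ → I S
  I-intro p q = proj₂ (exact _) (p , q)

  I-elim₀ : ∀ {S} → I S → S ≤T A₀
  I-elim₀ i = proj₁ (proj₁ (exact _) i)

  I-elim₁ : ∀ {S} → I S → S ≤T A₁
  I-elim₁ i = proj₂ (proj₁ (exact _) i)

  I-down : ∀ {S S'} → I S → S' ≤T S → I S'
  I-down i le = I-intro (≤T-trans le (I-elim₀ i)) (≤T-trans le (I-elim₁ i))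

  I-⊕ : ∀ {S} → I S → S ≤T (A₀ ⊕ A₁)
  I-⊕ i = ≤T-trans (I-elim₀ i) ≤T-⊕ˡ

  extend : ∀ d S x → ICond I (bit d , S) → x ∈ₛ S → Extend I d S x
  extend d S x (((_ , fin) , inf , sep) , i) sx with canonIdx (suc (d + x)) (insert (bit d) x) bounded
    where
    bounded : ∀ y → suc (d + x) ≤ y → insert (bit d) x y ≡ false
    bounded y le = ¬true⇒false λ e → case ∨-elim {bit d y} e of λ
      { (inj₁ b) → <⇒≱ (bit⇒< d y b) (≤-trans (m≤m+n d x) (<⇒≤ le))
      ; (inj₂ b) → <⇒≱ (s≤s (≤-trans (≤-reflexive (≡ᵇ-sound {y} b)) (m≤n+m x d))) le }
  ... | d' , canon = record
    { d' = d'
    ; bits = λ y → sym (canon y)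
    ; cond = ((d' , λ y le → ¬true⇒false λ e → <⇒≱ (bit⇒< d' y e) le) , above-infinite S x inf , sep') ,
        I-down i (above-≤T S x)
    ; ext = (λ y e → trans (sym (canon y)) (∨-introˡ e)) , new , above-⊆ S x }
    where
    sep' : ∀ y z → y ∈ₛ bit d' → z ∈ₛ (S above x) → y < z
    sep' y z e s with ∨-elim {bit d y} (trans (canon y) e)
    ... | inj₁ b = sep y z b (∧-left s)
    ... | inj₂ b rewrite ≡ᵇ-sound {y} b = above-< S x z s
    new : bit d' ⊆ₛ (bit d ∪ₛ S)
    new y e with ∨-elim {bit d y} (trans (canon y) e)
    ... | inj₁ b = ∪-introˡ {bit d} {S} b
    ... | inj₂ b = ∪-introʳ {bit d} {S} (subst (_∈ₛ S) (sym (≡ᵇ-sound {y} b)) sx)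

-- Genericity for collections given by a Σ⁰ₙ condition on the finite part
-- and a decidable condition on triples from the reservoir

Triples : (ℕ → ℕ → ℕ → ℕ → Bool) → ℕ → SetN → Set
Triples φ d S = ∀ x y w → x < y → y < w → x ∈ₛ S → y ∈ₛ S → w ∈ₛ S → φ d x y w ≡ true

TriplesR : SetN → (ℕ → ℕ → ℕ → ℕ → Bool) → Set
TriplesR X φ = RecB X (λ u → φ (π₁ u) (π₁ (π₂ u)) (π₁ (π₂ (π₂ u))) (π₂ (π₂ (π₂ u))))

module Genericity {I : Ideal} {A₀ A₁ : SetN} (exact : ExactPair I A₀ A₁) {n : ℕ} (n≥3 : 3 ≤ n)
  {G : SetN} (gen : Generic n I A₀ A₁ G) where

  open Index A₀ A₁
  open Ideals exact

  record Met (Θ : ℕ → Set) (φ : ℕ → ℕ → ℕ → ℕ → Bool) : Set where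
    constructor mkMet
    field
      d : ℕ
      S : SetN
      cond : ICond I (bit d , S)
      sat : Satisfies G (bit d , S)
      theta : Θ d
      triples : Triples φ d S

  record Avoided (Θ : ℕ → Set) (φ : ℕ → ℕ → ℕ → ℕ → Bool) : Set where
    constructor mkAvoided
    field
      d : ℕ
      S : SetN
      cond : ICond I (bit d , S)
      sat : Satisfies G (bit d , S)
      none : ∀ d' S' → (bit d' , S') ≼ (bit d , S) → ICond I (bit d' , S') → Θ d' → ¬ Triples φ d' S'

  ICond-canon : ∀ {d D S} → CanonIdx d D → ICond I (D , S) → ICond I (bit d , S)
  ICond-canon {d} canon ((fin , inf , sep) , i) =
    ((d , λ x le → ¬true⇒false λ e → <⇒≱ (bit⇒< d x e) le) , inf , λ x y e → sep x y (trans (canon x) e)) , i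

  Satisfies-canon : ∀ {d D S} → CanonIdx d D → Satisfies G (D , S) → Satisfies G (bit d , S)
  Satisfies-canon {d} {D} {S} canon (p , q) = (λ x e → p x (trans (canon x) e)) ,
    λ x e → case ∪-elim {D} {S} (q x e) of λ
      { (inj₁ b) → ∪-introˡ {bit d} {S} (trans (sym (canon x)) b) ; (inj₂ s) → ∪-introʳ {bit d} {S} s }

  module _ (Θ : ℕ → Set) (φ : ℕ → ℕ → ℕ → ℕ → Bool) where

    Coll : Collection
    Coll (D , S) = ICond I (D , S) × ∃ λ d → CanonIdx d D × Θ d × Triples φ d S

    -- Membership of `x`, `y` and `w` stands to the left of the implication, so the computations
    -- proving it, packed in `s`, are quantified universally. The condition is thus Π⁰₁ in the index
    -- and can be joined to `Valid`.
    triplesM : ℕ → ℕ → Bool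
    triplesM k a = let e = π₁ (π₂ k) ; x = π₁ a ; y = π₁ (π₂ a) ; w = π₁ (π₂ (π₂ a)) ; s = π₂ (π₂ (π₂ a)) in
      ((x <ᵇ y) ∧ ((y <ᵇ w) ∧ (T A₀ e x 1 (π₁ s) ∧ (T A₀ e y 1 (π₁ (π₂ s)) ∧ T A₀ e w 1 (π₂ (π₂ s)))))) ⇒ᵇ φ (π₁ k) x y w

    triplesM-intro : ∀ k S → Computes A₀ (decode (π₁ (π₂ k))) S → Triples φ (π₁ k) S → ∀ a → triplesM k a ≡ true
    triplesM-intro k S comp₀ tr a = ⇒ᵇ-intro λ h →
      let x = π₁ a ; y = π₁ (π₂ a) ; w = π₁ (π₂ (π₂ a)) ; s = π₂ (π₂ (π₂ a))
          h₁ = ∧-right {x <ᵇ y} h ; h₂ = ∧-right {y <ᵇ w} h₁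
          h₃ = ∧-right {T A₀ e x 1 (π₁ s)} h₂
      in tr x y w (<ᵇ-sound (∧-left h)) (<ᵇ-sound (∧-left h₁)) (in-S x (π₁ s) (∧-left h₂))
           (in-S y (π₁ (π₂ s)) (∧-left h₃)) (in-S w (π₂ (π₂ s)) (∧-right {T A₀ e y 1 (π₁ (π₂ s))} h₃))
      where
      e = π₁ (π₂ k)
      in-S : ∀ y w → T A₀ e y 1 w ≡ true → S y ≡ true
      in-S y w t with S y | Ev-det (comp₀ y) (T-sound e y 1 w t)
      ... | true | _ = refl

    triplesM-elim : ∀ k S → Computes A₀ (decode (π₁ (π₂ k))) S → (∀ a → triplesM k a ≡ true) → Triples φ (π₁ k) S
    triplesM-elim k S comp₀ h x y w x<y y<w sx sy sw = eq (out-S x sx) (out-S y sy) (out-S w sw)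
      where
      e = π₁ (π₂ k)
      out-S : ∀ y → S y ≡ true → ∃ λ w → T A₀ e y 1 w ≡ true
      out-S y sy = T-complete e (subst (Ev A₀ _ y) (cong b2n sy) (comp₀ y))
      eq : (∃ λ s → T A₀ e x 1 s ≡ true) → (∃ λ s → T A₀ e y 1 s ≡ true) → (∃ λ s → T A₀ e w 1 s ≡ true) → φ (π₁ k) x y w ≡ true
      eq (s₁ , t₁) (s₂ , t₂) (s₃ , t₃) with h ⟨ x , ⟨ y , ⟨ w , ⟨ s₁ , ⟨ s₂ , s₃ ⟩ ⟩ ⟩ ⟩ ⟩
      ... | g rewrite π₁-⟨⟩ x ⟨ y , ⟨ w , ⟨ s₁ , ⟨ s₂ , s₃ ⟩ ⟩ ⟩ ⟩ | π₂-⟨⟩ x ⟨ y , ⟨ w , ⟨ s₁ , ⟨ s₂ , s₃ ⟩ ⟩ ⟩ ⟩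
        | π₁-⟨⟩ y ⟨ w , ⟨ s₁ , ⟨ s₂ , s₃ ⟩ ⟩ ⟩ | π₂-⟨⟩ y ⟨ w , ⟨ s₁ , ⟨ s₂ , s₃ ⟩ ⟩ ⟩
        | π₁-⟨⟩ w ⟨ s₁ , ⟨ s₂ , s₃ ⟩ ⟩ | π₂-⟨⟩ w ⟨ s₁ , ⟨ s₂ , s₃ ⟩ ⟩
        | π₁-⟨⟩ s₁ ⟨ s₂ , s₃ ⟩ | π₂-⟨⟩ s₁ ⟨ s₂ , s₃ ⟩ | π₁-⟨⟩ s₂ s₃ | π₂-⟨⟩ s₂ s₃ =
        ⇒ᵇ-elim g (∧-intro (<ᵇ-complete x<y) (∧-intro (<ᵇ-complete y<w) (∧-intro t₁ (∧-intro t₂ t₃))))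

    convert : Meets G Coll ⊎ Avoids I G Coll → Met Θ φ ⊎ Avoided Θ φ
    convert (inj₁ ((D , S) , (ic , d , canon , θ , tr) , sat)) =
      inj₁ (mkMet d S (ICond-canon canon ic) (Satisfies-canon canon sat) θ tr)
    convert (inj₂ ((D , S) , ic@(((b , bounded) , _) , _) , sat , none)) with canonIdx b D bounded
    ... | d , canon = inj₂ (mkAvoided d S (ICond-canon canon ic) (Satisfies-canon canon sat)
      λ d' S' (p , q , r) ic' θ tr → none (bit d' , S')
        ( (λ x e → p x (trans (sym (canon x)) e))
        , (λ x e → case ∪-elim {bit d} {S} (q x e) of λ
            { (inj₁ b) → ∪-introˡ {D} {S} (trans (canon x) b) ; (inj₂ s) → ∪-introʳ {D} {S} s })
        , r) (ic' , d' , (λ _ → refl) , θ , tr))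

    module _ (ΘΣ : Sig n (A₀ ⊕ A₁) Θ) (φR : TriplesR (A₀ ⊕ A₁) φ) where

      triplesM-R : RecB (A₀ ⊕ A₁) (λ u → triplesM (π₁ u) (π₂ u))
      triplesM-R = ⇒R (andR (<ᵇR x y) (andR (<ᵇR y w) (andR (T₀ e x (constR 1) (π₁R s))
          (andR (T₀ e y (constR 1) (π₁R (π₂R s))) (T₀ e w (constR 1) (π₂R (π₂R s)))))))
        (RecB-ext (λ u → eq (π₁ (π₁ u)) (π₁ (π₂ u)) (π₁ (π₂ (π₂ u))) (π₁ (π₂ (π₂ (π₂ u)))))
          (φR ∘B pairR (π₁R (π₁R idR)) (pairR x (pairR y w))))
        where
        T₀ = T-relR {A₀} {A₀ ⊕ A₁} ≤T-⊕ˡ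
        e = π₁R (π₂R (π₁R idR))
        x = π₁R var
        y = π₁R (π₂R var)
        w = π₁R (π₂R (π₂R var))
        s = π₂R (π₂R (π₂R var))
        eq : ∀ d x y w → let u = ⟨ d , ⟨ x , ⟨ y , w ⟩ ⟩ ⟩ in
          φ (π₁ u) (π₁ (π₂ u)) (π₁ (π₂ (π₂ u))) (π₂ (π₂ (π₂ u))) ≡ φ d x y w
        eq d x y w rewrite π₁-⟨⟩ d ⟨ x , ⟨ y , w ⟩ ⟩ | π₂-⟨⟩ d ⟨ x , ⟨ y , w ⟩ ⟩
          | π₁-⟨⟩ x ⟨ y , w ⟩ | π₂-⟨⟩ x ⟨ y , w ⟩ | π₁-⟨⟩ y w | π₂-⟨⟩ y w = refl

      W : ℕ → Set
      W k = (Valid k × (∀ a → triplesM k a ≡ true)) × Θ (π₁ k)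

      W-Sig : Sig n (A₀ ⊕ A₁) W
      W-Sig = Sig-× (Pi2⇒Sig n≥3 (Pi2-× Valid-Pi2 (Pi1⇒Pi2 triplesM triplesM-R))) (Sig-reindex (π₁R idR) ΘΣ)

      definable : SigmaColl n I A₀ A₁ Coll
      definable = W , Sig⇒IsΣ W-Sig , λ k → out k , into k
        where
        out : ∀ k → W k → Σ Cond λ c → Coll c × IsIndex I A₀ A₁ k c
        out k ((v , t) , θ) with Valid⇒IsIndex exact k v
        ... | S , idx@(ic , d , e₀ , e₁ , k≡ , canon , comp₀ , comp₁) =
          (bit (π₁ k) , S) , (ic , π₁ k , (λ _ → refl) , θ , triplesM-elim k S comp' t) , idx
          where
          comp' : Computes A₀ (decode (π₁ (π₂ k))) S
          comp' = subst (λ e → Computes A₀ (decode e) S)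
            (sym (trans (cong (π₁ ∘ π₂) k≡) (trans (cong π₁ (π₂-⟨⟩ d ⟨ e₀ , e₁ ⟩)) (π₁-⟨⟩ e₀ e₁)))) comp₀
        into : ∀ k → (Σ Cond λ c → Coll c × IsIndex I A₀ A₁ k c) → W k
        into k ((D , S) , (_ , d' , canon' , θ , tr) , idx@(_ , d , e₀ , e₁ , k≡ , canon , comp₀ , _)) =
          (IsIndex⇒Valid exact k idx , triplesM-intro k S comp' (subst (λ v → Triples φ v S) d'≡ tr)) , subst Θ d'≡ θ
          where
          d'≡ : d' ≡ π₁ k
          d'≡ = trans (bit-injective d' d λ x → trans (sym (canon' x)) (canon x))
            (sym (trans (cong π₁ k≡) (π₁-⟨⟩ d ⟨ e₀ , e₁ ⟩)))
          comp' : Computes A₀ (decode (π₁ (π₂ k))) S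
          comp' = subst (λ e → Computes A₀ (decode e) S)
            (sym (trans (cong (π₁ ∘ π₂) k≡) (trans (cong π₁ (π₂-⟨⟩ d ⟨ e₀ , e₁ ⟩)) (π₁-⟨⟩ e₀ e₁)))) comp₀

      opaque
        met-or-avoided : Met Θ φ ⊎ Avoided Θ φ
        met-or-avoided = convert (gen Coll (λ _ → proj₁) definable)

  trivial : ℕ → ℕ → ℕ → ℕ → Bool
  trivial _ _ _ _ = true

  -- Genericity for the collection of all or no conditions, according to P.
  lem : ∀ {P : Set} → Sig n (A₀ ⊕ A₁) (λ _ → P) → P ⊎ ¬ P
  lem {P} s with met-or-avoided (λ _ → P) trivial s (constB true)
  ... | inj₁ m = inj₁ (Met.theta m)
  ... | inj₂ a = inj₂ λ p → Avoided.none a (Avoided.d a) (Avoided.S a) (≼-refl _) (Avoided.cond a) p (λ _ _ _ _ _ _ _ _ → refl)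

  lem₁ : ∀ {r : ℕ → Bool} → RecB (A₀ ⊕ A₁) r → (∃ λ b → r b ≡ true) ⊎ (∀ b → r b ≡ false)
  lem₁ {r} R with lem (Σ₂-sentence (λ a _ → r a) n≥3 (wkB R))
  ... | inj₁ (a , h) = inj₁ (a , h 0)
  ... | inj₂ ¬p = inj₂ λ b → ¬true⇒false λ e → ¬p (b , λ _ → e)

  -- A negative answer of `lem` says that no `a` fails. For each `a` the witness itself then comes
  -- from `lem₁`, whose other alternative would be such a failure.
  lem₂ : ∀ {r : ℕ → ℕ → Bool} → RecB (A₀ ⊕ A₁) (λ u → r (π₁ u) (π₂ u)) →
    (∀ a → ∃ λ b → r a b ≡ true) ⊎ (∃ λ a → ∀ b → r a b ≡ false)
  lem₂ {r} R with lem (Σ₂-sentence (λ a b → not (r a b)) n≥3 (notR R))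
  ... | inj₁ (a , h) = inj₂ (a , λ b → ¬true⇒false (not-elim (h b)))
  ... | inj₂ ¬p = inj₁ λ a → case lem₁ (R-at a) of λ
    { (inj₁ found) → found ; (inj₂ none) → ⊥-elim (¬p (a , λ b → not-intro λ e → true≢false e (none b))) }
    where
    R-at : ∀ a → RecB (A₀ ⊕ A₁) (r a)
    R-at a = RecB-ext (λ b → cong₂ r (π₁-⟨⟩ a b) (π₂-⟨⟩ a b)) (R ∘B pairR (constR a) idR)

  -- Every condition can absorb an element of its infinite reservoir at or beyond `m`, so no
  -- condition avoids those whose finite part reaches `m`.
  G-infinite : InfiniteS G
  G-infinite m with met-or-avoided (λ d → bex (λ x → bit d x ∧ not (x <ᵇ m)) d ≡ true) trivial
    (Sig-dec (bexR {p = λ d x → bit d x ∧ not (x <ᵇ m)} (andR (bitR (π₁R idR) var) (notR (<ᵇR var (constR m)))) idR)) (constB true)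
  ... | inj₁ (mkMet d S _ (D⊆G , _) θ _) with bex-sound d θ
  ... | x , _ , e = x , ≮⇒≥ (λ lt → not-elim (∧-right {bit d x} e) (<ᵇ-complete lt)) , D⊆G x (∧-left e)
  G-infinite m | inj₂ (mkAvoided d S cond@((_ , inf , _) , _) _ none) with inf m
  ... | x , m≤x , sx with extend d S x cond sx
  ... | record { d' = d' ; bits = bits ; cond = cond' ; ext = ext } =
    ⊥-elim (none d' (S above x) ext cond' (bex-complete d' x (bit⇒< d' x bx)
      (∧-intro bx (not-intro (λ e → <⇒≱ (<ᵇ-sound e) m≤x)))) (λ _ _ _ _ _ _ _ _ → refl))
    where
    bx : bit d' x ≡ true
    bx = trans (bits x) (∨-introʳ {bit d x} (≡ᵇ-refl x))

-- Computable conditions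

COMP-exact : ExactPair COMP ∅ₛ ∅ₛ
COMP-exact S = (λ c → c , c) , proj₁

open Index ∅ₛ ∅ₛ using () renaming
  (Valid to ValidC; Valid-Pi2 to ValidC-Pi2; Valid⇒IsIndex to ValidC⇒IsIndex; IsIndex⇒Valid to IsIndex⇒ValidC)
open Ideals COMP-exact using () renaming (extend to extendC)

IndexC : ℕ → Cond → Set
IndexC = IsIndex COMP ∅ₛ ∅ₛ

index-of : ∀ {D S} → ICond COMP (D , S) → ∃ λ k → IndexC k (D , S)
index-of {D} {S} ic@(((b , bounded) , _) , c , computes) with canonIdx b D bounded | decode-surjective c
... | d , canon | e , refl = ⟨ d , ⟨ e , e ⟩ ⟩ , ic , d , e , e , refl , canon , computes , computes

IndexC-parts : ∀ {k D S} → IndexC k (D , S) → CanonIdx (π₁ k) D × Computes ∅ₛ (decode (π₁ (π₂ k))) S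
IndexC-parts {S = S} (_ , d , e₀ , e₁ , refl , canon , comp₀ , _) =
  (λ x → trans (canon x) (cong (λ v → bit v x) (sym (π₁-⟨⟩ d ⟨ e₀ , e₁ ⟩)))) ,
  subst (λ e → Computes ∅ₛ (decode e) S) (sym (trans (cong π₁ (π₂-⟨⟩ d ⟨ e₀ , e₁ ⟩)) (π₁-⟨⟩ e₀ e₁))) comp₀

χ-injective : ∀ {a b} → b2n a ≡ b2n b → a ≡ b
χ-injective {true} {true} _ = refl
χ-injective {false} {false} _ = refl

Computes-unique : ∀ {X c S S'} → Computes X c S → Computes X c S' → ∀ x → S x ≡ S' x
Computes-unique h h' x = χ-injective (Ev-det (h x) (h' x))

Satisfies-≗ : ∀ {H D S D' S'} → (∀ x → D x ≡ D' x) → (∀ x → S x ≡ S' x) → Satisfies H (D , S) → Satisfies H (D' , S')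
Satisfies-≗ {H} {D} {S} {D'} {S'} dd ss (p , q) = (λ x e → p x (trans (dd x) e)) , λ x e →
  case ∪-elim {D} {S} (q x e) of λ
    { (inj₁ a) → ∪-introˡ {D'} {S'} (trans (sym (dd x)) a) ; (inj₂ a) → ∪-introʳ {D'} {S'} (trans (sym (ss x)) a) }

T⇒∈ : ∀ {X e S} → Computes X (decode e) S → ∀ x w → T X e x 1 w ≡ true → x ∈ₛ S
T⇒∈ {e = e} h x w t = χ-injective (Ev-det (h x) (T-sound e x 1 w t))

T⇒∉ : ∀ {X e S} → Computes X (decode e) S → ∀ x w → T X e x 0 w ≡ true → S x ≡ false
T⇒∉ {e = e} h x w t = χ-injective (Ev-det (h x) (T-sound e x 0 w t))

∈⇒T : ∀ {X e S} → Computes X (decode e) S → ∀ x → x ∈ₛ S → ∃ λ w → T X e x 1 w ≡ true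
∈⇒T {X} {e} h x s = T-complete e (subst (Ev X _ x) (cong b2n s) (h x))

∉⇒T : ∀ {X e S} → Computes X (decode e) S → ∀ x → S x ≡ false → ∃ λ w → T X e x 0 w ≡ true
∉⇒T {X} {e} h x s = T-complete e (subst (Ev X _ x) (cong b2n s) (h x))

-- Here `u` is `⟨ c , k ⟩`. Inclusion of the reservoirs is stated positively, as the program of `k`
-- returning 0 or the program of `c` returning 1; with both computations in `w` the relation becomes
-- Π⁰₂.
extM : ℕ → ℕ → ℕ → Bool
extM u h w = let c = π₁ u ; k = π₂ u in
  (bit (π₁ c) h ⇒ᵇ bit (π₁ k) h) ∧
  ((bit (π₁ k) h ⇒ᵇ (bit (π₁ c) h ∨ T ∅ₛ (π₁ (π₂ c)) h 1 (π₁ w))) ∧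
   (T ∅ₛ (π₁ (π₂ k)) h 0 (π₂ w) ∨ T ∅ₛ (π₁ (π₂ c)) h 1 (π₁ w)))

Ext : ℕ → Set
Ext u = ∀ h → ∃ λ w → extM u h w ≡ true

opaque
  Ext-Pi2 : Pi2 ∅ₛ Ext
  Ext-Pi2 = mkPi2 extM
    (andR (⇒R (bitR (π₁R c) h) (bitR (π₁R k) h))
      (andR (⇒R (bitR (π₁R k) h) (orR (bitR (π₁R c) h) inC))
        (orR (TR (π₁R (π₂R k)) h (constR 0) (π₂R var)) inC)))
    (λ _ → mk⇔ (λ e → e) (λ e → e))
    where
    c : Rec ∅ₛ (λ z → π₁ (π₁ (π₁ z)))
    c = π₁R (π₁R (π₁R idR))
    k : Rec ∅ₛ (λ z → π₂ (π₁ (π₁ z)))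
    k = π₂R (π₁R (π₁R idR))
    h : Rec ∅ₛ (λ z → π₂ (π₁ z))
    h = π₂R (π₁R idR)
    inC : RecB ∅ₛ (λ z → T ∅ₛ (π₁ (π₂ (π₁ (π₁ (π₁ z))))) (π₂ (π₁ z)) 1 (π₁ (π₂ z)))
    inC = TR (π₁R (π₂R c)) h (constR 1) (π₁R var)

  Ext⇔≼ : ∀ {c k D S D' S'} → IndexC c (D , S) → IndexC k (D' , S') → Ext ⟨ c , k ⟩ ⇔ ((D' , S') ≼ (D , S))
  Ext⇔≼ {c} {k} {D} {S} {D'} {S'} ic ik with IndexC-parts ic | IndexC-parts ik
  ... | canon , cmp | canon' , cmp' = mk⇔ forth back
    where
    M : ∀ h w → extM ⟨ c , k ⟩ h w ≡ true →
      (bit (π₁ c) h ≡ true → bit (π₁ k) h ≡ true) ×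
      (bit (π₁ k) h ≡ true → bit (π₁ c) h ≡ true ⊎ T ∅ₛ (π₁ (π₂ c)) h 1 (π₁ w) ≡ true) ×
      (T ∅ₛ (π₁ (π₂ k)) h 0 (π₂ w) ≡ true ⊎ T ∅ₛ (π₁ (π₂ c)) h 1 (π₁ w) ≡ true)
    M h w e rewrite π₁-⟨⟩ c k | π₂-⟨⟩ c k =
      let e' = ∧-right {bit (π₁ c) h ⇒ᵇ bit (π₁ k) h} e in
      ⇒ᵇ-elim (∧-left e) , (λ b → ∨-elim {bit (π₁ c) h} (⇒ᵇ-elim (∧-left e') b)) ,
      ∨-elim {T ∅ₛ (π₁ (π₂ k)) h 0 (π₂ w)}
        (∧-right {bit (π₁ k) h ⇒ᵇ (bit (π₁ c) h ∨ T ∅ₛ (π₁ (π₂ c)) h 1 (π₁ w))} e')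
    forth : Ext ⟨ c , k ⟩ → (D' , S') ≼ (D , S)
    forth ext =
      (λ h e → let (w , m) = ext h in
        trans (canon' h) (proj₁ (M h w m) (trans (sym (canon h)) e))) ,
      (λ h e → let (w , m) = ext h in case proj₁ (proj₂ (M h w m)) (trans (sym (canon' h)) e) of λ
        { (inj₁ b) → ∪-introˡ {D} {S} (trans (canon h) b) ; (inj₂ t) → ∪-introʳ {D} {S} (T⇒∈ cmp h (π₁ w) t) }) ,
      (λ h e → let (w , m) = ext h in case proj₂ (proj₂ (M h w m)) of λ
        { (inj₁ t) → ⊥-elim (true≢false e (T⇒∉ cmp' h (π₂ w) t)) ; (inj₂ t) → T⇒∈ cmp h (π₁ w) t })
    back : (D' , S') ≼ (D , S) → Ext ⟨ c , k ⟩
    back (p , q , r) h rewrite π₁-⟨⟩ c k | π₂-⟨⟩ c k with S h in sh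
    ... | true = let (w , t) = ∈⇒T cmp h sh in ⟨ w , 0 ⟩ , ∧-intro old
      (∧-intro (⇒ᵇ-intro λ _ → ∨-introʳ {bit (π₁ c) h} (fst-w w 0 1 t))
        (∨-introʳ {T ∅ₛ (π₁ (π₂ k)) h 0 (π₂ ⟨ w , 0 ⟩)} (fst-w w 0 1 t)))
      where
      fst-w : ∀ w v y → T ∅ₛ (π₁ (π₂ c)) h y w ≡ true → T ∅ₛ (π₁ (π₂ c)) h y (π₁ ⟨ w , v ⟩) ≡ true
      fst-w w v y t = trans (cong (T ∅ₛ (π₁ (π₂ c)) h y) (π₁-⟨⟩ w v)) t
      old : (bit (π₁ c) h ⇒ᵇ bit (π₁ k) h) ≡ true
      old = ⇒ᵇ-intro λ b → trans (sym (canon' h)) (p h (trans (canon h) b))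
    ... | false = let (w , t) = ∉⇒T cmp' h (¬true⇒false λ e → true≢false (r h e) sh) in ⟨ 0 , w ⟩ , ∧-intro old
      (∧-intro (⇒ᵇ-intro λ b → ∨-introˡ (in-D b))
        (∨-introˡ (trans (cong (T ∅ₛ (π₁ (π₂ k)) h 0) (π₂-⟨⟩ 0 w)) t)))
      where
      old : (bit (π₁ c) h ⇒ᵇ bit (π₁ k) h) ≡ true
      old = ⇒ᵇ-intro λ b → trans (sym (canon' h)) (p h (trans (canon h) b))
      in-D : bit (π₁ k) h ≡ true → bit (π₁ c) h ≡ true
      in-D b with ∪-elim {D} {S} (q h (trans (canon' h) b))
      ... | inj₁ a = trans (sym (canon h)) a
      ... | inj₂ a = ⊥-elim (true≢false a sh)

-- Jumps

Halt : SetN → ℕ → ℕ → Bool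
Halt Z u s = T Z (π₁ u) (π₂ u) (π₁ s) (π₂ s)

HaltR : ∀ {Z Y u s} → Z ≤T Y → Rec Y u → Rec Y s → RecB Y (λ z → Halt Z (u z) (s z))
HaltR le U S = T-relR le (π₁R U) (π₂R U) (π₁R S) (π₂R S)

IsJump : SetN → SetN → Set
IsJump Z Z' = ∀ u → (Z' u ≡ true) ⇔ (∃ λ s → Halt Z u s ≡ true)

Halt-iff : ∀ Z e x → (∃ λ s → Halt Z ⟨ e , x ⟩ s ≡ true) ⇔ (∃ λ y → Ev Z (decode e) x y)
Halt-iff Z e x = mk⇔
  (λ (s , h) → π₁ s , T-sound e x (π₁ s) (π₂ s)
    (trans (cong₂ (λ a b → T Z a b (π₁ s) (π₂ s)) (sym (π₁-⟨⟩ e x)) (sym (π₂-⟨⟩ e x))) h))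
  (λ (y , ev) → let (w , t) = T-complete e ev in ⟨ y , w ⟩ , trans (eq y w) t)
  where
  eq : ∀ y w → Halt Z ⟨ e , x ⟩ ⟨ y , w ⟩ ≡ T Z e x y w
  eq y w rewrite π₁-⟨⟩ e x | π₂-⟨⟩ e x | π₁-⟨⟩ y w | π₂-⟨⟩ y w = refl

record Decided (Z : SetN) (W : ℕ → Set) : Set where
  constructor mkDecided
  field
    decider : ℕ → Bool
    deciderR : RecB Z decider
    decides : ∀ x → (decider x ≡ true) ⇔ W x

open Decided

opaque
  Decided-⇔ : ∀ {Z V W} → (∀ x → V x ⇔ W x) → Decided Z V → Decided Z W
  Decided-⇔ eq (mkDecided q Q iff) = mkDecided q Q (λ x → mk⇔ (to (eq x) ∘ to (iff x)) (from (iff x) ∘ from (eq x)))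

  Decided-reindex : ∀ {Z W a} → Rec Z a → Decided Z W → Decided Z (λ x → W (a x))
  Decided-reindex {a = a} A (mkDecided q Q iff) = mkDecided (λ x → q (a x)) (Q ∘B A) (λ x → iff (a x))

  Decided-× : ∀ {Z V W} → Decided Z V → Decided Z W → Decided Z (λ x → V x × W x)
  Decided-× (mkDecided q Q iff) (mkDecided q' Q' iff') = mkDecided (λ x → q x ∧ q' x) (andR Q Q')
    (λ x → mk⇔ (λ e → to (iff x) (∧-left e) , to (iff' x) (∧-right {q x} e))
      (λ (v , w) → ∧-intro (from (iff x) v) (from (iff' x) w)))

  -- The unbounded search for `y` is a program with oracle `Z`, and the jump of `Z` tells whether it
  -- halts.
  jump-∃ : ∀ {Z Z' W} → IsJump Z Z' → Decided Z W → Decided Z' (λ x → ∃ λ y → W ⟨ x , y ⟩)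
  jump-∃ {Z} {Z'} {W} jump (mkDecided q Q iff) with decode-surjective (mu (code (b2nR (notR Q))))
  ... | e , decode-e = mkDecided (λ x → Z' ⟨ e , x ⟩) (orcR (pairR (constR e) idR))
    λ x → mk⇔ (λ z → found x (to (Halt-iff Z e x) (to (jump ⟨ e , x ⟩) z)))
      (λ (y , w) → from (jump ⟨ e , x ⟩) (from (Halt-iff Z e x) (halts x y (from (iff ⟨ x , y ⟩) w))))
    where
    N : Rec Z (λ u → b2n (not (q u)))
    N = b2nR (notR Q)
    found : ∀ x → (∃ λ y → Ev Z (decode e) x y) → ∃ λ y → W ⟨ x , y ⟩
    found x (y , ev) with subst (λ c → Ev Z c x y) decode-e ev
    ... | ev-mu h _ = y , to (iff ⟨ x , y ⟩) (is-true (Ev-det (evaluates N ⟨ x , y ⟩) h))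
      where
      is-true : b2n (not (q ⟨ x , y ⟩)) ≡ 0 → q ⟨ x , y ⟩ ≡ true
      is-true e with q ⟨ x , y ⟩
      is-true refl | true = refl
    halts : ∀ x y → q ⟨ x , y ⟩ ≡ true → ∃ λ y → Ev Z (decode e) x y
    halts x y h with least (λ y → q ⟨ x , y ⟩) y h
    ... | m , qm , below = m , subst (λ c → Ev Z c x m) (sym decode-e)
      (ev-mu {x = x} {m} (subst (Ev Z _ ⟨ x , m ⟩) (cong (b2n ∘ not) qm) (evaluates N ⟨ x , m ⟩))
        λ i lt → 0 , subst (Ev Z _ ⟨ x , i ⟩) (cong (b2n ∘ not) (below i lt)) (evaluates N ⟨ x , i ⟩))

  Decided-¬ : ∀ {Z W} → Decided Z W → Decided Z (λ x → ¬ W x)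
  Decided-¬ (mkDecided q Q iff) = mkDecided (λ x → not (q x)) (notR Q)
    (λ x → mk⇔ (λ e w → not-elim e (from (iff x) w)) (λ n → not-intro (λ e → n (to (iff x) e))))

  Decided-stable : ∀ {Z W} → Decided Z W → ∀ x → ¬ ¬ W x → W x
  Decided-stable (mkDecided q Q iff) x nn with q x in eq
  ... | true = to (iff x) eq
  ... | false = ⊥-elim (nn λ w → true≢false (from (iff x) w) eq)

  -- The quantifier is read as `¬ ∃ ¬`; the matrix is decided, hence stable under double negation.
  jump-∀ : ∀ {Z Z' W} → IsJump Z Z' → Decided Z W → Decided Z' (λ x → ∀ y → W ⟨ x , y ⟩)
  jump-∀ jump D = Decided-⇔ (λ x → mk⇔ (λ n y → Decided-stable D ⟨ x , y ⟩ (λ nw → n (y , nw))) (λ h (y , nw) → nw (h y)))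
    (Decided-¬ (jump-∃ jump (Decided-¬ D)))

  jump-lift : ∀ {Z Z' W} → IsJump Z Z' → Decided Z W → Decided Z' W
  jump-lift {W = W} jump D = Decided-⇔ (λ x → mk⇔ (λ (y , w) → subst W (π₁-⟨⟩ x y) w) (λ w → 0 , subst W (sym (π₁-⟨⟩ x 0)) w))
    (jump-∃ jump (Decided-reindex (π₁R idR) D))

-- The bottom may be any set: the matrices lifted through the tower are computable without oracle,
-- hence from whatever stands there.
Tower : ℕ → SetN → Set
Tower zero Z = ⊤
Tower (suc j) Z' = Σ SetN λ Z → Tower j Z × IsJump Z Z'

opaque
  tower-Pi2 : ∀ j {Z W} → Pi2 ∅ₛ W → Tower (suc (suc j)) Z → Decided Z W
  tower-Pi2 (suc j) P (Z₁ , t , jump) = jump-lift jump (tower-Pi2 j P t)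
  tower-Pi2 zero {Z} {W} (mkPi2 R RR iff) (Z₁ , (Z₀ , _ , jump₀) , jump₁) =
    Decided-⇔ {V = λ x → ∀ a → ∃ λ b → M ⟨ ⟨ x , a ⟩ , b ⟩ ≡ true}
      (λ x → mk⇔ (λ h → from (iff x) (λ a → let (b , e) = h a in b , trans (sym (eq x a b)) e))
        (λ w a → let (b , e) = to (iff x) w a in b , trans (eq x a b) e))
      (jump-∀ jump₁ (jump-∃ jump₀ (mkDecided M (RecB-rel ∅-≤T RR)
        (λ _ → mk⇔ (λ e → e) (λ e → e)))))
    where
    M : ℕ → Bool
    M u = R (π₁ (π₁ u)) (π₂ (π₁ u)) (π₂ u)
    eq : ∀ x a b → M ⟨ ⟨ x , a ⟩ , b ⟩ ≡ R x a b
    eq x a b rewrite π₁-⟨⟩ ⟨ x , a ⟩ b | π₂-⟨⟩ ⟨ x , a ⟩ b | π₁-⟨⟩ x a | π₂-⟨⟩ x a = refl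

  uncurry-R : ∀ {Z} → Rec Z (λ v → ⟨ π₁ (π₁ v) , ⟨ π₂ (π₁ v) , π₂ v ⟩ ⟩)
  uncurry-R = pairR (π₁R (π₁R idR)) (pairR (π₂R (π₁R idR)) var)

  uncurry-eq : ∀ (F : ℕ → ℕ → Set) u y →
    F (π₁ ⟨ π₁ (π₁ ⟨ u , y ⟩) , ⟨ π₂ (π₁ ⟨ u , y ⟩) , π₂ ⟨ u , y ⟩ ⟩ ⟩)
      (π₂ ⟨ π₁ (π₁ ⟨ u , y ⟩) , ⟨ π₂ (π₁ ⟨ u , y ⟩) , π₂ ⟨ u , y ⟩ ⟩ ⟩) ≡ F (π₁ u) ⟨ π₂ u , y ⟩
  uncurry-eq F u y rewrite π₁-⟨⟩ u y | π₂-⟨⟩ u y | π₁-⟨⟩ (π₁ u) ⟨ π₂ u , y ⟩ | π₂-⟨⟩ (π₁ u) ⟨ π₂ u , y ⟩ = refl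

  -- The programs `decode (π₁ u)` may be partial, so already the matrix is a halting question. It
  -- takes the first jump, and each quantifier takes one more.
  universal-Σ : ∀ j {Z} → Tower (suc j) Z → Decided Z (λ u → ΣQ j (λ z → Ev ∅ₛ (decode (π₁ u)) z 0) (π₂ u))
  universal-Π : ∀ j {Z} → Tower (suc j) Z → Decided Z (λ u → ΠQ j (λ z → Ev ∅ₛ (decode (π₁ u)) z 0) (π₂ u))
  universal-Σ zero (Z₀ , _ , jump) = Decided-⇔ {V = λ u → ∃ λ w → M ⟨ u , w ⟩ ≡ true}
    (λ u → mk⇔ (λ (w , t) → T-sound _ _ 0 w (trans (sym (eq u w)) t))
      (λ ev → let (w , t) = T-complete (π₁ u) ev in w , trans (eq u w) t))
    (jump-∃ jump (mkDecided M
      (T-relR ∅-≤T (π₁R (π₁R idR)) (π₂R (π₁R idR)) (constR 0) var) (λ _ → mk⇔ (λ e → e) (λ e → e))))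
    where
    M : ℕ → Bool
    M v = T ∅ₛ (π₁ (π₁ v)) (π₂ (π₁ v)) 0 (π₂ v)
    eq : ∀ u w → M ⟨ u , w ⟩ ≡ T ∅ₛ (π₁ u) (π₂ u) 0 w
    eq u w rewrite π₁-⟨⟩ u w | π₂-⟨⟩ u w = refl
  universal-Σ (suc j) (Z₁ , t , jump) = Decided-⇔
    {V = λ u → ∃ λ y → let v = ⟨ π₁ (π₁ ⟨ u , y ⟩) , ⟨ π₂ (π₁ ⟨ u , y ⟩) , π₂ ⟨ u , y ⟩ ⟩ ⟩ in F (π₁ v) (π₂ v)}
    (λ u → mk⇔ (λ (y , p) → y , subst (λ P → P) (uncurry-eq F u y) p)
      (λ (y , p) → y , subst (λ P → P) (sym (uncurry-eq F u y)) p))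
    (jump-∃ jump (Decided-reindex uncurry-R (universal-Π j t)))
    where
    F : ℕ → ℕ → Set
    F s x = ΠQ j (λ z → Ev ∅ₛ (decode s) z 0) x
  universal-Π zero t = universal-Σ zero t
  universal-Π (suc j) (Z₁ , t , jump) = Decided-⇔
    {V = λ u → ∀ y → let v = ⟨ π₁ (π₁ ⟨ u , y ⟩) , ⟨ π₂ (π₁ ⟨ u , y ⟩) , π₂ ⟨ u , y ⟩ ⟩ ⟩ in F (π₁ v) (π₂ v)}
    (λ u → mk⇔ (λ p y → subst (λ P → P) (uncurry-eq F u y) (p y)) (λ p y → subst (λ P → P) (sym (uncurry-eq F u y)) (p y)))
    (jump-∀ jump (Decided-reindex uncurry-R (universal-Σ j t)))
    where
    F : ℕ → ℕ → Set
    F s x = ΣQ j (λ z → Ev ∅ₛ (decode s) z 0) x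

  ValidC-Pi2' : Pi2 ∅ₛ ValidC
  ValidC-Pi2' = let open Pi2 ValidC-Pi2 in mkPi2 matrix (RecB-rel ∅⊕∅-≤T matrixR) defines

  Sig-index : ∀ {n W} → Sig n ∅ₛ W → ∃ λ s → ∀ x → W x ⇔ ΣQ n (λ z → Ev ∅ₛ (decode s) z 0) x
  Sig-index sig with Sig⇒IsΣ sig
  ... | c , _ , iff with decode-surjective c
  ... | s , refl = s , λ x → mk⇔ (proj₁ (iff x)) (proj₂ (iff x))

-- A set with enough jumps below it computes a generic by the usual finite-extension construction

allC : SetN
allC _ = true

record Initial : Set where
  field
    start : ℕ
    D₀ : SetN
    S₀ : SetN
    start-index : IndexC start (D₀ , S₀)

opaque
  initial : Initial
  initial = record { start = proj₁ idx ; D₀ = ∅ₛ ; S₀ = allC ; start-index = proj₂ idx }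
    where
    idx : ∃ λ k → IndexC k (∅ₛ , allC)
    idx = index-of (((0 , λ _ _ → refl) , (λ m → m , ≤-refl , refl) , λ _ _ ()) , RecB⇒≤T (constB true))

opaque
  -- Once a finite part has an element at or above `v`, membership of `v` in the limit is settled,
  -- because reservoirs lie beyond finite parts. Such stages are what the computation of a limit set
  -- searches for.
  hasAbove : ℕ → ℕ → Bool
  hasAbove v d = bex (λ h → bit d h ∧ not (h <ᵇ v)) d

  hasAbove-sound : ∀ {v d} → hasAbove v d ≡ true → ∃ λ h → v ≤ h × bit d h ≡ true
  hasAbove-sound {v} {d} e with bex-sound d e
  ... | h , _ , b = h , ≮⇒≥ (λ lt → not-elim (∧-right {bit d h} b) (<ᵇ-complete lt)) , ∧-left b

  hasAbove-complete : ∀ {v d h} → v ≤ h → bit d h ≡ true → hasAbove v d ≡ true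
  hasAbove-complete {v} {d} {h} le b = bex-complete d h (bit⇒< d h b) (∧-intro b (not-intro (λ e → <⇒≱ (<ᵇ-sound e) le)))

  hasAbove-weaken : ∀ {v v' d} → v ≤ v' → hasAbove v' d ≡ true → hasAbove v d ≡ true
  hasAbove-weaken {v} {v'} {d} le e = let (h , le' , b) = hasAbove-sound {v'} {d} e in
    hasAbove-complete {v} {d} {h} (≤-trans le le') b

  hasAboveR : ∀ {X v d} → Rec X v → Rec X d → RecB X (λ z → hasAbove (v z) (d z))
  hasAboveR {v = v} {d} V D = bexR {p = λ z h → bit (d z) h ∧ not (h <ᵇ v z)}
      (andR (bitR (wk D) var) (notR (<ᵇR var (wk V)))) D

module Construction (m : ℕ) {Z : SetN} (tower : Tower (suc (suc (suc m))) Z) where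

  private
    n : ℕ
    n = suc m

  open Initial initial

  Candidate : ℕ → ℕ → ℕ → Set
  Candidate s c k = ValidC k × (Ext ⟨ c , k ⟩ × ΣQ n (λ z → Ev ∅ₛ (decode s) z 0) k)

  candidate : ∀ {Z₁} → Tower (suc n) Z₁ → Decided Z₁ (λ v → Candidate (π₁ (π₁ v)) (π₂ (π₁ v)) (π₂ v))
  candidate t = Decided-× (Decided-reindex var (tower-Pi2 m ValidC-Pi2' t))
    (Decided-× (Decided-reindex (pairR (π₂R (π₁R idR)) var) (tower-Pi2 m Ext-Pi2 t))
      (Decided-⇔ {V = λ v → F (π₁ ⟨ π₁ (π₁ v) , π₂ v ⟩) (π₂ ⟨ π₁ (π₁ v) , π₂ v ⟩)}
        (λ v → mk⇔ (subst (λ P → P) (eq v)) (subst (λ P → P) (sym (eq v))))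
        (Decided-reindex (pairR (π₁R (π₁R idR)) var) (universal-Σ n t))))
    where
    F : ℕ → ℕ → Set
    F s = ΣQ n (λ z → Ev ∅ₛ (decode s) z 0)
    eq : ∀ v → F (π₁ ⟨ π₁ (π₁ v) , π₂ v ⟩) (π₂ ⟨ π₁ (π₁ v) , π₂ v ⟩) ≡ F (π₁ (π₁ v)) (π₂ v)
    eq v = cong₂ F (π₁-⟨⟩ (π₁ (π₁ v)) (π₂ v)) (π₂-⟨⟩ (π₁ (π₁ v)) (π₂ v))

  opaque
    good : Decided Z (λ v → Candidate (π₁ (π₁ v)) (π₂ (π₁ v)) (π₂ v))
    good = jump-lift (proj₂ (proj₂ tower)) (candidate (proj₁ (proj₂ tower)))

    -- Deciding a candidate takes `n + 1` jumps, by `universal-Σ`; the quantifier over `k` takes the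
    -- last of the `n + 2`.
    exists : Decided Z (λ p → ∃ λ k → Candidate (π₁ (π₁ ⟨ p , k ⟩)) (π₂ (π₁ ⟨ p , k ⟩)) (π₂ ⟨ p , k ⟩))
    exists = jump-∃ (proj₂ (proj₂ tower)) (candidate (proj₁ (proj₂ tower)))

  candidate-eq : ∀ s c k → let p = ⟨ s , c ⟩ in
    Candidate (π₁ (π₁ ⟨ p , k ⟩)) (π₂ (π₁ ⟨ p , k ⟩)) (π₂ ⟨ p , k ⟩) ≡ Candidate s c k
  candidate-eq s c k rewrite π₁-⟨⟩ ⟨ s , c ⟩ k | π₂-⟨⟩ ⟨ s , c ⟩ k | π₁-⟨⟩ s c | π₂-⟨⟩ s c = refl

  -- Vacuously true when there is no candidate, which makes the search in `choice` total.
  isGood : ℕ → ℕ → Bool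
  isGood p k = not (decider exists p) ∨ decider good ⟨ p , k ⟩

  opaque
    find : ∀ p → ∃ λ k → isGood p k ≡ true
    find p with decider exists p in eq
    ... | false = 0 , refl
    ... | true = let (k , c) = to (decides exists p) eq in k , from (decides good ⟨ p , k ⟩) c

    isGoodR : RecB Z (λ u → isGood (π₁ u) (π₂ u))
    isGoodR = orR (notR (deciderR exists ∘B π₁R idR)) (deciderR good ∘B pairR (π₁R idR) var)

  opaque
    choice : ℕ → ℕ
    choice p = proj₁ (least (isGood p) (proj₁ (find p)) (proj₂ (find p)))

    choice-good : ∀ p → isGood p (choice p) ≡ true
    choice-good p = proj₁ (proj₂ (least (isGood p) (proj₁ (find p)) (proj₂ (find p))))

    choiceR : Rec Z choice
    choiceR = muR {p = isGood} {n = λ p → proj₁ (find p)} isGoodR (λ p → proj₂ (find p))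

  step : ℕ → ℕ → ℕ
  step s c = if decider exists ⟨ s , c ⟩ then choice ⟨ s , c ⟩ else c

  step-true : ∀ s c → decider exists ⟨ s , c ⟩ ≡ true → step s c ≡ choice ⟨ s , c ⟩
  step-true s c ex = cong (λ b → if b then choice ⟨ s , c ⟩ else c) ex

  step-false : ∀ s c → decider exists ⟨ s , c ⟩ ≡ false → step s c ≡ c
  step-false s c ex = cong (λ b → if b then choice ⟨ s , c ⟩ else c) ex

  step-met : ∀ s c → decider exists ⟨ s , c ⟩ ≡ true → Candidate s c (step s c)
  step-met s c ex = subst (Candidate s c) (sym (step-true s c ex)) (subst (λ P → P) (candidate-eq s c k)
    (to (decides good ⟨ ⟨ s , c ⟩ , k ⟩) (case ∨-elim {not (decider exists ⟨ s , c ⟩)} (choice-good ⟨ s , c ⟩) of λ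
      { (inj₁ e) → ⊥-elim (not-elim e ex) ; (inj₂ e) → e })))
    where
    k = choice ⟨ s , c ⟩

  exists-complete : ∀ s c k → Candidate s c k → decider exists ⟨ s , c ⟩ ≡ true
  exists-complete s c k cand = from (decides exists ⟨ s , c ⟩) (k , subst (λ P → P) (sym (candidate-eq s c k)) cand)

  seq : ℕ → ℕ
  seq = natrec start step

  opaque
    seqR : ∀ {f} → Rec Z f → Rec Z (λ z → seq (f z))
    seqR F = natrecR {s = λ _ → step} (constR start)
      (ifR (deciderR exists ∘B sc) (choiceR ∘R sc) (π₂R (π₂R idR))) F
      where
      sc : Rec Z (λ u → ⟨ π₁ (π₂ u) , π₂ (π₂ u) ⟩)
      sc = pairR (π₁R (π₂R idR)) (π₂R (π₂R idR))

    seq-valid : ∀ s → ValidC (seq s)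
    seq-valid zero = IsIndex⇒ValidC COMP-exact start start-index
    seq-valid (suc s) = go (decider exists ⟨ s , seq s ⟩) refl
      where
      go : ∀ b → decider exists ⟨ s , seq s ⟩ ≡ b → ValidC (seq (suc s))
      go false eq = subst ValidC (sym (step-false s (seq s) eq)) (seq-valid s)
      go true eq = proj₁ (step-met s (seq s) eq)

  dₛ : ℕ → ℕ
  dₛ s = π₁ (seq s)

  opaque
    Sₛ : ℕ → SetN
    Sₛ s = proj₁ (ValidC⇒IsIndex COMP-exact (seq s) (seq-valid s))

    index : ∀ s → IndexC (seq s) (bit (dₛ s) , Sₛ s)
    index s = proj₂ (ValidC⇒IsIndex COMP-exact (seq s) (seq-valid s))

  cond : ∀ s → ICond COMP (bit (dₛ s) , Sₛ s)
  cond s = proj₁ (index s)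

  ≗⇒≼ : ∀ {s t} → seq t ≡ seq s → (bit (dₛ t) , Sₛ t) ≼ (bit (dₛ s) , Sₛ s)
  ≗⇒≼ {s} {t} eq = (λ x e → subst (λ k → bit (π₁ k) x ≡ true) (sym eq) e) ,
    (λ x e → ∪-introˡ {bit (dₛ s)} {Sₛ s} (subst (λ k → bit (π₁ k) x ≡ true) eq e)) ,
    (λ x e → trans (Computes-unique (proj₂ (IndexC-parts (index s)))
      (subst (λ k → Computes ∅ₛ (decode (π₁ (π₂ k))) (Sₛ t)) eq (proj₂ (IndexC-parts (index t)))) x) e)

  seq-step : ∀ s → (bit (dₛ (suc s)) , Sₛ (suc s)) ≼ (bit (dₛ s) , Sₛ s)
  seq-step s = go (decider exists ⟨ s , seq s ⟩) refl
    where
    go : ∀ b → decider exists ⟨ s , seq s ⟩ ≡ b → (bit (dₛ (suc s)) , Sₛ (suc s)) ≼ (bit (dₛ s) , Sₛ s)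
    go false eq = ≗⇒≼ {s} {suc s} (step-false s (seq s) eq)
    go true eq = to (Ext⇔≼ (index s) (index (suc s))) (proj₁ (proj₂ (step-met s (seq s) eq)))

  seq-mono : ∀ {s t} → s ≤ t → (bit (dₛ t) , Sₛ t) ≼ (bit (dₛ s) , Sₛ s)
  seq-mono {s} {t} s≤t = subst (λ t → (bit (dₛ t) , Sₛ t) ≼ (bit (dₛ s) , Sₛ s)) (m∸n+n≡m s≤t) (go (t ∸ s))
    where
    go : ∀ j → (bit (dₛ (j + s)) , Sₛ (j + s)) ≼ (bit (dₛ s) , Sₛ s)
    go zero = ≼-refl _
    go (suc j) = ≼-trans {bit (dₛ (suc j + s)) , Sₛ (suc j + s)} {bit (dₛ (j + s)) , Sₛ (j + s)} {bit (dₛ s) , Sₛ s}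
      (seq-step (j + s)) (go j)

  opaque
    -- Growth follows from genericity: the conditions with an element at or above `v` are given by a
    -- Σ⁰ₙ set of indices, which is met at the stage numbered by a program for it, because every
    -- condition extends into it.
    growth : ∀ v → ∃ λ s → hasAbove v (dₛ s) ≡ true
    growth v with Sig-index {n} (Sig-dec (hasAboveR (constR v) (π₁R idR)))
    ... | s , iff = suc s , from (iff (seq (suc s))) (proj₂ (proj₂
        (step-met s (seq s) (extendible (proj₁ (proj₂ (proj₁ (cond s))) v)))))
      where
      extendible : (∃ λ x → v ≤ x × x ∈ₛ Sₛ s) → decider exists ⟨ s , seq s ⟩ ≡ true
      extendible (x , v≤x , sx) with extendC (dₛ s) (Sₛ s) x (cond s) sx
      ... | record { d' = d' ; bits = bits ; cond = cond' ; ext = ext } with index-of cond'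
      ... | k , idx = exists-complete s (seq s) k (IsIndex⇒ValidC COMP-exact k idx , from (Ext⇔≼ (index s) idx) ext ,
        to (iff k) (hasAbove-complete v≤x (trans (sym (proj₁ (IndexC-parts idx) x))
          (trans (bits x) (∨-introʳ {bit (dₛ s) x} (≡ᵇ-refl x))))))

  H : SetN
  H v = bit (dₛ (proj₁ (growth v))) v

  H-satisfies : ∀ s → Satisfies H (bit (dₛ s) , Sₛ s)
  H-satisfies s = D⊆H , H⊆
    where
    D⊆H : bit (dₛ s) ⊆ₛ H
    D⊆H x e with growth x
    ... | t , g with ≤-total s t | hasAbove-sound g
    ... | inj₁ s≤t | _ = proj₁ (seq-mono s≤t) x e
    ... | inj₂ t≤s | h , x≤h , bh with ∪-elim {bit (dₛ t)} {Sₛ t} (proj₁ (proj₂ (seq-mono t≤s)) x e)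
    ... | inj₁ b = b
    -- Elements entering after stage `t` come from `Sₛ t`, beyond `h` and hence beyond `x`.
    ... | inj₂ a = ⊥-elim (<⇒≱ (proj₂ (proj₂ (proj₁ (cond t))) h x bh a) x≤h)
    H⊆ : H ⊆ₛ (bit (dₛ s) ∪ₛ Sₛ s)
    H⊆ x e with ≤-total s (proj₁ (growth x))
    ... | inj₁ s≤t = proj₁ (proj₂ (seq-mono s≤t)) x e
    ... | inj₂ t≤s = ∪-introˡ {bit (dₛ s)} {Sₛ s} (proj₁ (seq-mono t≤s) x e)

  H-stable : ∀ s x → hasAbove x (dₛ s) ≡ true → bit (dₛ s) x ≡ H x
  H-stable s x g = bool-ext (proj₁ (H-satisfies s) x) λ e →
    case ∪-elim {bit (dₛ s)} {Sₛ s} (proj₂ (H-satisfies s) x e) of λ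
      { (inj₁ b) → b
      ; (inj₂ a) → let (h , x≤h , bh) = hasAbove-sound g in
          ⊥-elim (<⇒≱ (proj₂ (proj₂ (proj₁ (cond s))) h x bh a) x≤h) }

  H≤T : H ≤T Z
  H≤T = RecB⇒≤T (RecB-ext (λ x → H-stable (stage x) x (stage-grown x)) (bitR (π₁R (seqR stageR)) idR))
    where
    grown : ℕ → ℕ → Bool
    grown x s = hasAbove x (dₛ s)
    stage : ℕ → ℕ
    stage x = proj₁ (least (grown x) (proj₁ (growth x)) (proj₂ (growth x)))
    stage-grown : ∀ x → grown x (stage x) ≡ true
    stage-grown x = proj₁ (proj₂ (least (grown x) (proj₁ (growth x)) (proj₂ (growth x))))
    stageR : Rec Z stage
    stageR = muR {p = grown} {n = λ x → proj₁ (growth x)} (hasAboveR (π₁R idR) (π₁R (seqR var))) (λ x → proj₂ (growth x))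

  H-generic : Generic n COMP ∅ₛ ∅ₛ H
  H-generic C sub (W , WΣ , iff) with Sig-index (Sig-rel ∅⊕∅-≤T (IsΣ⇒Sig {n} WΣ))
  ... | s , W⇔ = go (decider exists ⟨ s , seq s ⟩) refl
    where
    -- Conditions with the same index may differ as functions, but they agree pointwise.
    transfer : ∀ c → IndexC (seq (suc s)) c → Satisfies H c
    transfer (D , S) idx = Satisfies-≗ (λ x → sym (proj₁ (IndexC-parts idx) x))
      (Computes-unique (proj₂ (IndexC-parts (index (suc s)))) (proj₂ (IndexC-parts idx))) (H-satisfies (suc s))
    none : decider exists ⟨ s , seq s ⟩ ≡ false → ∀ c' → c' ≼ (bit (dₛ s) , Sₛ s) → ¬ C c'
    none eq c' ext Cc' with index-of (sub c' Cc')
    ... | k , idx = true≢false (exists-complete s (seq s) k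
      (IsIndex⇒ValidC COMP-exact k idx , from (Ext⇔≼ (index s) idx) ext , to (W⇔ k) (proj₂ (iff k) (c' , Cc' , idx)))) eq
    go : ∀ b → decider exists ⟨ s , seq s ⟩ ≡ b → Meets H C ⊎ Avoids COMP H C
    go true eq =
      let k = seq (suc s)
          (c , Cc , idx) = proj₁ (iff k) (from (W⇔ k) (proj₂ (proj₂ (step-met s (seq s) eq))))
      in inj₁ (c , Cc , transfer c idx)
    go false eq = inj₂ ((bit (dₛ s) , Sₛ s) , cond s , H-satisfies s , none eq)

-- Marked triples: some computation from Z with index below x halts, but only after stage y and before w

haltsBy : SetN → ℕ → ℕ → Bool
haltsBy Z u = bex (Halt Z u)

haltsBy-mono : ∀ {Z u y w} → y ≤ w → haltsBy Z u y ≡ true → haltsBy Z u w ≡ true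
haltsBy-mono {y = y} {w} le e with bex-sound y e
... | s , s<y , h = bex-complete w s (≤-trans s<y le) h

opaque
  haltsByR : ∀ {Z Y u y} → Z ≤T Y → Rec Y u → Rec Y y → RecB Y (λ z → haltsBy Z (u z) (y z))
  haltsByR {Z} {u = u} le U N = bexR {p = λ z → Halt Z (u z)} (HaltR le (wk U) var) N

opaque
  mark : SetN → ℕ → ℕ → ℕ → Bool
  mark Z x y w = bex (λ u → haltsBy Z u w ∧ not (haltsBy Z u y)) x

  mark-sound : ∀ {Z x y w} → mark Z x y w ≡ true → ∃ λ u → u < x × haltsBy Z u w ≡ true × haltsBy Z u y ≡ false
  mark-sound {Z} {x} {y} {w} e with bex-sound x e
  ... | u , u<x , e' = u , u<x , ∧-left e' , ¬true⇒false (not-elim (∧-right {haltsBy Z u w} e'))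

  mark-complete : ∀ {Z x y w} u → u < x → haltsBy Z u w ≡ true → haltsBy Z u y ≡ false → mark Z x y w ≡ true
  mark-complete {x = x} u u<x h n = bex-complete x u u<x (∧-intro h (not-intro λ e → true≢false e n))

  markR : ∀ {Z Y x y w} → Z ≤T Y → Rec Y x → Rec Y y → Rec Y w → RecB Y (λ z → mark Z (x z) (y z) (w z))
  markR {Z} {Y} {x} {y} {w} le N M W = bexR {p = λ z u → haltsBy Z u (w z) ∧ not (haltsBy Z u (y z))}
    (andR (haltsByR le var (wk W)) (notR (haltsByR le var (wk M)))) N

mark-mono : ∀ {Z x y w w'} → w ≤ w' → mark Z x y w ≡ true → mark Z x y w' ≡ true
mark-mono {Z} le e with mark-sound {Z} e
... | u , u<x , h , n = mark-complete u u<x (haltsBy-mono le h) n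

Unmarked : SetN → SetN → Set
Unmarked Z S = ∀ x y w → x < y → y < w → x ∈ₛ S → y ∈ₛ S → w ∈ₛ S → mark Z x y w ≡ false

module _ {Z S : SetN} (infinite : InfiniteS S) (unmarked : Unmarked Z S) where

  -- If the program had not halted by stage `y`, an element of `S` beyond its halting stage would
  -- complete a marked triple.
  halts-early : ∀ {u x y s} → u < x → x < y → x ∈ₛ S → y ∈ₛ S → Halt Z u s ≡ true → haltsBy Z u y ≡ true
  halts-early {u} {x} {y} {s} u<x x<y sx sy h with haltsBy Z u y in eq
  ... | true = refl
  ... | false with infinite (suc (s ⊔ y))
  ... | w , lt , sw = ⊥-elim (true≢false
    (mark-complete {Z} u u<x (bex-complete w s (≤-trans (s≤s (m≤m⊔n s y)) lt) h) eq)
    (unmarked x y w x<y (≤-trans (s≤s (m≤n⊔m s y)) lt) sx sy sw))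

  opaque
    window : ∀ u → ∃ λ x → ∃ λ y → u < x × x < y × x ∈ₛ S × y ∈ₛ S
    window u with infinite (suc u)
    ... | x , u<x , sx with infinite (suc x)
    ... | y , x<y , sy = x , y , u<x , x<y , sx , sy

  jumpOf : SetN
  jumpOf u = haltsBy Z u (proj₁ (proj₂ (window u)))

  jumpOf-isJump : IsJump Z jumpOf
  jumpOf-isJump u with window u
  ... | x , y , u<x , x<y , sx , sy = mk⇔ (λ e → let (s , _ , h) = bex-sound y e in s , h)
    (λ (s , h) → halts-early u<x x<y sx sy h)

  -- Two elements of `S` above `u` are searched for, and the larger one bounds the halting time. The
  -- jump `Z'` is a parameter because one and the same set has to be computed from both halves of
  -- the exact pair and from `G`.
  jump-≤T : ∀ {Z' Y} → IsJump Z Z' → Z ≤T Y → S ≤T Y → Z' ≤T Y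
  jump-≤T {Z'} {Y} jump Z≤Y S≤Y = RecB⇒≤T (RecB-ext correct (haltsByR Z≤Y idR
    (π₂R (muR {p = isWindow} {n = λ u → proj₁ (found u)} windowR (λ u → proj₂ (found u))))))
    where
    isWindow : ℕ → ℕ → Bool
    isWindow u p = ((u <ᵇ π₁ p) ∧ (π₁ p <ᵇ π₂ p)) ∧ (S (π₁ p) ∧ S (π₂ p))
    windowR : RecB Y (λ v → isWindow (π₁ v) (π₂ v))
    windowR = andR (andR (<ᵇR (π₁R idR) (π₁R var)) (<ᵇR (π₁R var) (π₂R var)))
      (andR (≤T⇒RecB S≤Y ∘B π₁R var) (≤T⇒RecB S≤Y ∘B π₂R var))
    found : ∀ u → ∃ λ p → isWindow u p ≡ true
    found u with window u
    ... | x , y , u<x , x<y , sx , sy = ⟨ x , y ⟩ , eq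
      where
      eq : isWindow u ⟨ x , y ⟩ ≡ true
      eq rewrite π₁-⟨⟩ x y | π₂-⟨⟩ x y = ∧-intro (∧-intro (<ᵇ-complete u<x) (<ᵇ-complete x<y)) (∧-intro sx sy)
    correct : ∀ u → haltsBy Z u (π₂ (proj₁ (least (isWindow u) (proj₁ (found u)) (proj₂ (found u))))) ≡ Z' u
    correct u with least (isWindow u) (proj₁ (found u)) (proj₂ (found u))
    ... | p , e , _ = bool-ext (λ b → let (s , _ , h) = bex-sound (π₂ p) b in from (jump u) (s , h))
      (λ z → let (s , h) = to (jump u) z
                 e₁ = ∧-left {(u <ᵇ π₁ p) ∧ (π₁ p <ᵇ π₂ p)} e
                 e₂ = ∧-right {(u <ᵇ π₁ p) ∧ (π₁ p <ᵇ π₂ p)} e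
             in halts-early (<ᵇ-sound (∧-left e₁)) (<ᵇ-sound (∧-right {u <ᵇ π₁ p} e₁))
                  (∧-left e₂) (∧-right {S (π₁ p)} e₂) h)

Satisfies-above : ∀ {G d S x} → Satisfies G (bit d , S) → x ∈ₛ (G above d) → x ∈ₛ S
Satisfies-above {G} {d} {S} {x} (_ , G⊆) e with ∪-elim {bit d} {S} (G⊆ x (∧-left e))
... | inj₁ b = ⊥-elim (<-asym (bit⇒< d x b) (above-< G d x e))
... | inj₂ s = s

unmarkedφ : SetN → ℕ → ℕ → ℕ → ℕ → Bool
unmarkedφ Z _ x y w = not (mark Z x y w)

module JumpStep {I : Ideal} {A₀ A₁ : SetN} (exact : ExactPair I A₀ A₁) {n : ℕ} (n≥3 : 3 ≤ n)
  {G : SetN} (gen : Generic n I A₀ A₁ G) where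

  open Ideals exact
  open Genericity exact n≥3 gen

  jump-or-avoid : ∀ Z → I Z → Z ≤T G →
    (Σ SetN λ Z' → IsJump Z Z' × I Z' × Z' ≤T G) ⊎ Avoided (λ _ → ⊤) (unmarkedφ Z)
  jump-or-avoid Z iz Z≤G with met-or-avoided (λ _ → ⊤) (unmarkedφ Z) (Sig-⇔ (λ _ → mk⇔ _ (λ _ → refl)) (Sig-dec (constB true)))
    (notR (markR (I-⊕ iz) (π₁R (π₂R idR)) (π₁R (π₂R (π₂R idR))) (π₂R (π₂R (π₂R idR)))))
  ... | inj₂ a = inj₂ a
  ... | inj₁ (mkMet d S ((_ , inf , _) , is) sat _ tr) = inj₁ (jumpOf inf unmarked , isJump ,
      I-intro (jump-≤T inf unmarked isJump (I-elim₀ iz) (I-elim₀ is)) (jump-≤T inf unmarked isJump (I-elim₁ iz) (I-elim₁ is)) ,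
      jump-≤T (above-infinite G d G-infinite) unmarkedG isJump Z≤G (above-≤T G d))
    where
    unmarked : Unmarked Z S
    unmarked x y w x<y y<w sx sy sw = ¬true⇒false (not-elim (tr x y w x<y y<w sx sy sw))
    isJump : IsJump Z (jumpOf inf unmarked)
    isJump = jumpOf-isJump inf unmarked
    unmarkedG : Unmarked Z (G above d)
    unmarkedG x y w x<y y<w gx gy gw = unmarked x y w x<y y<w
      (Satisfies-above sat gx) (Satisfies-above sat gy) (Satisfies-above sat gw)

-- Bounded evaluation of programs without oracle

prog : ℕ → ℕ
prog k = π₁ (π₂ k)

opaque
  V : ℕ → ℕ → ℕ → ℕ → Bool
  V e h b w = bex (λ u → T ∅ₛ e h b u) w

  V-sound : ∀ e h b w → V e h b w ≡ true → Ev ∅ₛ (decode e) h b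
  V-sound e h b w v with bex-sound w v
  ... | u , _ , t = T-sound e h b u t

  V-complete : ∀ e h b → Ev ∅ₛ (decode e) h b → ∃ λ w → V e h b w ≡ true
  V-complete e h b ev with T-complete e ev
  ... | u , t = suc u , bex-complete (suc u) u ≤-refl t

  V-mono : ∀ e h b {w w'} → w ≤ w' → V e h b w ≡ true → V e h b w' ≡ true
  V-mono e h b {w} {w'} le v with bex-sound w v
  ... | u , u<w , t = bex-complete w' u (≤-trans u<w le) t

  VR : ∀ {Y e h b w} → Rec Y e → Rec Y h → Rec Y b → Rec Y w → RecB Y (λ z → V (e z) (h z) (b z) (w z))
  VR {Y} {e} {h} {b} E N B W = bexR {p = λ z u → T ∅ₛ (e z) (h z) (b z) u} (T-relR ∅-≤T (wk E) (wk N) (wk B) var) W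

V-contradiction : ∀ e h w w' → V e h 0 w ≡ true → ¬ V e h 1 w' ≡ true
V-contradiction e h w w' v v' with Ev-det (V-sound e h 0 w v) (V-sound e h 1 w' v')
... | ()

-- A belief r is 0 (no restriction) or suc k (elements must lie in the set computed by prog k).

opaque
  inC : ℕ → ℕ → ℕ → Bool
  inC r h w = not (nonzero r) ∨ V (prog (pred r)) h 1 w

  inC-none : ∀ h w → inC 0 h w ≡ true
  inC-none h w = refl

  inC-some : ∀ k h w → inC (suc k) h w ≡ V (prog k) h 1 w
  inC-some k h w = refl

  inC-mono : ∀ r h {w w'} → w ≤ w' → inC r h w ≡ true → inC r h w' ≡ true
  inC-mono zero h le _ = refl
  inC-mono (suc k) h le v = V-mono (prog k) h 1 le v

  inCR : ∀ {Y r h w} → Rec Y r → Rec Y h → Rec Y w → RecB Y (λ z → inC (r z) (h z) (w z))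
  inCR R N W = orR (notR (nonzeroR R)) (VR (π₁R (π₂R (predR R))) N (constR 1) W)

Believed : ℕ → ℕ → Set
Believed r h = ∃ λ w → inC r h w ≡ true

opaque
  -- Up to y, prog k is total and below the belief r, and its set has an element in [y , w).
  test : ℕ → ℕ → ℕ → ℕ → Bool
  test k r y w = ball (λ h → V (prog k) h 0 w ∨ (V (prog k) h 1 w ∧ inC r h w)) y ∧
    bex (λ h → not (h <ᵇ y) ∧ V (prog k) h 1 w) w

  test-below : ∀ {k r y w} → test k r y w ≡ true → ∀ h → h < y →
    V (prog k) h 0 w ≡ true ⊎ (V (prog k) h 1 w ≡ true × inC r h w ≡ true)
  test-below {k} {r} {y} {w} t h h<y with ∨-elim {V (prog k) h 0 w} (ball-sound y (∧-left t) h<y)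
  ... | inj₁ v = inj₁ v
  ... | inj₂ v = inj₂ (∧-left v , ∧-right {V (prog k) h 1 w} v)

  test-above : ∀ {k r y w} → test k r y w ≡ true → ∃ λ h → y ≤ h × h < w × V (prog k) h 1 w ≡ true
  test-above {k} {r} {y} {w} t
    with bex-sound w (∧-right {ball (λ h → V (prog k) h 0 w ∨ (V (prog k) h 1 w ∧ inC r h w)) y} t)
  ... | h , h<w , e = h , ≮⇒≥ (λ lt → not-elim (∧-left e) (<ᵇ-complete lt)) , h<w , ∧-right {not (h <ᵇ y)} e

  test-intro : ∀ {k r y w} →
    (∀ h → h < y → V (prog k) h 0 w ≡ true ⊎ (V (prog k) h 1 w ≡ true × inC r h w ≡ true)) →
    (∃ λ h → y ≤ h × h < w × V (prog k) h 1 w ≡ true) → test k r y w ≡ true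
  test-intro {k} {r} {y} {w} f (h , y≤h , h<w , v) = ∧-intro
    (ball-complete y λ i lt → case f i lt of λ
      { (inj₁ e) → ∨-introˡ e ; (inj₂ (a , b)) → ∨-introʳ {V (prog k) i 0 w} (∧-intro a b) })
    (bex-complete w h h<w (∧-intro (not-intro (λ e → <⇒≱ (<ᵇ-sound e) y≤h)) v))

  testR : ∀ {Y k r y w} → Rec Y k → Rec Y r → Rec Y y → Rec Y w → RecB Y (λ z → test (k z) (r z) (y z) (w z))
  testR {Y} {k} {r} {y} {w} K R N W = andR
    (ballR {p = λ z h → V (prog (k z)) h 0 (w z) ∨ (V (prog (k z)) h 1 (w z) ∧ inC (r z) h (w z))}
      (orR (VR e var (constR 0) (wk W)) (andR (VR e var (constR 1) (wk W)) (inCR (wk R) var (wk W)))) N)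
    (bexR {p = λ z h → not (h <ᵇ y z) ∧ V (prog (k z)) h 1 (w z)}
      (andR (notR (<ᵇR var (wk N))) (VR e var (constR 1) (wk W))) W)
    where
    e : Rec Y (λ u → prog (k (π₁ u)))
    e = wk (π₁R (π₂R K))

test-mono : ∀ {k r y y' w w'} → y' ≤ y → w ≤ w' → test k r y w ≡ true → test k r y' w' ≡ true
test-mono {k} {r} y'≤y w≤w' t = test-intro
  (λ h lt → case test-below t h (≤-trans lt y'≤y) of λ
    { (inj₁ v) → inj₁ (V-mono (prog k) h 0 w≤w' v)
    ; (inj₂ (v , c)) → inj₂ (V-mono (prog k) h 1 w≤w' v , inC-mono r h w≤w' c) })
  (let (h , y≤h , h<w , v) = test-above t in h , ≤-trans y'≤y y≤h , ≤-trans h<w w≤w' , V-mono (prog k) h 1 w≤w' v)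

opaque
  -- The belief at the pair `y`, `w`. Indices are tested from the oldest to the newest, each against
  -- the belief left by its predecessors. One that fails is skipped and does not end the process, so
  -- a wrong index cannot block those pushed after it.
  cur : ℕ → ℕ → ℕ → ℕ
  cur L y w = para 0 (λ k _ r → if test k r y w then suc k else r) L

  cur-nil : ∀ y w → cur 0 y w ≡ 0
  cur-nil y w = para-nil 0 _

  cur-cons : ∀ k L y w → cur (cons k L) y w ≡ (if test k (cur L y w) y w then suc k else cur L y w)
  cur-cons k L y w = para-cons 0 (λ k _ r → if test k r y w then suc k else r) k L

  curR : ∀ {Y L y w} → Rec Y L → Rec Y y → Rec Y w → Rec Y (λ z → cur (L z) (y z) (w z))
  curR {Y} {L} {y} {w} LR N W = paraR {c = λ z k _ r → if test k r (y z) (w z) then suc k else r} (constR 0)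
    (ifR (testR (π₁R (π₂R idR)) (π₂R (π₂R (π₂R idR))) (wk N) (wk W)) (sucR (π₁R (π₂R idR))) (π₂R (π₂R (π₂R idR)))) LR

cur-pass : ∀ {k L r y w} → cur L y w ≡ r → test k r y w ≡ true → cur (cons k L) y w ≡ suc k
cur-pass {k} {L} {_} {y} {w} refl t = trans (cur-cons k L y w) (cong (λ b → if b then suc k else cur L y w) t)

cur-fail : ∀ {k L r y w} → cur L y w ≡ r → test k r y w ≡ false → cur (cons k L) y w ≡ r
cur-fail {k} {L} {_} {y} {w} refl t = trans (cur-cons k L y w) (cong (λ b → if b then suc k else cur L y w) t)

cur-tested : ∀ L k y w → cur L y w ≡ suc k → ∃ λ r → test k r y w ≡ true
cur-tested = list-ind (λ L → ∀ k y w → cur L y w ≡ suc k → ∃ λ r → test k r y w ≡ true)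
  (λ k y w e → case trans (sym (cur-nil y w)) e of λ ()) step
  where
  step : ∀ k' L → (∀ k y w → cur L y w ≡ suc k → ∃ λ r → test k r y w ≡ true) →
    ∀ k y w → cur (cons k' L) y w ≡ suc k → ∃ λ r → test k r y w ≡ true
  step k' L ih k y w e = go (test k' (cur L y w) y w) refl
    where
    go : ∀ b → test k' (cur L y w) y w ≡ b → ∃ λ r → test k r y w ≡ true
    go true t with trans (sym (cur-pass {k'} {L} refl t)) e
    ... | refl = cur L y w , t
    go false t = ih k y w (trans (sym (cur-fail {k'} {L} refl t)) e)

-- The latest index suffices, since accepted finite parts increase. On the empty list the value is
-- 0, the canonical index of the empty set.
fin : ℕ → ℕ
fin L = π₁ (hd L)

hd-cons : ∀ k L → hd (cons k L) ≡ k
hd-cons k L = π₁-⟨⟩ k L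

fin-cons : ∀ k L → fin (cons k L) ≡ π₁ k
fin-cons k L = cong π₁ (hd-cons k L)

-- `small` puts the new finite part below `y`, the range in which `test` has checked one believed
-- set against another; this is what `ExtL-belief` needs. `adds` allows only end extensions inside
-- the current belief.
record Accepts (L k y w : ℕ) : Set where
  constructor mkAccepts
  field
    small : π₁ k < y
    keeps : ∀ h → bit (fin L) h ≡ true → bit (π₁ k) h ≡ true
    adds : ∀ h → bit (π₁ k) h ≡ true → bit (fin L) h ≡ true ⊎
      (inC (cur L y w) h w ≡ true × (∀ h' → bit (fin L) h' ≡ true → h' < h))

opaque
  acc : ℕ → ℕ → ℕ → ℕ → Bool
  acc L k y w = (π₁ k <ᵇ y) ∧ (ball (λ h → bit (fin L) h ⇒ᵇ bit (π₁ k) h) (fin L) ∧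
    ball (λ h → bit (π₁ k) h ⇒ᵇ (bit (fin L) h ∨
      (inC (cur L y w) h w ∧ ball (λ h' → bit (fin L) h' ⇒ᵇ (h' <ᵇ h)) (fin L)))) (π₁ k))

  acc-sound : ∀ {L k y w} → acc L k y w ≡ true → Accepts L k y w
  acc-sound {L} {k} {y} {w} a = mkAccepts (<ᵇ-sound (∧-left a))
    (λ h b → ⇒ᵇ-elim (ball-sound (fin L) (∧-left a') (bit⇒< (fin L) h b)) b)
    (λ h b → case ∨-elim {bit (fin L) h} (⇒ᵇ-elim (ball-sound (π₁ k) a'' (bit⇒< (π₁ k) h b)) b) of λ
      { (inj₁ e) → inj₁ e
      ; (inj₂ e) → inj₂ (∧-left e , λ h' b' → <ᵇ-sound
          (⇒ᵇ-elim (ball-sound (fin L) (∧-right {inC (cur L y w) h w} e) (bit⇒< (fin L) h' b')) b')) })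
    where
    a' : ball (λ h → bit (fin L) h ⇒ᵇ bit (π₁ k) h) (fin L) ∧
      ball (λ h → bit (π₁ k) h ⇒ᵇ (bit (fin L) h ∨
        (inC (cur L y w) h w ∧ ball (λ h' → bit (fin L) h' ⇒ᵇ (h' <ᵇ h)) (fin L)))) (π₁ k) ≡ true
    a' = ∧-right {π₁ k <ᵇ y} a
    a'' : ball (λ h → bit (π₁ k) h ⇒ᵇ (bit (fin L) h ∨
        (inC (cur L y w) h w ∧ ball (λ h' → bit (fin L) h' ⇒ᵇ (h' <ᵇ h)) (fin L)))) (π₁ k) ≡ true
    a'' = ∧-right {ball (λ h → bit (fin L) h ⇒ᵇ bit (π₁ k) h) (fin L)} a'

  acc-complete : ∀ {L k y w} → Accepts L k y w → acc L k y w ≡ true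
  acc-complete {L} {k} {y} {w} (mkAccepts small keeps adds) = ∧-intro (<ᵇ-complete small) (∧-intro
    (ball-complete (fin L) λ h _ → ⇒ᵇ-intro (keeps h))
    (ball-complete (π₁ k) λ h _ → ⇒ᵇ-intro λ b → case adds h b of λ
      { (inj₁ e) → ∨-introˡ e
      ; (inj₂ (i , f)) → ∨-introʳ {bit (fin L) h} (∧-intro i
          (ball-complete (fin L) λ h' _ → ⇒ᵇ-intro λ b' → <ᵇ-complete (f h' b'))) }))

  accR : ∀ {Y L k y w} → Rec Y L → Rec Y k → Rec Y y → Rec Y w → RecB Y (λ z → acc (L z) (k z) (y z) (w z))
  accR {Y} {L} {k} {y} {w} LR K N W = andR (<ᵇR (π₁R K) N) (andR
    (ballR {p = λ z h → bit (fin (L z)) h ⇒ᵇ bit (π₁ (k z)) h} (⇒R (bitR (wk F) var) (bitR (wk (π₁R K)) var)) F)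
    (ballR {p = λ z h → bit (π₁ (k z)) h ⇒ᵇ (bit (fin (L z)) h ∨
        (inC (cur (L z) (y z) (w z)) h (w z) ∧ ball (λ h' → bit (fin (L z)) h' ⇒ᵇ (h' <ᵇ h)) (fin (L z))))}
      (⇒R (bitR (wk (π₁R K)) var) (orR (bitR (wk F) var) (andR (inCR (wk (curR LR N W)) var (wk W))
        (ballR {p = λ u h' → bit (fin (L (π₁ u))) h' ⇒ᵇ (h' <ᵇ π₂ u)}
          (⇒R (bitR (wk (wk F)) var) (<ᵇR var (wk var))) (wk F))))) (π₁R K)))
    where
    F : Rec Y (λ z → fin (L z))
    F = π₁R (π₁R (predR LR))

-- Reading a set: the state records the last two elements, their number, and the accepted indices

record State : Set where
  constructor state
  field
    older newer count accepted : ℕ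

open State

encodeSt : State → ℕ
encodeSt (state x y c L) = ⟨ ⟨ x , y ⟩ , ⟨ c , L ⟩ ⟩

decodeSt : ℕ → State
decodeSt σ = state (π₁ (π₁ σ)) (π₂ (π₁ σ)) (π₁ (π₂ σ)) (π₂ (π₂ σ))

decode-encodeSt : ∀ σ → decodeSt (encodeSt σ) ≡ σ
decode-encodeSt (state x y c L) rewrite π₁-⟨⟩ ⟨ x , y ⟩ ⟨ c , L ⟩ | π₂-⟨⟩ ⟨ x , y ⟩ ⟨ c , L ⟩
  | π₁-⟨⟩ x y | π₂-⟨⟩ x y | π₁-⟨⟩ c L | π₂-⟨⟩ c L = refl

module Reader (Z : SetN) where

  -- The triple consists of the last two elements and the incoming one. Since `π₁` takes every value
  -- infinitely often, each index remains available however many elements have been read.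
  push? : State → ℕ → Bool
  push? (state x y c L) w = mark Z x y w ∧ acc L (π₁ c) y w

  next : State → ℕ → State
  next σ w = state (newer σ) w (suc (count σ)) (if push? σ w then cons (π₁ (count σ)) (accepted σ) else accepted σ)

  run : SetN → ℕ → State
  run X zero = state 0 0 0 0
  run X (suc s) = if X s then next (run X s) s else run X s

  run-in : ∀ X {s} → X s ≡ true → run X (suc s) ≡ next (run X s) s
  run-in X {s} e = cong (λ b → if b then next (run X s) s else run X s) e

  run-out : ∀ X {s} → X s ≡ false → run X (suc s) ≡ run X s
  run-out X {s} e = cong (λ b → if b then next (run X s) s else run X s) e

  run-cong : ∀ {X Y} s → (∀ x → x < s → X x ≡ Y x) → run X s ≡ run Y s
  run-cong zero h = refl
  run-cong {X} {Y} (suc s) h = trans (cong (λ σ → if X s then next σ s else σ) (run-cong s (λ x lt → h x (m<n⇒m<1+n lt))))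
    (cong (λ b → if b then next (run Y s) s else run Y s) (h s ≤-refl))

  run-const : ∀ X {s} → (∀ x → s ≤ x → X x ≡ false) → ∀ {t} → s ≤ t → run X t ≡ run X s
  run-const X {s} h {t} s≤t = subst (λ t → run X t ≡ run X s) (m∸n+n≡m s≤t) (go (t ∸ s))
    where
    go : ∀ j → run X (j + s) ≡ run X s
    go zero = refl
    go (suc j) = trans (run-out X (h (j + s) (m≤n+m s j))) (go j)

  -- Elements of `bit d` are below `d`, so `d` steps read the whole set.
  final : ℕ → State
  final d = run (bit d) d

  run-bits : ∀ d s → (∀ x → bit d x ≡ true → x < s) → run (bit d) s ≡ final d
  run-bits d s h = trans (sym (run-const (bit d) (λ x le → ¬true⇒false λ e → <⇒≱ (h x e) le) (m≤m⊔n s d)))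
    (run-const (bit d) (λ x le → ¬true⇒false λ e → <⇒≱ (bit⇒< d x e) le) (m≤n⊔m s d))

  final-insert : ∀ d d' x → (∀ y → bit d' y ≡ insert (bit d) x y) → (∀ y → bit d y ≡ true → y < x) →
    final d' ≡ next (final d) x
  final-insert d d' x bits below = trans (sym (run-bits d' (suc x) bound)) (trans (run-in (bit d') bx)
    (cong (λ σ → next σ x) (trans (run-cong x agree) (run-bits d x below))))
    where
    bx : bit d' x ≡ true
    bx = trans (bits x) (∨-introʳ {bit d x} (≡ᵇ-refl x))
    bound : ∀ y → bit d' y ≡ true → y < suc x
    bound y e with ∨-elim {bit d y} (trans (sym (bits y)) e)
    ... | inj₁ b = m<n⇒m<1+n (below y b)
    ... | inj₂ b = s≤s (≤-reflexive (≡ᵇ-sound {y} b))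
    agree : ∀ y → y < x → bit d' y ≡ bit d y
    agree y lt = trans (bits y) (bool-ext (λ e → case ∨-elim {bit d y} e of λ
      { (inj₁ b) → b ; (inj₂ b) → ⊥-elim (<-irrefl (≡ᵇ-sound {y} b) lt) }) ∨-introˡ)

  opaque
    code-next : ℕ → ℕ → ℕ
    code-next σ w = encodeSt (next (decodeSt σ) w)

    code-run : SetN → ℕ → ℕ
    code-run X = natrec (encodeSt (state 0 0 0 0)) (λ i σ → if X i then code-next σ i else σ)

    code-run-correct : ∀ X s → code-run X s ≡ encodeSt (run X s)
    code-run-correct X zero = refl
    code-run-correct X (suc s) with X s
    ... | true = cong (λ σ → encodeSt (next σ s)) (trans (cong decodeSt (code-run-correct X s)) (decode-encodeSt (run X s)))
    ... | false = code-run-correct X s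

    code-runR : ∀ {Y} {X : ℕ → ℕ → Bool} {s} → Z ≤T Y → RecB Y (λ u → X (π₁ u) (π₂ u)) → Rec Y s →
      Rec Y (λ z → code-run (X z) (s z))
    code-runR {Y} {X} {s} le XR SR = natrecR {s = λ z i σ → if X z i then code-next σ i else σ}
      (constR (encodeSt (state 0 0 0 0)))
      (ifR (RecB-ext (λ u → cong₂ X (π₁-⟨⟩ (π₁ u) (π₁ (π₂ u))) (π₂-⟨⟩ (π₁ u) (π₁ (π₂ u)))) (XR ∘B pairR (π₁R idR) i))
        (pairR (pairR y i) (pairR (sucR c) (ifR (andR (markR le x y i) (accR L (π₁R c) y i)) (sucR (pairR (π₁R c) L)) L))) σ) SR
      where
      i : Rec Y (λ u → π₁ (π₂ u))
      i = π₁R (π₂R idR)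
      σ : Rec Y (λ u → π₂ (π₂ u))
      σ = π₂R (π₂R idR)
      x : Rec Y (λ u → π₁ (π₁ (π₂ (π₂ u))))
      x = π₁R (π₁R σ)
      y : Rec Y (λ u → π₂ (π₁ (π₂ (π₂ u))))
      y = π₂R (π₁R σ)
      c : Rec Y (λ u → π₁ (π₂ (π₂ (π₂ u))))
      c = π₁R (π₂R σ)
      L : Rec Y (λ u → π₂ (π₂ (π₂ (π₂ u))))
      L = π₂R (π₂R σ)

  decode-run : ∀ X s → decodeSt (code-run X s) ≡ run X s
  decode-run X s = trans (cong decodeSt (code-run-correct X s)) (decode-encodeSt (run X s))

  opaque
    olderR : ∀ {Y} {X : ℕ → ℕ → Bool} {s} → Z ≤T Y → RecB Y (λ u → X (π₁ u) (π₂ u)) → Rec Y s →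
      Rec Y (λ z → older (run (X z) (s z)))
    olderR {X = X} {s} le XR SR = Rec-ext (λ z → cong older (decode-run (X z) (s z))) (π₁R (π₁R (code-runR {X = X} le XR SR)))

    newerR : ∀ {Y} {X : ℕ → ℕ → Bool} {s} → Z ≤T Y → RecB Y (λ u → X (π₁ u) (π₂ u)) → Rec Y s →
      Rec Y (λ z → newer (run (X z) (s z)))
    newerR {X = X} {s} le XR SR = Rec-ext (λ z → cong newer (decode-run (X z) (s z))) (π₂R (π₁R (code-runR {X = X} le XR SR)))

    acceptedR : ∀ {Y} {X : ℕ → ℕ → Bool} {s} → Z ≤T Y → RecB Y (λ u → X (π₁ u) (π₂ u)) → Rec Y s →
      Rec Y (λ z → accepted (run (X z) (s z)))
    acceptedR {X = X} {s} le XR SR = Rec-ext (λ z → cong accepted (decode-run (X z) (s z))) (π₂R (π₂R (code-runR {X = X} le XR SR)))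

-- End extensions of canonically indexed finite sets

record EndExt (d d' : ℕ) : Set where
  constructor mkEndExt
  field
    keep : ∀ h → bit d h ≡ true → bit d' h ≡ true
    new : ∀ h → bit d' h ≡ true → bit d h ≡ true ⊎ (∀ h' → bit d h' ≡ true → h' < h)

EndExt-refl : ∀ {d} → EndExt d d
EndExt-refl = mkEndExt (λ _ e → e) (λ _ → inj₁)

EndExt-trans : ∀ {a b c} → EndExt a b → EndExt b c → EndExt a c
EndExt-trans (mkEndExt k n) (mkEndExt k' n') = mkEndExt (λ h e → k' h (k h e)) λ h e → case n' h e of λ
  { (inj₁ b) → n h b ; (inj₂ above) → inj₂ λ h' e' → above h' (k h' e') }

data ExtL (L₀ : ℕ) : ℕ → Set where
  same : ExtL L₀ L₀
  push : ∀ {L} k → ExtL L₀ L → ExtL L₀ (cons k L)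

-- Pushing can only narrow the belief below `y`: an index that passes its test is contained there in
-- the preceding belief, and one that fails leaves it unchanged.
ExtL-belief : ∀ {L₀ L k y w} → ExtL L₀ L → cur L₀ y w ≡ suc k → ∀ {h} → h < y →
  inC (cur L y w) h w ≡ true → V (prog k) h 1 w ≡ true
ExtL-belief {k = k} {y} {w} same eq {h} _ i = trans (sym (inC-some k h w)) (subst (λ r → inC r h w ≡ true) eq i)
ExtL-belief {L₀} {_} {k} {y} {w} (push {L} k' x) eq {h} h<y i = go (test k' (cur L y w) y w) refl
  where
  go : ∀ b → test k' (cur L y w) y w ≡ b → V (prog k) h 1 w ≡ true
  go false t = ExtL-belief x eq h<y (subst (λ r → inC r h w ≡ true) (cur-fail {k'} {L} refl t) i)
  go true t with test-below t h h<y
  ... | inj₁ v = ⊥-elim (V-contradiction (prog k') h w w v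
    (trans (sym (inC-some k' h w)) (subst (λ r → inC r h w ≡ true) (cur-pass {k'} {L} refl t) i)))
  ... | inj₂ (_ , i') = ExtL-belief x eq h<y i'

largest : ∀ (p : ℕ → Bool) s → (∃ λ m → p m ≡ true × m < s × (∀ y → y < s → p y ≡ true → y ≤ m)) ⊎ (∀ y → y < s → p y ≡ false)
largest p zero = inj₂ λ _ ()
largest p (suc s) with p s in eq
... | true = inj₁ (s , eq , ≤-refl , λ y lt _ → ≤-pred lt)
... | false with largest p s
... | inj₁ (m , pm , m<s , max) = inj₁ (m , pm , m<n⇒m<1+n m<s , λ y lt py → case m≤n⇒m<n∨m≡n (≤-pred lt) of λ
  { (inj₁ y<s) → max y y<s py ; (inj₂ refl) → ⊥-elim (true≢false py eq) })
... | inj₂ none = inj₂ λ y lt → case m≤n⇒m<n∨m≡n (≤-pred lt) of λ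
  { (inj₁ y<s) → none y y<s ; (inj₂ refl) → eq }

separator : ∀ d S → IsMathias (bit d , S) → ∃ λ b → (∀ x → bit d x ≡ true → x < b) × (∀ y → y ∈ₛ S → b ≤ y)
separator d S (_ , _ , sep) with largest (bit d) d
... | inj₁ (m , bm , _ , max) = suc m , (λ x e → s≤s (max x (bit⇒< d x e) e)) , λ y sy → sep m y bm sy
... | inj₂ none = 0 , (λ x e → ⊥-elim (true≢false e (none x (bit⇒< d x e)))) , λ _ _ → z≤n

-- Evolution of the state while a set satisfying a condition is read

module Dynamics (Z : SetN) where

  open Reader Z

  next-quiet : ∀ σ w → mark Z (older σ) (newer σ) w ≡ false →
    next σ w ≡ state (newer σ) w (suc (count σ)) (accepted σ)
  next-quiet σ w e rewrite e = refl

  next-push : ∀ σ w → mark Z (older σ) (newer σ) w ≡ true → Accepts (accepted σ) (π₁ (count σ)) (newer σ) w →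
    next σ w ≡ state (newer σ) w (suc (count σ)) (cons (π₁ (count σ)) (accepted σ))
  next-push σ w m a rewrite m | acc-complete a = refl

  next-cases : ∀ σ w → accepted (next σ w) ≡ accepted σ ⊎
    (mark Z (older σ) (newer σ) w ≡ true × Accepts (accepted σ) (π₁ (count σ)) (newer σ) w ×
     accepted (next σ w) ≡ cons (π₁ (count σ)) (accepted σ))
  next-cases σ w with mark Z (older σ) (newer σ) w | acc (accepted σ) (π₁ (count σ)) (newer σ) w in eq
  ... | false | _ = inj₁ refl
  ... | true | false = inj₁ refl
  ... | true | true = inj₂ (refl , acc-sound eq , refl)

  Accepts-EndExt : ∀ {L k y w} → Accepts L k y w → EndExt (fin L) (fin (cons k L))
  Accepts-EndExt {L} {k} (mkAccepts _ keeps adds) = subst (EndExt (fin L)) (sym (fin-cons k L))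
    (mkEndExt keeps λ h e → case adds h e of λ { (inj₁ b) → inj₁ b ; (inj₂ (_ , above)) → inj₂ above })

  next-EndExt : ∀ σ w → EndExt (fin (accepted σ)) (fin (accepted (next σ w)))
  next-EndExt σ w with next-cases σ w
  ... | inj₁ eq rewrite eq = EndExt-refl
  ... | inj₂ (_ , a , eq) rewrite eq = Accepts-EndExt a

  run-EndExt : ∀ X {s t} → s ≤ t → EndExt (fin (accepted (run X s))) (fin (accepted (run X t)))
  run-EndExt X {s} {t} s≤t = subst (λ t → EndExt (fin (accepted (run X s))) (fin (accepted (run X t)))) (m∸n+n≡m s≤t) (go (t ∸ s))
    where
    one : ∀ t → EndExt (fin (accepted (run X t))) (fin (accepted (run X (suc t))))
    one t with X t
    ... | true = next-EndExt (run X t) t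
    ... | false = EndExt-refl
    go : ∀ j → EndExt (fin (accepted (run X s))) (fin (accepted (run X (j + s))))
    go zero = EndExt-refl
    go (suc j) = EndExt-trans (go j) (one (j + s))

  run-satisfies : ∀ {G d S} → IsMathias (bit d , S) → Satisfies G (bit d , S) →
    ∃ λ b → run G b ≡ final d × (∀ x → b ≤ x → x ∈ₛ G → x ∈ₛ S)
  run-satisfies {G} {d} {S} math (D⊆G , G⊆) with separator d S math
  ... | b , below , above = b , trans (run-cong b agree) (run-bits d b below) , λ x b≤x gx →
    case ∪-elim {bit d} {S} (G⊆ x gx) of λ { (inj₁ e) → ⊥-elim (<⇒≱ (below x e) b≤x) ; (inj₂ s) → s }
    where
    agree : ∀ x → x < b → G x ≡ bit d x
    agree x x<b = bool-ext (λ gx → case ∪-elim {bit d} {S} (G⊆ x gx) of λ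
      { (inj₁ e) → e ; (inj₂ s) → ⊥-elim (<⇒≱ x<b (above x s)) }) (D⊆G x)

  -- `ConstCur` controls a push only when `newer` already lies in the reservoir. `Ready` excludes
  -- the remaining case, a push at the first reservoir element read.
  Ready : State → SetN → Set
  Ready σ S = ∀ x → x ∈ₛ S → mark Z (older σ) (newer σ) x ≡ false

  ConstCur : ℕ → ℕ → SetN → Set
  ConstCur L r S = ∀ x y → x < y → x ∈ₛ S → y ∈ₛ S → cur L x y ≡ r

  -- Whatever is pushed later, the set decoded from `X` cannot leave the set computed by `prog k`:
  -- every acceptance from stage `b` on happens at a pair of elements of `S`, where the belief of
  -- the initial list is `suc k` and later beliefs are narrower.
  module Preservation {X S : SetN} {b : ℕ} {σ₀ : State} {k : ℕ} (start : run X b ≡ σ₀)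
    (X⊆S : ∀ x → b ≤ x → x ∈ₛ X → x ∈ₛ S) (ready : Ready σ₀ S) (const : ConstCur (accepted σ₀) (suc k) S) where

    record Inv (s : ℕ) (σ : State) : Set where
      constructor mkInv
      field
        list : ExtL (accepted σ₀) (accepted σ)
        believed : ∀ h → bit (fin (accepted σ)) h ≡ true →
          bit (fin (accepted σ₀)) h ≡ true ⊎ Ev ∅ₛ (decode (prog k)) h 1
        last : (older σ ≡ older σ₀ × newer σ ≡ newer σ₀) ⊎ (newer σ ∈ₛ S × newer σ < s)

    inv-next : ∀ s σ → s ∈ₛ S → Inv s σ → Inv (suc s) (next σ s)
    inv-next s σ sS (mkInv list believed last) with next-cases σ s
    ... | inj₁ eq = mkInv (subst (ExtL (accepted σ₀)) (sym eq) list)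
      (λ h e → believed h (subst (λ L → bit (fin L) h ≡ true) eq e)) (inj₂ (sS , ≤-refl))
    ... | inj₂ (m , mkAccepts small keeps adds , eq) = mkInv (subst (ExtL (accepted σ₀)) (sym eq) (push (π₁ (count σ)) list))
      new (inj₂ (sS , ≤-refl))
      where
      tested : newer σ ∈ₛ S × newer σ < s
      tested = case last of λ
        { (inj₂ t) → t
        ; (inj₁ (eo , en)) → ⊥-elim (true≢false m (trans (cong₂ (λ x y → mark Z x y s) eo en) (ready s sS))) }
      new : ∀ h → bit (fin (accepted (next σ s))) h ≡ true → bit (fin (accepted σ₀)) h ≡ true ⊎ Ev ∅ₛ (decode (prog k)) h 1
      new h e with subst (λ d → bit d h ≡ true) (trans (cong fin eq) (fin-cons (π₁ (count σ)) (accepted σ))) e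
      ... | e' with adds h e'
      ... | inj₁ old = believed h old
      ... | inj₂ (i , _) = inj₂ (V-sound (prog k) h 1 s (ExtL-belief list
        (const (newer σ) s (proj₂ tested) (proj₁ tested) sS)
        (<-trans (bit⇒< (π₁ (π₁ (count σ))) h e') small) i))

    inv : ∀ {s} → b ≤ s → Inv s (run X s)
    inv {s} b≤s = subst (λ s → Inv s (run X s)) (m∸n+n≡m b≤s) (go (s ∸ b))
      where
      go : ∀ j → Inv (j + b) (run X (j + b))
      go zero = subst (Inv b) (sym start) (mkInv same (λ _ → inj₁) (inj₁ (refl , refl)))
      go (suc j) = step (X (j + b)) refl
        where
        step : ∀ v → X (j + b) ≡ v → Inv (suc (j + b)) (run X (suc (j + b)))
        step true e = subst (Inv (suc (j + b))) (sym (run-in X e))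
          (inv-next (j + b) (run X (j + b)) (X⊆S (j + b) (m≤n+m b j) e) (go j))
        step false e with go j
        ... | mkInv list believed last = subst (Inv (suc (j + b))) (sym (run-out X e)) (mkInv list believed
          (case last of λ { (inj₁ l) → inj₁ l ; (inj₂ (sn , lt)) → inj₂ (sn , m<n⇒m<1+n lt) }))

-- Sparse subsets of reservoirs

module Sparsify (S : SetN) (P : ℕ → ℕ → Bool) where

  opaque
    clash : ℕ → ℕ → Bool
    clash y = anyL (λ x → not (P x y))

    clash-sound : ∀ y L → clash y L ≡ true → ∃ λ x → mem x L ≡ true × P x y ≡ false
    clash-sound y L e with anyL-sound (λ x → not (P x y)) L e
    ... | x , m , p = x , m , ¬true⇒false (not-elim p)

    clash-complete : ∀ y L x → mem x L ≡ true → P x y ≡ false → clash y L ≡ true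
    clash-complete y L x m p = anyL-complete (λ x → not (P x y)) L x m (not-intro λ e → true≢false e p)

  accept? : ℕ → ℕ → Bool
  accept? y L = S y ∧ not (clash y L)

  history : ℕ → ℕ
  history = natrec 0 (λ y L → if accept? y L then cons y L else L)

  -- Greedily: an element of S is kept if it is P-related to all the elements kept before.
  sparse : SetN
  sparse y = accept? y (history y)

  mem-cons : ∀ x y L → mem x (cons y L) ≡ (y ≡ᵇ x) ∨ mem x L
  mem-cons x y L = anyL-cons (λ h → h ≡ᵇ x) y L

  history-complete : ∀ {x} y → x < y → x ∈ₛ sparse → mem x (history y) ≡ true
  history-complete {x} (suc y) (s≤s x≤y) e with accept? y (history y) in eq | m≤n⇒m<n∨m≡n x≤y
  ... | true | inj₁ lt = trans (mem-cons x y (history y)) (∨-introʳ {y ≡ᵇ x} (history-complete y lt e))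
  ... | true | inj₂ refl = trans (mem-cons x x (history x)) (∨-introˡ (≡ᵇ-refl x))
  ... | false | inj₁ lt = history-complete y lt e
  ... | false | inj₂ refl = ⊥-elim (true≢false e eq)

  history-sound : ∀ {x} y → mem x (history y) ≡ true → x < y × x ∈ₛ sparse
  history-sound zero e = anyL-absurd _ e
  history-sound {x} (suc y) e with accept? y (history y) in eq
  ... | false = let (lt , s) = history-sound y e in m<n⇒m<1+n lt , s
  ... | true with ∨-elim {y ≡ᵇ x} (trans (sym (mem-cons x y (history y))) e)
  ... | inj₂ e' = let (lt , s) = history-sound y e' in m<n⇒m<1+n lt , s
  ... | inj₁ e' with ≡ᵇ-sound {y} e'
  ... | refl = ≤-refl , eq

  sparse-⊆ : sparse ⊆ₛ S
  sparse-⊆ x = ∧-left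

  sparse-P : ∀ x y → x < y → x ∈ₛ sparse → y ∈ₛ sparse → P x y ≡ true
  sparse-P x y x<y sx sy with P x y in eq
  ... | true = refl
  ... | false = ⊥-elim (not-elim (∧-right {S y} sy) (clash-complete y (history y) x (history-complete y x<y sx) eq))

  -- The kept elements below `m` are compatible with everything in `S` beyond a common bound `M`. An
  -- element of `S` past `m` and `M` is therefore either kept or rejected because of a kept element
  -- that is itself at least `m`.
  sparse-infinite : InfiniteS S → (∀ x → x ∈ₛ S → ∃ λ m → ∀ y → m ≤ y → x < y → y ∈ₛ S → P x y ≡ true) → InfiniteS sparse
  sparse-infinite inf eventually m with common-bound Good mono m bounds
    where
    Good : ℕ → ℕ → Set
    Good x M = x ∈ₛ S → ∀ y → M ≤ y → x < y → y ∈ₛ S → P x y ≡ true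
    mono : ∀ x {M M'} → M ≤ M' → Good x M → Good x M'
    mono x le g sx y le' = g sx y (≤-trans le le')
    bounds : ∀ x → x < m → ∃ (Good x)
    bounds x _ with S x in eq
    ... | true = let (M , g) = eventually x eq in M , λ _ → g
    ... | false = 0 , λ ()
  ... | M , good with inf (m ⊔ M)
  ... | y , le , sy with clash y (history y) in eq
  ... | false = y , ≤-trans (m≤m⊔n m M) le , ∧-intro sy (cong not eq)
  ... | true with clash-sound y (history y) eq
  ... | x , xin , bad with history-sound y xin
  ... | x<y , sx with x <? m
  ... | no ¬lt = x , ≮⇒≥ ¬lt , sx
  ... | yes lt = ⊥-elim (true≢false (good x lt (sparse-⊆ x sx) y (≤-trans (m≤n⊔m m M) le) x<y sy) bad)

  opaque
    unfolding clash

    -- `P` is computable, so thinning uses no oracle besides `S`; applied to both halves of the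
    -- exact pair, this keeps the reservoir in the ideal.
    sparse-≤T : ∀ {Y} → S ≤T Y → RecB ∅ₛ (λ u → P (π₁ u) (π₂ u)) → sparse ≤T Y
    sparse-≤T {Y} le PR = RecB⇒≤T (acceptR idR (natrecR {s = λ _ y L → if accept? y L then cons y L else L} (constR 0)
      (ifR (acceptR (π₁R (π₂R idR)) (π₂R (π₂R idR))) (sucR (pairR (π₁R (π₂R idR)) (π₂R (π₂R idR)))) (π₂R (π₂R idR))) idR))
      where
      clashR : ∀ {y L} → Rec Y y → Rec Y L → RecB Y (λ z → clash (y z) (L z))
      clashR {y} YR LR = anyLR {p = λ z x → not (P x (y z))}
        (notR (RecB-ext (λ u → cong₂ P (π₁-⟨⟩ (π₂ u) (y (π₁ u))) (π₂-⟨⟩ (π₂ u) (y (π₁ u))))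
          (RecB-rel ∅-≤T PR ∘B pairR var (wk YR)))) LR
      acceptR : ∀ {y L} → Rec Y y → Rec Y L → RecB Y (λ z → accept? (y z) (L z))
      acceptR YR LR = andR (≤T⇒RecB le ∘B YR) (notR (clashR YR LR))

-- Steering a generic set for an ideal that does not see the jump of Z

module Steering {I : Ideal} {A₀ A₁ : SetN} (exact : ExactPair I A₀ A₁) {n : ℕ} (n≥3 : 3 ≤ n)
  {G : SetN} (gen : Generic n I A₀ A₁ G) {Z : SetN} (iz : I Z) where

  open Ideals exact
  open Genericity exact n≥3 gen
  open Reader Z
  open Dynamics Z

  opaque
    sparsify : ∀ {d S} → ICond I (bit d , S) → (P : ℕ → ℕ → Bool) → RecB ∅ₛ (λ u → P (π₁ u) (π₂ u)) →
      (∀ x → x ∈ₛ S → ∃ λ m → ∀ y → m ≤ y → x < y → y ∈ₛ S → P x y ≡ true) →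
      Σ SetN λ S' → ICond I (bit d , S') × S' ⊆ₛ S × (∀ x y → x < y → x ∈ₛ S' → y ∈ₛ S' → P x y ≡ true)
    sparsify {d} {S} ((fin , inf , sep) , i) P PR ev = sparse ,
      ((fin , sparse-infinite inf ev , λ x y e s → sep x y e (sparse-⊆ y s)) ,
        I-intro (sparse-≤T (I-elim₀ i) PR) (sparse-≤T (I-elim₁ i) PR)) , sparse-⊆ , sparse-P
      where open Sparsify S P

  opaque
    -- Each program below `x` halts by some stage or never, as `lem₁` decides. Beyond the maximum of
    -- these finitely many stages nothing new halts.
    modulus : ∀ x → ∃ λ m → ∀ y w → m ≤ y → mark Z x y w ≡ false
    modulus x with common-bound Quiet (λ u le q y w le' → q y w (≤-trans le le')) x (λ u _ → quiet u)
      where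
      Quiet : ℕ → ℕ → Set
      Quiet u m = ∀ y w → m ≤ y → haltsBy Z u w ≡ true → haltsBy Z u y ≡ true
      quiet : ∀ u → ∃ (Quiet u)
      quiet u with lem₁ (HaltR (I-⊕ iz) (constR u) idR)
      ... | inj₁ (s , h) = suc s , λ y w le _ → bex-complete y s le h
      ... | inj₂ never = 0 , λ y w _ e → let (s , _ , h) = bex-sound w e in ⊥-elim (true≢false h (never s))
    ... | m , q = m , λ y w le → ¬true⇒false λ e → let (u , u<x , h , nh) = mark-sound {Z} e in
      true≢false (q u u<x y w le h) nh

    -- Beliefs converge: whether an index survives its tests is a Π⁰₂ question, decided by genericity.
    cur-limit : ∀ L → ∃ λ r → ∃ λ x₀ → ∀ x → x₀ ≤ x → ∃ λ m → ∀ y → m ≤ y → cur L x y ≡ r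
    cur-limit = list-ind (λ L → ∃ λ r → ∃ λ x₀ → ∀ x → x₀ ≤ x → ∃ λ m → ∀ y → m ≤ y → cur L x y ≡ r)
      (0 , 0 , λ x _ → 0 , λ y _ → cur-nil x y) step
      where
      step : ∀ k L → (∃ λ r → ∃ λ x₀ → ∀ x → x₀ ≤ x → ∃ λ m → ∀ y → m ≤ y → cur L x y ≡ r) →
        ∃ λ r → ∃ λ x₀ → ∀ x → x₀ ≤ x → ∃ λ m → ∀ y → m ≤ y → cur (cons k L) x y ≡ r
      step k L (r , x₀ , lim) with lem₂ {r = λ a b → test k r a b} (testR (constR k) (constR r) (π₁R idR) var)
      ... | inj₁ survives = suc k , x₀ , λ x le → let (m , f) = lim x le ; (b , t) = survives x in
        m ⊔ b , λ y le' → cur-pass {k} {L} (f y (≤-trans (m≤m⊔n m b) le'))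
          (test-mono ≤-refl (≤-trans (m≤n⊔m m b) le') t)
      ... | inj₂ (a , fails) = r , x₀ ⊔ a , λ x le → let (m , f) = lim x (≤-trans (m≤m⊔n x₀ a) le) in
        m , λ y le' → cur-fail {k} {L} (f y le') (¬true⇒false λ t →
          true≢false (test-mono (≤-trans (m≤n⊔m x₀ a) le) ≤-refl t) (fails y))

  record Node : Set where
    constructor node
    field
      d : ℕ
      S : SetN
      cond : ICond I (bit d , S)

    σ : State
    σ = final d

    infinite : InfiniteS S
    infinite = proj₁ (proj₂ (proj₁ cond))

    asCond : Cond
    asCond = bit d , S

  open Node

  thin : (c : Node) (S' : SetN) → S' ⊆ₛ S c → InfiniteS S' → I S' → Node
  thin (node d S ((fin , _ , sep) , _)) S' sub inf i = node d S' ((fin , inf , λ x y e s → sep x y e (sub y s)) , i)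

  cut : Node → ℕ → Node
  cut c x = thin c (S c above x) (above-⊆ (S c) x) (above-infinite (S c) x (infinite c))
    (I-down (proj₂ (cond c)) (above-≤T (S c) x))

  ≼-S : ∀ {a b} → asCond a ≼ asCond b → S a ⊆ₛ S b
  ≼-S (_ , _ , s) = s

  record Appended (c : Node) (x : ℕ) : Set where
    constructor mkAppended
    field
      result : Node
      below : asCond result ≼ asCond c
      state-eq : σ result ≡ next (σ c) x
      reservoir : S result ≡ (S c above x)
      contains : bit (d result) x ≡ true

  opaque
    append : ∀ c x → x ∈ₛ S c → Appended c x
    append (node d S cond@((_ , _ , sep) , _)) x sx with extend d S x cond sx
    ... | record { d' = d' ; bits = bits ; cond = cond' ; ext = ext } =
      mkAppended (node d' (S above x) cond') ext (final-insert d d' x bits (λ y e → sep y x e sx)) refl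
        (trans (bits x) (∨-introʳ {bit d x} (≡ᵇ-refl x)))

  above-intro : ∀ {S : SetN} {x y} → y ∈ₛ S → x < y → y ∈ₛ (S above x)
  above-intro s lt = ∧-intro s (<ᵇ-complete lt)

  record Padded (c : Node) (j : ℕ) : Set where
    constructor mkPadded
    field
      result : Node
      below : asCond result ≼ asCond c
      ready : Ready (σ result) (S result)
      counted : count (σ result) ≡ j + count (σ c)
      unchanged : accepted (σ result) ≡ accepted (σ c)

  opaque
    -- An element beyond the modulus of the last one read admits no marked continuation, so the
    -- counter can be advanced by any amount without a push.
    pad : ∀ c → Ready (σ c) (S c) → ∀ j → Padded c j
    pad c ready zero = mkPadded c (≼-refl _) ready refl refl
    pad c ready (suc j) with pad c ready j
    ... | mkPadded c₁ c₁≼c ready₁ counted₁ unchanged₁ with modulus (newer (σ c₁))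
    ... | m , quiet with infinite c₁ m
    ... | z , m≤z , sz with append c₁ z sz
    ... | mkAppended c₂ c₂≼c₁ st res _ = mkPadded c₂ (≼-trans {asCond c₂} {asCond c₁} {asCond c} c₂≼c₁ c₁≼c)
      (λ x _ → trans (cong (λ σ → mark Z (older σ) (newer σ) x) st') (quiet z x m≤z))
      (trans (cong count st') (cong suc counted₁)) (trans (cong accepted st') unchanged₁)
      where
      st' : σ c₂ ≡ state (newer (σ c₁)) z (suc (count (σ c₁))) (accepted (σ c₁))
      st' = trans st (next-quiet (σ c₁) z (ready₁ z sz))

  -- The counterpart of `Accepts` and `test` without time bounds: `k` describes an extension of the
  -- computable condition formed by the finite part of `L` and the belief `r`.
  record Growable (L r k : ℕ) : Set where
    constructor mkGrowable
    field
      keeps : ∀ h → bit (fin L) h ≡ true → bit (π₁ k) h ≡ true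
      adds : ∀ h → bit (π₁ k) h ≡ true → bit (fin L) h ≡ true ⊎
        (Believed r h × (∀ h' → bit (fin L) h' ≡ true → h' < h))
      total : ∀ h → Ev ∅ₛ (decode (prog k)) h 0 ⊎ (Ev ∅ₛ (decode (prog k)) h 1 × Believed r h)
      unbounded : ∀ m → ∃ λ h → m ≤ h × Ev ∅ₛ (decode (prog k)) h 1

  opaque
    eventually-tested : ∀ {L r k} → Growable L r k → ∀ x → ∃ λ w → test k r x w ≡ true
    eventually-tested {L} {r} {k} g x with common-bound P mono x (λ h _ → decided h) | Growable.unbounded g x
      where
      P : ℕ → ℕ → Set
      P h w = V (prog k) h 0 w ≡ true ⊎ (V (prog k) h 1 w ≡ true × inC r h w ≡ true)
      mono : ∀ h {w w'} → w ≤ w' → P h w → P h w'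
      mono h le (inj₁ v) = inj₁ (V-mono (prog k) h 0 le v)
      mono h le (inj₂ (v , i)) = inj₂ (V-mono (prog k) h 1 le v , inC-mono r h le i)
      decided : ∀ h → ∃ (P h)
      decided h with Growable.total g h
      ... | inj₁ ev = let (w , v) = V-complete (prog k) h 0 ev in w , inj₁ v
      ... | inj₂ (ev , (w' , i)) = let (w , v) = V-complete (prog k) h 1 ev in
        w ⊔ w' , inj₂ (V-mono (prog k) h 1 (m≤m⊔n w w') v , inC-mono r h (m≤n⊔m w w') i)
    ... | w₁ , f | h , x≤h , ev with V-complete (prog k) h 1 ev
    ... | w₂ , v = w₁ ⊔ (w₂ ⊔ suc h) , test-intro
      (λ i lt → case f i lt of λ
        { (inj₁ a) → inj₁ (V-mono (prog k) i 0 (m≤m⊔n w₁ _) a)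
        ; (inj₂ (a , b)) → inj₂ (V-mono (prog k) i 1 (m≤m⊔n w₁ _) a , inC-mono r i (m≤m⊔n w₁ _) b) })
      (h , x≤h , ≤-trans (m≤n⊔m w₂ (suc h)) (m≤n⊔m w₁ _) , V-mono (prog k) h 1 (≤-trans (m≤m⊔n w₂ (suc h)) (m≤n⊔m w₁ _)) v)

  opaque
    believed-bound : ∀ {L r k} → Growable L r k → ∃ λ w → ∀ h → bit (π₁ k) h ≡ true → bit (fin L) h ≡ true ⊎
      (inC r h w ≡ true × (∀ h' → bit (fin L) h' ≡ true → h' < h))
    believed-bound {L} {r} {k} g with common-bound P mono (π₁ k) (λ h _ → bound h)
      where
      P : ℕ → ℕ → Set
      P h w = bit (π₁ k) h ≡ true → bit (fin L) h ≡ true ⊎ (inC r h w ≡ true × (∀ h' → bit (fin L) h' ≡ true → h' < h))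
      mono : ∀ h {w w'} → w ≤ w' → P h w → P h w'
      mono h le p b = case p b of λ { (inj₁ e) → inj₁ e ; (inj₂ (i , a)) → inj₂ (inC-mono r h le i , a) }
      bound : ∀ h → ∃ (P h)
      bound h with bit (π₁ k) h in eq
      ... | false = 0 , λ ()
      ... | true with Growable.adds g h eq
      ... | inj₁ e = 0 , λ _ → inj₁ e
      ... | inj₂ ((w , i) , a) = w , λ _ → inj₂ (i , a)
    ... | w , f = w , λ h b → f h (bit⇒< (π₁ k) h b) b

  -- Transmission of a prescribed index

  module Coding (avoided : Avoided (λ _ → ⊤) (unmarkedφ Z)) where

    base : Node
    base = node (Avoided.d avoided) (Avoided.S avoided) (Avoided.cond avoided)

    isTriple : SetN → ℕ → Bool
    isTriple S p = ((π₁ p <ᵇ π₁ (π₂ p)) ∧ (π₁ (π₂ p) <ᵇ π₂ (π₂ p))) ∧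
      ((S (π₁ p) ∧ (S (π₁ (π₂ p)) ∧ S (π₂ (π₂ p)))) ∧ mark Z (π₁ p) (π₁ (π₂ p)) (π₂ (π₂ p)))

    isTriple-intro : ∀ S x y w → x < y → y < w → x ∈ₛ S → y ∈ₛ S → w ∈ₛ S → mark Z x y w ≡ true →
      isTriple S ⟨ x , ⟨ y , w ⟩ ⟩ ≡ true
    isTriple-intro S x y w x<y y<w sx sy sw mk
      rewrite π₁-⟨⟩ x ⟨ y , w ⟩ | π₂-⟨⟩ x ⟨ y , w ⟩ | π₁-⟨⟩ y w | π₂-⟨⟩ y w =
      ∧-intro (∧-intro (<ᵇ-complete x<y) (<ᵇ-complete y<w)) (∧-intro (∧-intro sx (∧-intro sy sw)) mk)

    isTriple-elim : ∀ S p → isTriple S p ≡ true → ∃ λ x → ∃ λ y → ∃ λ w →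
      x < y × y < w × x ∈ₛ S × y ∈ₛ S × w ∈ₛ S × mark Z x y w ≡ true
    isTriple-elim S p e =
      let x = π₁ p ; y = π₁ (π₂ p) ; w = π₂ (π₂ p)
          e₁ = ∧-left {(x <ᵇ y) ∧ (y <ᵇ w)} e
          e₂ = ∧-right {(x <ᵇ y) ∧ (y <ᵇ w)} e
          e₃ = ∧-left {S x ∧ (S y ∧ S w)} e₂
          e₄ = ∧-right {S x} e₃
      in x , y , w , <ᵇ-sound (∧-left e₁) , <ᵇ-sound (∧-right {x <ᵇ y} e₁) ,
         ∧-left e₃ , ∧-left e₄ , ∧-right {S y} e₄ , ∧-right {S x ∧ (S y ∧ S w)} e₂

    opaque
      isTripleR : ∀ {S} → S ≤T (A₀ ⊕ A₁) → RecB (A₀ ⊕ A₁) (isTriple S)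
      isTripleR {S} le = andR (andR (<ᵇR (π₁R idR) (π₁R (π₂R idR))) (<ᵇR (π₁R (π₂R idR)) (π₂R (π₂R idR))))
        (andR (andR (SR ∘B π₁R idR) (andR (SR ∘B π₁R (π₂R idR)) (SR ∘B π₂R (π₂R idR))))
          (markR (I-⊕ iz) (π₁R idR) (π₁R (π₂R idR)) (π₂R (π₂R idR))))
        where
        SR : RecB (A₀ ⊕ A₁) S
        SR = ≤T⇒RecB le

    opaque
      -- Without such a triple, cutting the reservoir at `b` would give an unmarked extension of
      -- `base`, which avoidance forbids. `lem₁` turns this refutation into an actual triple.
      marked-triple : ∀ c → asCond c ≼ asCond base → ∀ b → ∃ λ x → ∃ λ y → ∃ λ w →
        b < x × x < y × y < w × x ∈ₛ S c × y ∈ₛ S c × w ∈ₛ S c × mark Z x y w ≡ true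
      marked-triple c c≼ b with lem₁ {r = isTriple (S c above b)} (isTripleR (≤T-trans (above-≤T (S c) b) (I-⊕ (proj₂ (cond c)))))
      ... | inj₁ (p , e) with isTriple-elim (S c above b) p e
      ... | x , y , w , x<y , y<w , sx , sy , sw , mk = x , y , w , above-< (S c) b x sx , x<y , y<w ,
        above-⊆ (S c) b x sx , above-⊆ (S c) b y sy , above-⊆ (S c) b w sw , mk
      marked-triple c c≼ b | inj₂ never = ⊥-elim (Avoided.none avoided (d c') (S c')
          (≼-trans {asCond c'} {asCond c} {asCond base}
            ((λ _ e → e) , (λ _ → ∪-introˡ {bit (d c)} {S c}) , above-⊆ (S c) b) c≼) (cond c') tt unmarked)
        where
        c' : Node
        c' = cut c b
        unmarked : Triples (unmarkedφ Z) (d c') (S c')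
        unmarked x y w x<y y<w sx sy sw = not-intro λ mk →
          true≢false (isTriple-intro (S c above b) x y w x<y y<w sx sy sw mk) (never ⟨ x , ⟨ y , w ⟩ ⟩)

    record Pushed (c : Node) (L k : ℕ) : Set where
      constructor mkPushed
      field
        result : Node
        below : asCond result ≼ asCond c
        ready : Ready (σ result) (S result)
        pushed : accepted (σ result) ≡ cons k L
        const : ConstCur (cons k L) (suc k) (S result)

    -- The index k is transmitted as π₁ of the number of elements read when the marked triple appears.
    opaque
      push-index : ∀ c → asCond c ≼ asCond base → Ready (σ c) (S c) → ∀ {r} → ConstCur (accepted (σ c)) r (S c) →
        ∀ k → Growable (accepted (σ c)) r k → Pushed c (accepted (σ c)) k
      -- The elements `x` and `y` are read after the padding, so the target is reduced by 2. Its
      -- second component `2 + count` makes it large enough for the truncated subtraction to be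
      -- exact.
      push-index c c≼ ready {r} const k g with pad c ready (⟨ k , 2 + count (σ c) ⟩ ∸ (2 + count (σ c)))
      -- With `x` beyond `m₁`, reading `y` pushes nothing; with `x` beyond `π₁ k`, the element `y`
      -- satisfies `Accepts.small`.
      ... | mkPadded c₁ c₁≼ ready₁ counted₁ unchanged₁ with modulus (newer (σ c₁))
      ... | m₁ , quiet₁ with marked-triple c₁ (≼-trans {asCond c₁} {asCond c} {asCond base} c₁≼ c≼) (m₁ ⊔ π₁ k)
      ... | x , y , w , b<x , x<y , y<w , sx , sy , sw , mk with append c₁ x sx
      ... | mkAppended c₂ c₂≼ st₂ refl _ with append c₂ y (above-intro {S c₁} sy x<y)
      ... | mkAppended c₃ c₃≼ st₃ refl _ with modulus y | believed-bound g
      -- Marks persist when the third element grows, so `w` may be replaced by a later `w'`. Past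
      -- `m₃` it leaves a ready state, and past `wb` the believed memberships have been computed.
      ... | m₃ , quiet₃ | wb , believed with infinite c₃ (w ⊔ (m₃ ⊔ wb))
      ... | w' , le , sw' with append c₃ w' sw'
      -- Thinning to pairs at which `k` passes its test makes the belief in `k` permanent; each `x`
      -- passes with all sufficiently large `y`.
      ... | mkAppended c₄ c₄≼ st₄ refl _ with sparsify (cond c₄) (λ x y → cur (cons k (accepted (σ c))) x y ≡ᵇ suc k)
          (≡ᵇR (curR (constR (cons k (accepted (σ c)))) (π₁R idR) var) (constR (suc k))) eventually
        where
        c₄≼c : asCond c₄ ≼ asCond c
        c₄≼c = ≼-trans {asCond c₄} {asCond c₃} {asCond c} c₄≼ (≼-trans {asCond c₃} {asCond c₂} {asCond c} c₃≼
          (≼-trans {asCond c₂} {asCond c₁} {asCond c} c₂≼ c₁≼))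
        eventually : ∀ x → x ∈ₛ S c₄ → ∃ λ m → ∀ y → m ≤ y → x < y → y ∈ₛ S c₄ →
          (cur (cons k (accepted (σ c))) x y ≡ᵇ suc k) ≡ true
        eventually x sx = let (m , t) = eventually-tested g x in m , λ y m≤y x<y sy → ≡ᵇ-complete
          (cur-pass {k} {accepted (σ c)} (const x y x<y (≼-S {c₄} {c} c₄≼c x sx) (≼-S {c₄} {c} c₄≼c y sy)) (test-mono ≤-refl m≤y t))
      ... | S₅ , cond₅ , S₅⊆ , tested = mkPushed (node (d c₄) S₅ cond₅)
        (≼-trans {bit (d c₄) , S₅} {asCond c₄} {asCond c} ((λ _ e → e) , (λ _ → ∪-introˡ {bit (d c₄)} {S c₄}) , S₅⊆) c₄≼c)
        (λ z _ → trans (cong (λ σ → mark Z (older σ) (newer σ) z) st)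
          (quiet₃ w' z (≤-trans (m≤m⊔n m₃ wb) (≤-trans (m≤n⊔m w _) le))))
        (cong accepted st)
        (λ x y x<y sx sy → ≡ᵇ-sound (tested x y x<y sx sy))
        where
        L p : ℕ
        L = accepted (σ c)
        p = ⟨ k , 2 + count (σ c) ⟩
        c₄≼c : asCond c₄ ≼ asCond c
        c₄≼c = ≼-trans {asCond c₄} {asCond c₃} {asCond c} c₄≼ (≼-trans {asCond c₃} {asCond c₂} {asCond c} c₃≼
          (≼-trans {asCond c₂} {asCond c₁} {asCond c} c₂≼ c₁≼))
        st₂' : σ c₂ ≡ state (newer (σ c₁)) x (suc (count (σ c₁))) L
        st₂' = trans st₂ (trans (next-quiet (σ c₁) x (ready₁ x sx)) (cong (state _ _ _) unchanged₁))
        reads-p : suc (suc (count (σ c₁))) ≡ p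
        reads-p = trans (cong (2 +_) counted₁) (trans (sym (trans (+-suc _ _) (cong suc (+-suc _ _))))
          (m∸n+n≡m (n≤⟨m,n⟩ k (2 + count (σ c)))))
        st₃' : σ c₃ ≡ state x y p L
        st₃' = trans st₃ (trans (cong (λ σ → next σ y) st₂') (trans (next-quiet _ y
          (quiet₁ x y (≤-trans (m≤m⊔n m₁ (π₁ k)) (<⇒≤ b<x)))) (cong (λ q → state x y q L) reads-p)))
        accepts : Accepts L (π₁ p) y w'
        accepts = subst (λ k → Accepts L k y w') (sym (π₁-⟨⟩ k (2 + count (σ c)))) (mkAccepts
          (≤-trans (s≤s (m≤n⊔m m₁ (π₁ k))) (≤-trans b<x (<⇒≤ x<y))) (Growable.keeps g)
          (λ h b → case believed h b of λ
            { (inj₁ e) → inj₁ e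
            ; (inj₂ (i , a)) → inj₂ (subst (λ r → inC r h w' ≡ true)
                (sym (const y w' (above-< (S c₁ above x) y w' sw') (≼-S {c₁} {c} c₁≼ y sy)
                  (≼-S {c₁} {c} c₁≼ w' (∧-left (∧-left sw')))))
                (inC-mono r h (≤-trans (m≤n⊔m m₃ wb) (≤-trans (m≤n⊔m w _) le)) i) , a) }))
        st : σ c₄ ≡ state y w' (suc p) (cons k L)
        st = trans st₄ (trans (cong (λ σ → next σ w') st₃') (trans (next-push (state x y p L) w'
          (mark-mono {Z} (≤-trans (m≤m⊔n w _) le) mk) accepts)
          (cong (λ k → state y w' (suc p) (cons k L)) (π₁-⟨⟩ k (2 + count (σ c))))))

-- Decoding a computable generic from G when some jump is missing from the ideal

module Decoding {I : Ideal} {A₀ A₁ : SetN} (exact : ExactPair I A₀ A₁) {n : ℕ} (n≥3 : 3 ≤ n)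
  {G : SetN} (gen : Generic n I A₀ A₁ G) {Z : SetN} (iz : I Z) (Z≤G : Z ≤T G) where

  open Ideals exact
  open Genericity exact n≥3 gen
  open Reader Z
  open Dynamics Z
  open Steering exact n≥3 gen iz
  open Node

  -- Combines `Ready` with permanent belief in the latest index as a decidable condition on triples,
  -- so that genericity applies to good conditions. The finite part enters through the state
  -- `final d`.
  goodφ : ℕ → ℕ → ℕ → ℕ → Bool
  goodφ d x y _ = not (mark Z (older (final d)) (newer (final d)) x) ∧
    (cur (accepted (final d)) x y ≡ᵇ suc (hd (accepted (final d))))

  bigΘ : ℕ → ℕ → Bool
  bigΘ m d = hasAbove m d ∧ hasAbove m (fin (accepted (final d)))

  opaque
    finalR : Rec (A₀ ⊕ A₁) (λ d → accepted (final d))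
    finalR = acceptedR {X = bit} (I-⊕ iz) (bitR (π₁R idR) var) idR

    goodφR : TriplesR (A₀ ⊕ A₁) goodφ
    goodφR = andR (notR (markR (I-⊕ iz) (olderR {X = bit} (I-⊕ iz) (bitR (π₁R idR) var) idR ∘R π₁R idR)
        (newerR {X = bit} (I-⊕ iz) (bitR (π₁R idR) var) idR ∘R π₁R idR) (π₁R (π₂R idR))))
      (≡ᵇR (curR L (π₁R (π₂R idR)) (π₁R (π₂R (π₂R idR)))) (sucR (π₁R (predR L))))
      where
      L : Rec (A₀ ⊕ A₁) (λ u → accepted (final (π₁ u)))
      L = finalR ∘R π₁R idR

    bigΘ-Sig : ∀ m → Sig n (A₀ ⊕ A₁) (λ d → bigΘ m d ≡ true)
    bigΘ-Sig m = Sig-dec (andR (hasAboveR (constR m) idR) (hasAboveR (constR m) (π₁R (π₁R (predR finalR)))))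

  headOf : Node → ℕ
  headOf c = hd (accepted (σ c))

  GoodNode : Node → Set
  GoodNode c = Ready (σ c) (S c) × ConstCur (accepted (σ c)) (suc (headOf c)) (S c)

  triples⇒good : ∀ c → Triples goodφ (d c) (S c) → GoodNode c
  triples⇒good c tr =
    (λ x sx → let (y , x<y , sy) = infinite c (suc x) ; (w , y<w , sw) = infinite c (suc y) in
      ¬true⇒false (not-elim (∧-left (tr x y w x<y y<w sx sy sw)))) ,
    (λ x y x<y sx sy → let (w , y<w , sw) = infinite c (suc y) in
      ≡ᵇ-sound (∧-right {not (mark Z (older (σ c)) (newer (σ c)) x)} (tr x y w x<y y<w sx sy sw)))

  good⇒triples : ∀ c → GoodNode c → Triples goodφ (d c) (S c)
  good⇒triples c (ready , const) x y w x<y y<w sx sy sw =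
    ∧-intro (not-intro λ e → true≢false e (ready x sx)) (≡ᵇ-complete (const x y x<y sx sy))

  -- A belief held at all pairs of an infinite reservoir has passed its test with arbitrarily large
  -- bounds.
  const-total : ∀ c {L k} → ConstCur L (suc k) (S c) → ∀ h → Ev ∅ₛ (decode (prog k)) h 0 ⊎ Ev ∅ₛ (decode (prog k)) h 1
  const-total c {L} {k} const h with infinite c (suc h)
  ... | x , h<x , sx with infinite c (suc x)
  ... | y , x<y , sy with cur-tested L k x y (const x y x<y sx sy)
  ... | r , t with test-below t h h<x
  ... | inj₁ v = inj₁ (V-sound (prog k) h 0 y v)
  ... | inj₂ (v , _) = inj₂ (V-sound (prog k) h 1 y v)

  const-infinite : ∀ c {L k} → ConstCur L (suc k) (S c) → ∀ m → ∃ λ h → m ≤ h × Ev ∅ₛ (decode (prog k)) h 1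
  const-infinite c {L} {k} const m with infinite c m
  ... | x , m≤x , sx with infinite c (suc x)
  ... | y , x<y , sy with cur-tested L k x y (const x y x<y sx sy)
  ... | r , t with test-above t
  ... | h , x≤h , _ , v = h , ≤-trans m≤x x≤h , V-sound (prog k) h 1 y v

  Ev⇒Believed : ∀ k h → Ev ∅ₛ (decode (prog k)) h 1 → Believed (suc k) h
  Ev⇒Believed k h ev = let (w , v) = V-complete (prog k) h 1 ev in w , trans (inC-some k h w) v

  record Reservoir (r : ℕ) : Set where
    constructor mkReservoir
    field
      program : ℕ
      total : ∀ h → Ev ∅ₛ (decode program) h 0 ⊎ (Ev ∅ₛ (decode program) h 1 × Believed r h)
      unbounded : ∀ m → ∃ λ h → m ≤ h × Ev ∅ₛ (decode program) h 1

  opaque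
    -- The belief `0` imposes no restriction and is realised by the set of all numbers. A belief
    -- `suc k` that is held permanently is realised by `prog k` itself.
    reservoir : ∀ c {L} r → ConstCur L r (S c) → Reservoir r
    reservoir c zero const with decode-surjective (code (constR {∅ₛ} 1))
    ... | e , eq = mkReservoir e (λ h → inj₂ (one h , 0 , inC-none h 0)) (λ m → m , ≤-refl , one m)
      where
      one : ∀ h → Ev ∅ₛ (decode e) h 1
      one h = subst (λ c → Ev ∅ₛ c h 1) (sym eq) (evaluates (constR 1) h)
    reservoir c (suc k) const = mkReservoir (prog k)
      (λ h → case const-total c const h of λ { (inj₁ ev) → inj₁ ev ; (inj₂ ev) → inj₂ (ev , Ev⇒Believed k h ev) })
      (const-infinite c const)

  opaque
    grow-index : ∀ {L r} m → Reservoir r → ∃ λ k → Growable L r k × hasAbove m (π₁ k) ≡ true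
    grow-index {L} {r} m (mkReservoir e total unbounded) with unbounded (m ⊔ fin L)
    ... | h , le , ev with canonIdx (suc h) (insert (bit (fin L)) h) bounded
      where
      bounded : ∀ y → suc h ≤ y → insert (bit (fin L)) h y ≡ false
      bounded y lt = ¬true⇒false λ b → case ∨-elim {bit (fin L) y} b of λ
        { (inj₁ b') → <⇒≱ (bit⇒< (fin L) y b') (≤-trans (m≤n⊔m m (fin L)) (≤-trans le (<⇒≤ lt)))
        ; (inj₂ b') → <-irrefl (sym (≡ᵇ-sound {y} b')) lt }
    ... | d , canon = k , mkGrowable
        (λ i b → trans (bit-k i) (∨-introˡ b))
        (λ i b → case ∨-elim {bit (fin L) i} (trans (sym (bit-k i)) b) of λ
          { (inj₁ b') → inj₁ b'
          ; (inj₂ b') → inj₂ (subst (Believed r) (sym (≡ᵇ-sound {i} b')) believed ,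
              λ i' b'' → ≤-trans (bit⇒< (fin L) i' b'')
                (≤-trans (≤-trans (m≤n⊔m m (fin L)) le) (≤-reflexive (sym (≡ᵇ-sound {i} b'))))) })
        (subst (λ e → ∀ h → Ev ∅ₛ (decode e) h 0 ⊎ (Ev ∅ₛ (decode e) h 1 × Believed r h)) (sym prog-k) total)
        (subst (λ e → ∀ m → ∃ λ h → m ≤ h × Ev ∅ₛ (decode e) h 1) (sym prog-k) unbounded) ,
        hasAbove-complete {h = h} (≤-trans (m≤m⊔n m (fin L)) le) (trans (bit-k h) (∨-introʳ {bit (fin L) h} (≡ᵇ-refl h)))
      where
      -- Decoding consults the first program of an index; 0 fills the place of the second.
      k : ℕ
      k = ⟨ d , ⟨ e , 0 ⟩ ⟩
      prog-k : prog k ≡ e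
      prog-k = trans (cong π₁ (π₂-⟨⟩ d ⟨ e , 0 ⟩)) (π₁-⟨⟩ e 0)
      bit-k : ∀ i → bit (π₁ k) i ≡ insert (bit (fin L)) h i
      bit-k i = trans (cong (λ v → bit v i) (π₁-⟨⟩ d ⟨ e , 0 ⟩)) (sym (canon i))
      believed : Believed r h
      believed = case total h of λ
        { (inj₁ ev') → case Ev-det ev' ev of λ () ; (inj₂ (_ , b)) → b }

  record Refined (a b : Node) : Set where
    constructor mkRefined
    field
      result : Node
      same-d : d result ≡ d a
      ⊆a : S result ⊆ₛ S a
      ≼b : asCond result ≼ asCond b
      sat : Satisfies G (asCond result)

  opaque
    -- Two conditions satisfied by `G` are compatible, since both reservoirs contain a tail of the
    -- infinite set `G`. The size hypothesis puts the finite part of `b` inside that of `a`, so the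
    -- latter can be kept and the state with it.
    refine : ∀ a b → Satisfies G (asCond a) → Satisfies G (asCond b) → hasAbove (d b) (d a) ≡ true → Refined a b
    refine a b satA@(Da⊆ , G⊆a) satB@(Db⊆ , G⊆b) big = mkRefined
      (thin a T' (λ x → ∧-left) inf (I-intro (both (I-elim₀ (proj₂ (cond a))) (I-elim₀ (proj₂ (cond b))))
        (both (I-elim₁ (proj₂ (cond a))) (I-elim₁ (proj₂ (cond b)))))) refl (λ x → ∧-left)
      (old , (λ x e → G⊆b x (Da⊆ x e)) , λ x → ∧-right {S a x})
      (Da⊆ , inside)
      where
      T' : SetN
      T' x = S a x ∧ S b x
      both : ∀ {Y} → S a ≤T Y → S b ≤T Y → T' ≤T Y
      both p q = RecB⇒≤T (andR (≤T⇒RecB p) (≤T⇒RecB q))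
      inf : InfiniteS T'
      inf m with G-infinite (suc (m ⊔ (d a ⊔ d b)))
      ... | x , le , gx = x , ≤-trans (m≤m⊔n m _) (<⇒≤ le) , ∧-intro
        (Satisfies-above satA (above-intro {G} gx (≤-trans (s≤s (≤-trans (m≤m⊔n (d a) (d b)) (m≤n⊔m m _))) le)))
        (Satisfies-above satB (above-intro {G} gx (≤-trans (s≤s (≤-trans (m≤n⊔m (d a) (d b)) (m≤n⊔m m _))) le)))
      sepA : ∀ x y → x ∈ₛ bit (d a) → y ∈ₛ S a → x < y
      sepA = proj₂ (proj₂ (proj₁ (cond a)))
      late : ∀ x → x ∈ₛ S a → d b < x
      late x sx = let (h , le , bh) = hasAbove-sound big in ≤-trans (s≤s le) (sepA h x bh sx)
      old : bit (d b) ⊆ₛ bit (d a)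
      old x e with ∪-elim {bit (d a)} {S a} (G⊆a x (Db⊆ x e))
      ... | inj₁ e' = e'
      ... | inj₂ sx = ⊥-elim (<-asym (bit⇒< (d b) x e) (late x sx))
      inside : ∀ x → x ∈ₛ G → x ∈ₛ (bit (d a) ∪ₛ T')
      inside x gx with ∪-elim {bit (d a)} {S a} (G⊆a x gx)
      ... | inj₁ e = ∪-introˡ {bit (d a)} {T'} e
      ... | inj₂ sx with ∪-elim {bit (d b)} {S b} (G⊆b x gx)
      ... | inj₁ e = ⊥-elim (<-asym (bit⇒< (d b) x e) (late x sx))
      ... | inj₂ sx' = ∪-introʳ {bit (d a)} {T'} (∧-intro sx sx')

  opaque
    lengthen : ∀ a m → Satisfies G (asCond a) → Σ Node λ c → asCond c ≼ asCond a × Satisfies G (asCond c) × hasAbove m (d c) ≡ true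
    lengthen a m sat@(D⊆ , G⊆) with G-infinite (m ⊔ d a)
    ... | g , le , gg with canonIdx (suc g) (λ x → G x ∧ (x <ᵇ suc g)) bounded
      where
      bounded : ∀ x → suc g ≤ x → G x ∧ (x <ᵇ suc g) ≡ false
      bounded x lt = ¬true⇒false λ e → <⇒≱ (<ᵇ-sound (∧-right {G x} e)) lt
    ... | d' , canon = node d' (S a above g)
        ((bounded , above-infinite (S a) g (infinite a) , sep) , I-down (proj₂ (cond a)) (above-≤T (S a) g)) ,
      ((λ x e → trans (sym (canon x)) (∧-intro (D⊆ x e)
          (<ᵇ-complete (m<n⇒m<1+n (<-≤-trans (bit⇒< (d a) x e) (≤-trans (m≤n⊔m m (d a)) le)))))) ,
       (λ x e → G⊆ x (∧-left (trans (canon x) e))) , above-⊆ (S a) g) ,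
      ((λ x e → ∧-left (trans (canon x) e)) , inside) ,
      hasAbove-complete {h = g} (≤-trans (m≤m⊔n m (d a)) le) (trans (sym (canon g)) (∧-intro gg (<ᵇ-complete {g} ≤-refl)))
      where
      bounded : FiniteS (bit d')
      bounded = d' , λ x le → ¬true⇒false λ e → <⇒≱ (bit⇒< d' x e) le
      sep : ∀ x y → x ∈ₛ bit d' → y ∈ₛ (S a above g) → x < y
      sep x y e s = ≤-trans (<ᵇ-sound (∧-right {G x} (trans (canon x) e))) (above-< (S a) g y s)
      inside : G ⊆ₛ (bit d' ∪ₛ (S a above g))
      inside x gx with x <? suc g
      ... | yes lt = ∪-introˡ {bit d'} {S a above g} (trans (sym (canon x)) (∧-intro gx (<ᵇ-complete lt)))
      ... | no ¬lt = ∪-introʳ {bit d'} {S a above g} (above-intro {S a} (Satisfies-above sat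
        (above-intro {G} gx (≤-trans (s≤s (≤-trans (m≤n⊔m m (d a)) le)) (≮⇒≥ ¬lt)))) (≮⇒≥ ¬lt))

  -- The decoded set and its genericity

  module Result (avoided : Avoided (λ _ → ⊤) (unmarkedφ Z)) where

    open Coding avoided

    pushed⇒good : ∀ {c L k} (p : Pushed c L k) → GoodNode (Pushed.result p)
    pushed⇒good {c} {L} {k} (mkPushed res _ ready pushed const) = ready , λ x y x<y sx sy →
      trans (cong (λ L → cur L x y) pushed) (trans (const x y x<y sx sy) (cong suc (sym (trans (cong hd pushed) (hd-cons k L)))))

    opaque
      -- Two elements far enough apart make the state ready. By `cur-limit` the reservoir can then
      -- be thinned until the belief is constant, which neutralises wrong indices already accepted;
      -- pushing an index that grows inside this belief gives a good node.
      dense : ∀ c → asCond c ≼ asCond base → ∀ m →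
        Σ Node λ c' → asCond c' ≼ asCond c × GoodNode c' × bigΘ m (d c') ≡ true
      dense c c≼ m with infinite c m
      ... | v , m≤v , sv with append c v sv
      ... | mkAppended c₁ c₁≼ st₁ refl hasV with modulus v
      ... | mv , quiet with infinite c₁ mv
      ... | w , mv≤w , sw with append c₁ w sw
      ... | mkAppended c₂ c₂≼ st₂ refl _ with cur-limit (accepted (σ c₂))
      ... | r , x₀ , lim with sparsify (cond c₃) (λ x y → cur L x y ≡ᵇ r)
          (≡ᵇR (curR (constR L) (π₁R idR) var) (constR r))
          (λ x sx → let (M , f) = lim x (<⇒≤ (above-< (S c₂) x₀ x sx)) in M , λ y le _ _ → ≡ᵇ-complete (f y le))
        where
        L : ℕ
        L = accepted (σ c₂)
        c₃ : Node
        c₃ = cut c₂ x₀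
      ... | S₄ , cond₄ , S₄⊆ , const with grow-index {accepted (σ c₂)} m
          (reservoir (node (d c₂) S₄ cond₄) {accepted (σ c₂)} r (λ x y x<y sx sy → ≡ᵇ-sound (const x y x<y sx sy)))
      ... | k , growable , big = finish (push-index c₄ (≼-trans {asCond c₄} {asCond c} {asCond base} c₄≼c c≼) ready₄
          (λ x y x<y sx sy → ≡ᵇ-sound (const x y x<y sx sy)) k growable)
        where
        c₄ : Node
        c₄ = node (d c₂) S₄ cond₄
        c₄≼c : asCond c₄ ≼ asCond c
        c₄≼c = ≼-trans {asCond c₄} {asCond c₂} {asCond c}
          ((λ _ e → e) , (λ _ → ∪-introˡ {bit (d c₂)} {S c₂}) , λ x s → above-⊆ (S c₂) x₀ x (S₄⊆ x s))
          (≼-trans {asCond c₂} {asCond c₁} {asCond c} c₂≼ c₁≼)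
        ready₄ : Ready (σ c₄) S₄
        ready₄ z _ = trans (cong (λ σ → mark Z (older σ) (newer σ) z) (trans st₂ (cong (λ σ → next σ w) st₁))) (quiet w z mv≤w)
        finish : Pushed c₄ (accepted (σ c₂)) k → Σ Node λ c' → asCond c' ≼ asCond c × GoodNode c' × bigΘ m (d c') ≡ true
        finish p@(mkPushed c₅ c₅≼ _ pushed _) = c₅ , ≼-trans {asCond c₅} {asCond c₄} {asCond c} c₅≼ c₄≼c , pushed⇒good p ,
          ∧-intro (hasAbove-complete m≤v (proj₁ c₅≼ v (proj₁ c₂≼ v hasV)))
            (subst (λ d → hasAbove m d ≡ true) (sym (trans (cong fin pushed) (fin-cons k (accepted (σ c₂))))) big)

    record GoodMet (m : ℕ) : Set where
      constructor mkGoodMet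
      field
        c : Node
        sat : Satisfies G (asCond c)
        good : GoodNode c
        long : hasAbove m (d c) ≡ true
        large : hasAbove m (fin (accepted (σ c))) ≡ true

    opaque
      -- If good conditions were avoided, the avoiding condition and `base`, both satisfied by `G`,
      -- would have a common extension, and `dense` would find a good one below it.
      good-met : ∀ m → GoodMet m
      good-met m with met-or-avoided (λ d → bigΘ m d ≡ true) goodφ (bigΘ-Sig m) goodφR
      ... | inj₁ (mkMet d S cond sat θ tr) = mkGoodMet (node d S cond) sat (triples⇒good (node d S cond) tr)
        (∧-left θ) (∧-right {hasAbove m d} θ)
      ... | inj₂ (mkAvoided d S cond sat none) with lengthen (node d S cond) (Node.d base) sat
      ... | c₁ , c₁≼ , sat₁ , big with refine c₁ base sat₁ (Avoided.sat avoided) big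
      ... | mkRefined c₂ refl S⊆ ≼base _ with dense c₂ ≼base m
      ... | c₃ , c₃≼ , good , θ = ⊥-elim (none (Node.d c₃) (Node.S c₃)
        (≼-trans {asCond c₃} {asCond c₂} {bit d , S} c₃≼
          (≼-trans {asCond c₂} {asCond c₁} {bit d , S} ((λ _ e → e) , (λ _ → ∪-introˡ {bit (Node.d c₁)} {Node.S c₁}) , S⊆) c₁≼))
        (Node.cond c₃) θ (good⇒triples c₃ good))

    E : ℕ → ℕ
    E s = fin (accepted (run G s))

    opaque
      growth : ∀ v → ∃ λ s → hasAbove v (E s) ≡ true
      growth v with good-met v
      ... | mkGoodMet c sat _ _ large with run-satisfies (proj₁ (cond c)) sat
      ... | b , eq , _ = b , subst (λ σ → hasAbove v (fin (accepted σ)) ≡ true) (sym eq) large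

    H : SetN
    H v = bit (E (proj₁ (growth v))) v

    E⊆H : ∀ s → bit (E s) ⊆ₛ H
    E⊆H s x e with growth x
    ... | t , big with ≤-total s t
    ... | inj₁ s≤t = EndExt.keep (run-EndExt G s≤t) x e
    ... | inj₂ t≤s with EndExt.new (run-EndExt G t≤s) x e | hasAbove-sound big
    ... | inj₁ b | _ = b
    ... | inj₂ above | h , x≤h , bh = ⊥-elim (<⇒≱ (above h bh) x≤h)

    H-late : ∀ s x → x ∈ₛ H → ∃ λ t → s ≤ t × bit (E t) x ≡ true
    H-late s x e = s ⊔ proj₁ (growth x) , m≤m⊔n s _ , EndExt.keep (run-EndExt G (m≤n⊔m s (proj₁ (growth x)))) x e

    H-stable : ∀ s x → hasAbove x (E s) ≡ true → bit (E s) x ≡ H x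
    H-stable s x big = bool-ext (E⊆H s x) λ e → let (t , s≤t , bt) = H-late s x e in
      case EndExt.new (run-EndExt G s≤t) x bt of λ
        { (inj₁ b) → b
        ; (inj₂ above) → let (h , x≤h , bh) = hasAbove-sound big in ⊥-elim (<⇒≱ (above h bh) x≤h) }

    H≤T : H ≤T G
    H≤T = RecB⇒≤T (RecB-ext (λ x → H-stable (stage x) x (stage-grown x)) (bitR (ER stageR) idR))
      where
      ER : ∀ {f} → Rec G f → Rec G (λ z → E (f z))
      ER {f} F = π₁R (π₁R (predR (acceptedR {X = λ _ → G} Z≤G (orcR var) F)))
      grown : ℕ → ℕ → Bool
      grown x s = hasAbove x (E s)
      stage : ℕ → ℕ
      stage x = proj₁ (least (grown x) (proj₁ (growth x)) (proj₂ (growth x)))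
      stage-grown : ∀ x → grown x (stage x) ≡ true
      stage-grown x = proj₁ (proj₂ (least (grown x) (proj₁ (growth x)) (proj₂ (growth x))))
      stageR : Rec G stage
      stageR = muR {p = grown} {n = λ x → proj₁ (growth x)} (hasAboveR (π₁R idR) (ER var)) (λ x → proj₂ (growth x))

    finOf : Node → ℕ
    finOf c = fin (accepted (σ c))

    good-keep : ∀ c → Satisfies G (asCond c) → bit (finOf c) ⊆ₛ H
    good-keep c sat x e with run-satisfies (proj₁ (cond c)) sat
    ... | b , eq , _ = E⊆H b x (subst (λ σ → bit (fin (accepted σ)) x ≡ true) (sym eq) e)

    -- `Preservation` puts later elements into the set of the latest index, and end extension puts
    -- them beyond the finite part.
    good-new : ∀ c → Satisfies G (asCond c) → GoodNode c → ∀ x → x ∈ₛ H → bit (finOf c) x ≡ true ⊎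
      (Ev ∅ₛ (decode (prog (headOf c))) x 1 × (∀ h → bit (finOf c) h ≡ true → h < x))
    good-new c sat (ready , const) x e with run-satisfies (proj₁ (cond c)) sat
    ... | b , eq , G⊆S with H-late b x e
    ... | t , b≤t , bt with Preservation.Inv.believed (Preservation.inv eq G⊆S ready const b≤t) x bt
      | EndExt.new (run-EndExt G b≤t) x bt
    ... | inj₁ old | _ = inj₁ old
    ... | inj₂ ev | inj₁ old = inj₁ (subst (λ σ → bit (fin (accepted σ)) x ≡ true) eq old)
    ... | inj₂ ev | inj₂ above = inj₂ (ev , λ h bh → above h (subst (λ σ → bit (fin (accepted σ)) h ≡ true) (sym eq) bh))

    record Projection (c : Node) : Set where
      constructor mkProjection
      field
        R : SetN
        condC : ICond COMP (bit (finOf c) , R)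
        satH : Satisfies H (bit (finOf c) , R)
        R-sound : ∀ x → x ∈ₛ R → Ev ∅ₛ (decode (prog (headOf c))) x 1 × (∀ h → bit (finOf c) h ≡ true → h < x)

    -- The computable condition that a good condition imposes on H.
    opaque
      projection : ∀ c → Satisfies G (asCond c) → GoodNode c → Projection c
      projection c sat good@(_ , const) = mkProjection R
        (((finOf c , λ x le → ¬true⇒false λ e → <⇒≱ (bit⇒< (finOf c) x e) le) , infR ,
          λ x y e r → proj₂ (R-sound y r) x e) , R≤T)
        (good-keep c sat , covered) R-sound
        where
        k : ℕ
        k = headOf c
        total : ∀ h → Ev ∅ₛ (decode (prog k)) h 0 ⊎ Ev ∅ₛ (decode (prog k)) h 1
        total = const-total c const
        value : ∀ {h} → Ev ∅ₛ (decode (prog k)) h 0 ⊎ Ev ∅ₛ (decode (prog k)) h 1 → Bool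
        value (inj₁ _) = false
        value (inj₂ _) = true
        Q : SetN
        Q h = value (total h)
        Q-Ev : ∀ h → Ev ∅ₛ (decode (prog k)) h (χ Q h)
        Q-Ev h with total h
        ... | inj₁ ev = ev
        ... | inj₂ ev = ev
        beyond : ℕ → Bool
        beyond x = ball (λ h → bit (finOf c) h ⇒ᵇ (h <ᵇ x)) (finOf c)
        beyond-sound : ∀ x → beyond x ≡ true → ∀ h → bit (finOf c) h ≡ true → h < x
        beyond-sound x e h bh = <ᵇ-sound (⇒ᵇ-elim (ball-sound (finOf c) e (bit⇒< (finOf c) h bh)) bh)
        beyond-complete : ∀ x → (∀ h → bit (finOf c) h ≡ true → h < x) → beyond x ≡ true
        beyond-complete x f = ball-complete (finOf c) λ h _ → ⇒ᵇ-intro λ bh → <ᵇ-complete (f h bh)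
        -- The set of `prog k` may reach down into the range of the finite part; `beyond` restores
        -- the separation required of a Mathias condition.
        R : SetN
        R x = Q x ∧ beyond x
        R-sound : ∀ x → x ∈ₛ R → Ev ∅ₛ (decode (prog k)) x 1 × (∀ h → bit (finOf c) h ≡ true → h < x)
        R-sound x r = subst (Ev ∅ₛ _ x) (cong b2n (∧-left r)) (Q-Ev x) , beyond-sound x (∧-right {Q x} r)
        R-complete : ∀ x → Ev ∅ₛ (decode (prog k)) x 1 → (∀ h → bit (finOf c) h ≡ true → h < x) → x ∈ₛ R
        R-complete x ev f = ∧-intro (χ-injective (Ev-det (Q-Ev x) ev)) (beyond-complete x f)
        R≤T : R ≤T ∅ₛ
        R≤T = RecB⇒≤T (andR (≤T⇒RecB (decode (prog k) , Q-Ev))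
          (ballR {p = λ x h → bit (finOf c) h ⇒ᵇ (h <ᵇ x)}
            (⇒R (bitR (constR (finOf c)) var) (<ᵇR var (π₁R idR))) (constR (finOf c))))
        infR : InfiniteS R
        infR m with const-infinite c const (m ⊔ finOf c)
        ... | h , le , ev = h , ≤-trans (m≤m⊔n m _) le , R-complete h ev λ h' b →
          ≤-trans (bit⇒< (finOf c) h' b) (≤-trans (m≤n⊔m m _) le)
        covered : H ⊆ₛ (bit (finOf c) ∪ₛ R)
        covered x e with good-new c sat good x e
        ... | inj₁ b = ∪-introˡ {bit (finOf c)} {R} b
        ... | inj₂ (ev , f) = ∪-introʳ {bit (finOf c)} {R} (R-complete x ev f)

    module _ (C : Collection) (sub : ∀ c → C c → ICond COMP c) (W : ℕ → Set)
      (iff : ∀ k → (W k → Σ Cond λ c → C c × IndexC k c) × ((Σ Cond λ c → C c × IndexC k c) → W k)) where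

      meets : Met (λ d → W (hd (accepted (final d)))) goodφ → Meets H C
      meets (mkMet d S cond sat θ tr) = let (c' , Cc' , idx) = proj₁ (iff (headOf c)) θ in c' , Cc' , transfer c' idx
        where
        c : Node
        c = node d S cond
        transfer : ∀ c' → IndexC (headOf c) c' → Satisfies H c'
        transfer (D' , S') idx with IndexC-parts idx
        ... | canon , computes = (λ x e → good-keep c sat x (trans (sym (canon x)) e)) ,
          λ x e → case good-new c sat (triples⇒good c tr) x e of λ
            { (inj₁ b) → ∪-introˡ {D'} {S'} (trans (canon x) b)
            ; (inj₂ (ev , _)) → ∪-introʳ {D'} {S'} (χ-injective (Ev-det (computes x) ev)) }

      opaque
        -- The index of `c'` is growable over the current belief because `c'` extends the
        -- projection, so it can be pushed. The resulting node is good and has an element of `W` at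
        -- the head of its list.
        no-extension : ∀ c → asCond c ≼ asCond base → Satisfies G (asCond c) → GoodNode c → (p : Projection c) →
          ∀ c' → c' ≼ (bit (finOf c) , Projection.R p) → C c' →
          Σ Node λ e → asCond e ≼ asCond c × GoodNode e × W (headOf e)
        no-extension c c≼ sat good@(ready , const) (mkProjection R condC satH R-sound) (D' , S') (keep , new , S'⊆R) Cc'
          with index-of (sub (D' , S') Cc')
        ... | k , idx with IndexC-parts idx
        ... | canon , computes with push-index c c≼ ready const k growable
          where
          growable : Growable (accepted (σ c)) (suc (headOf c)) k
          growable = mkGrowable (λ h b → trans (sym (canon h)) (keep h b))
            (λ h b → case ∪-elim {bit (finOf c)} {R} (new h (trans (canon h) b)) of λ
              { (inj₁ b') → inj₁ b'
              ; (inj₂ r) → inj₂ (Ev⇒Believed (headOf c) h (proj₁ (R-sound h r)) , proj₂ (R-sound h r)) })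
            (λ h → decided h (S' h) refl)
            (λ m → let (h , m≤h , sh) = proj₁ (proj₂ (proj₁ (sub (D' , S') Cc'))) m in
              h , m≤h , subst (Ev ∅ₛ _ h) (cong b2n sh) (computes h))
            where
            decided : ∀ h v → S' h ≡ v → Ev ∅ₛ (decode (prog k)) h 0 ⊎ (Ev ∅ₛ (decode (prog k)) h 1 × Believed (suc (headOf c)) h)
            decided h false eq = inj₁ (subst (Ev ∅ₛ _ h) (cong b2n eq) (computes h))
            decided h true eq = inj₂ (subst (Ev ∅ₛ _ h) (cong b2n eq) (computes h) ,
              Ev⇒Believed (headOf c) h (proj₁ (R-sound h (S'⊆R h eq))))
        ... | p@(mkPushed e e≼ _ pushed _) = e , e≼ , pushed⇒good p ,
          subst W (sym (trans (cong hd pushed) (hd-cons k (accepted (σ c))))) (proj₂ (iff k) ((D' , S') , Cc' , idx))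

      -- A good condition longer than `d'` and the finite part of `base` is intersected with the
      -- avoiding condition and with `base`. The finite part, hence the state, is unchanged, and
      -- goodness passes to smaller reservoirs.
      avoids : Avoided (λ d → W (hd (accepted (final d)))) goodφ → Avoids COMP H C
      avoids (mkAvoided d' S' cond' sat' none) with good-met (d' ⊔ Node.d base)
      ... | mkGoodMet c sat good long _ with refine c (node d' S' cond') sat sat' (hasAbove-weaken (m≤m⊔n d' _) long)
      ... | mkRefined c₁ eq₁ S⊆₁ c₁≼ sat₁ with refine c₁ base sat₁ (Avoided.sat avoided)
          (subst (λ v → hasAbove (Node.d base) v ≡ true) (sym eq₁) (hasAbove-weaken (m≤n⊔m d' (Node.d base)) long))
      ... | mkRefined c₂ eq₂ S⊆₂ c₂≼ sat₂ = (bit (finOf c₂) , Projection.R p) , Projection.condC p , Projection.satH p ,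
        λ c' ext Cc' → let (e , e≼ , goodE , w) = no-extension c₂ c₂≼ sat₂ good₂ p c' ext Cc' in
          none (d e) (S e) (≼-trans {asCond e} {asCond c₂} {bit d' , S'} e≼
              (≼-trans {asCond c₂} {asCond c₁} {bit d' , S'} c₂≼c₁ c₁≼))
            (cond e) w (good⇒triples e goodE)
        where
        d₂≡ : d c₂ ≡ d c
        d₂≡ = trans eq₂ eq₁
        good₂ : GoodNode c₂
        good₂ = (λ x s → subst (λ v → mark Z (older (final v)) (newer (final v)) x ≡ false) (sym d₂≡)
            (proj₁ good x (S⊆₁ x (S⊆₂ x s)))) ,
          λ x y x<y sx sy → subst (λ v → cur (accepted (final v)) x y ≡ suc (hd (accepted (final v)))) (sym d₂≡)
            (proj₂ good x y x<y (S⊆₁ x (S⊆₂ x sx)) (S⊆₁ y (S⊆₂ y sy)))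
        p : Projection c₂
        p = projection c₂ sat₂ good₂
        c₂≼c₁ : asCond c₂ ≼ asCond c₁
        c₂≼c₁ = (λ x e → subst (λ v → bit v x ≡ true) (sym eq₂) e) ,
          (λ x e → ∪-introˡ {bit (d c₁)} {S c₁} (subst (λ v → bit v x ≡ true) eq₂ e)) , S⊆₂

    H-generic : Generic n COMP ∅ₛ ∅ₛ H
    H-generic C sub (W , WΣ , iff) with met-or-avoided (λ d → W (hd (accepted (final d)))) goodφ
      (Sig-reindex (π₁R (predR finalR)) (Sig-rel ∅⊕∅-≤T (IsΣ⇒Sig {n} WΣ))) goodφR
    ... | inj₁ met = inj₁ (meets C sub W iff met)
    ... | inj₂ avoided' = inj₂ (avoids C sub W iff avoided')

-- Iteration of the jump step and combination of the two cases

module Main {I : Ideal} {A₀ A₁ : SetN} (exact : ExactPair I A₀ A₁) {n : ℕ} (n≥3 : 3 ≤ n)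
  {G : SetN} (gen : Generic n I A₀ A₁ G) where

  open Ideals exact
  open JumpStep exact n≥3 gen

  ComputesGeneric : Set₁
  ComputesGeneric = Σ SetN λ H → (H ≤T G) × Generic n COMP ∅ₛ ∅ₛ H

  climb : ∀ j → (Σ SetN λ Z → Tower j Z × I Z × Z ≤T G) ⊎ ComputesGeneric
  climb zero = inj₁ (∅ₛ , tt , I-intro ∅-≤T ∅-≤T , ∅-≤T)
  climb (suc j) with climb j
  ... | inj₂ done = inj₂ done
  ... | inj₁ (Z , tower , iz , Z≤G) with jump-or-avoid Z iz Z≤G
  ... | inj₁ (Z' , jump , iz' , Z'≤G) = inj₁ (Z' , (Z , tower , jump) , iz' , Z'≤G)
  ... | inj₂ avoided = inj₂ (H , H≤T , H-generic)
    where open Decoding.Result exact n≥3 gen iz Z≤G avoided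

theorem5p6 : (I : Ideal) (A₀ A₁ : SetN) → IsIdeal I → ExactPair I A₀ A₁ →
    (n : ℕ) → 3 ≤ n → (G : SetN) → Generic n I A₀ A₁ G →
    Σ SetN λ H → (H ≤T G) × Generic n COMP ∅ₛ ∅ₛ H
-- With `n` equal to `suc m`, this is the height `n + 2` required by `Construction`.
theorem5p6 I A₀ A₁ _ exact (suc m) n≥3 G gen with Main.climb exact n≥3 gen (suc (suc (suc m)))
... | inj₂ done = done
... | inj₁ (Z , tower , _ , Z≤G) = H , ≤T-trans H≤T Z≤G , H-generic
  where open Construction m tower
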